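{- Let $n$ be a positive odd integer, let $a,b,c$ be indeterminates, and let $M$ be either $n-1$ or $(n-1)/2$. Then, modulo $[n](1-aq^n)(a-q^n)$, \[ \sum_{k=0}^{M}[3k+1]\frac{(aq,q/a,q;q^2)_k\, (q/b,q/c,bc;q)_k} {(aq,q/a,q;q)_k\, (bq^2,cq^2,q^3/bc;q^2)_k}\, q^k \equiv\frac{(bcq,q^2/b,q^2/c;q^2)_{(n-1)/2}} {(q^3/bc,bq^2,cq^2;q^2)_{(n-1)/2}}\,[n]. \]
   Context: Here $q,a,b,c$ are indeterminates. For $x$ and a base $p$ (a power of $q$), $(x;p)_k=\prod_{j=0}^{k-1}(1-xp^j)$ and $(x_1,\dots,x_m;p)_k=(x_1;p)_k\cdots(x_m;p)_k$. The $q$-integer is $[j]=1+q+\cdots+q^{j-1}$. For rational functions $A,B$ in $q,a,b,c$ and a polynomial $P$, $A\equiv B\pmod{P}$ means that the numerator of the reduced form of $A-B$ is divisible by $P$ in the polynomial ring over $\mathbb{Z}$ in these variables. -}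

module Defs where

open import Data.Nat as ℕ using (ℕ; zero; suc)
open import Data.Integer as ℤ using (ℤ)
open import Data.List using (List; []; _∷_; map)
open import Data.Vec using (Vec; []; _∷_)
open import Data.Fin using (Fin; zero; suc)
open import Data.Product using (Σ; _×_; _,_)
open import Relation.Binary.PropositionalEquality using (_≡_)
open import Relation.Nullary using (¬_)

-- Multivariate polynomials over ℤ in n variables, dense nested form:
-- Poly (suc n) = polynomials in the first variable with coefficients
-- in Poly n (lowest degree first).  Equality is coefficientwise.

infixl 6 _+P_ _-P_ _+F_ _-F_
infixl 7 _*P_ _*F_ _/F_
infixr 8 _^F_ _^P_
infix 4 _≈P_ _∣P_

Poly : ℕ → Set
Poly zero    = ℤ
Poly (suc n) = List (Poly n)

0P : ∀ {n} → Poly n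
0P {zero}  = ℤ.0ℤ
0P {suc n} = []

constP : ∀ {n} → ℤ → Poly n
constP {zero}  z = z
constP {suc n} z = constP z ∷ []

1P : ∀ {n} → Poly n
1P = constP ℤ.1ℤ

_+P_ : ∀ {n} → Poly n → Poly n → Poly n
_+P_ {zero}  x y = x ℤ.+ y
_+P_ {suc n} []       ys       = ys
_+P_ {suc n} (x ∷ xs) []       = x ∷ xs
_+P_ {suc n} (x ∷ xs) (y ∷ ys) = (x +P y) ∷ (xs +P ys)

-P_ : ∀ {n} → Poly n → Poly n
-P_ {zero}  x  = ℤ.- x
-P_ {suc n} xs = map (-P_ {n}) xs

_*P_ : ∀ {n} → Poly n → Poly n → Poly n
_*P_ {zero}  x y = x ℤ.* y
_*P_ {suc n} []       ys = []
_*P_ {suc n} (x ∷ xs) ys = map (_*P_ {n} x) ys +P (0P ∷ (xs *P ys))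

_-P_ : ∀ {n} → Poly n → Poly n → Poly n
x -P y = x +P (-P y)

varP : ∀ {n} → Fin n → Poly n
varP {suc n} zero    = 0P ∷ 1P ∷ []
varP {suc n} (suc i) = varP i ∷ []

coeff : ∀ {n} → Poly n → Vec ℕ n → ℤ
coeff {zero}  z        []            = z
coeff {suc n} []       _             = ℤ.0ℤ
coeff {suc n} (p ∷ ps) (zero  ∷ e)   = coeff p e
coeff {suc n} (p ∷ ps) (suc k ∷ e)   = coeff ps (k ∷ e)

_≈P_ : ∀ {n} → Poly n → Poly n → Set
p ≈P r = ∀ e → coeff p e ≡ coeff r e

_∣P_ : ∀ {n} → Poly n → Poly n → Set
_∣P_ {n} h f = Σ (Poly n) λ r → f ≈P (h *P r)

IsUnitP : ∀ {n} → Poly n → Set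
IsUnitP {n} h = Σ (Poly n) λ u → (h *P u) ≈P 1P

CoprimeP : ∀ {n} → Poly n → Poly n → Set
CoprimeP {n} f g = ∀ (h : Poly n) → h ∣P f → h ∣P g → IsUnitP h

P4 : Set
P4 = Poly 4

record Frac : Set where
  constructor _//_
  field
    num : P4
    den : P4
open Frac public

fromP : P4 → Frac
fromP p = p // 1P

_+F_ : Frac → Frac → Frac
(x // y) +F (z // w) = ((x *P w) +P (z *P y)) // (y *P w)

_-F_ : Frac → Frac → Frac
(x // y) -F (z // w) = ((x *P w) -P (z *P y)) // (y *P w)

_*F_ : Frac → Frac → Frac
(x // y) *F (z // w) = (x *P z) // (y *P w)

_/F_ : Frac → Frac → Frac
(x // y) /F (z // w) = (x *P w) // (y *P z)

1F : Frac
1F = fromP 1P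

0F : Frac
0F = fromP 0P

_^F_ : Frac → ℕ → Frac
x ^F zero  = 1F
x ^F suc k = x *F (x ^F k)

prodF : ℕ → (ℕ → Frac) → Frac
prodF zero    f = 1F
prodF (suc k) f = prodF k f *F f k

sumF : ℕ → (ℕ → Frac) → Frac
sumF zero    f = 0F
sumF (suc k) f = sumF k f +F f k

qP aP bP cP : P4
qP = varP zero
aP = varP (suc zero)
bP = varP (suc (suc zero))
cP = varP (suc (suc (suc zero)))

q a b c : Frac
q = fromP qP
a = fromP aP
b = fromP bP
c = fromP cP

poch : Frac → Frac → ℕ → Frac
poch x p k = prodF k λ j → 1F -F (x *F (p ^F j))

_^P_ : P4 → ℕ → P4
x ^P zero  = 1P
x ^P suc k = x *P (x ^P k)

qint : ℕ → P4
qint zero    = 0P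
qint (suc j) = qint j +P (qP ^P j)

-- A ≡ B (mod P): the numerator of the reduced form of A - B is divisible
-- by P.  Writing A - B = U/V (U = num, V = den of the difference), this
-- says: A - B = (P·R)/S for some R, S with S ≠ 0 and P·R, S coprime,
-- i.e. P·R / S is the reduced form of A - B and P divides its numerator.
CongMod : Frac → Frac → P4 → Set
CongMod A B P =
  let D = A -F B in
  Σ P4 λ R → Σ P4 λ S →
    (¬ (S ≈P 0P)) × CoprimeP (P *P R) S × ((num D *P S) ≈P ((P *P R) *P den D))

q² q³ : Frac
q² = q ^F 2
q³ = q ^F 3

summand : ℕ → Frac
summand k =
  fromP (qint (3 ℕ.* k ℕ.+ 1))
  *F ((poch (a *F q) q² k *F poch (q /F a) q² k *F poch q q² k
        *F poch (q /F b) q k *F poch (q /F c) q k *F poch (b *F c) q k)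
      /F (poch (a *F q) q k *F poch (q /F a) q k *F poch q q k
        *F poch (b *F q²) q² k *F poch (c *F q²) q² k
        *F poch (q³ /F (b *F c)) q² k))
  *F (q ^F k)

lhs : ℕ → Frac
lhs M = sumF (suc M) summand

-- right-hand side, with m = (n-1)/2
rhs : ℕ → ℕ → Frac
rhs n m =
  ((poch (b *F c *F q) q² m *F poch (q² /F b) q² m *F poch (q² /F c) q² m)
   /F (poch (q³ /F (b *F c)) q² m *F poch (b *F q²) q² m *F poch (c *F q²) q² m))
  *F fromP (qint n)

modulus : ℕ → P4
modulus n = (qint n *P (1P -P (aP *P (qP ^P n)))) *P (aP -P (qP ^P n))

{-# OPTIONS --safe #-}
module Submission where

-- The difference of the two sides is put in lowest terms, ℤ[q,a,b,c] being a GCD domain by Gauss's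
-- lemma.  A factor f of the modulus divides the reduced numerator if the two sides agree in the ring
-- of fractions, modulo f, whose denominators are regular modulo f.  Modulo 1 - aqⁿ or a - qⁿ the sum
-- terminates and is Rahman's quadratic summation; this follows from a telescoping relation between
-- the sums with parameters (A,d,b) and (Aq²,dq²,bq²), which also shows that the sum vanishes when
-- A = q⁻²ᵐ.  The second case applies modulo a divisor of [n] on which q is a primitive root of unity
-- of odd order o = 2m + 1, where A = q = q⁻²ᵐ: the first m + 1 terms of a period add up to 0, the
-- others are 0, and each period is a multiple of the first one.  As [n] is squarefree, it is the
-- product of such divisors.

open import Defs hiding (q; a; b; c)
import Defs as F
open import Algebra.Bundles using (CommutativeRing)
import Algebra.Properties.CommutativeSemigroup as CommutativeSemigroupProperties
import Algebra.Properties.Group as GroupProperties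
import Algebra.Properties.Ring as RingProperties
import Algebra.Properties.Semiring.Exp as Exp
import Algebra.Properties.Semiring.Mult as Mult
open import Algebra.Structures using (IsCommutativeRing)
open import Data.Bool.Base using (Bool; true; false; T; _∧_; if_then_else_)
open import Data.Empty using (⊥; ⊥-elim)
open import Data.Fin.Base using (Fin; zero; suc)
import Data.Fin.Properties as Fin
open import Data.Integer.Base as ℤ using (ℤ; +_; -[1+_])
import Data.Integer.Divisibility.Signed as ℤ-Div
import Data.Integer.GCD as ℤ-GCD
import Data.Integer.Properties as ℤₚ
open import Data.List.Base using (List; []; _∷_; map)
open import Data.Nat.Base as ℕ using (ℕ; zero; suc; s≤s; z≤n)
import Data.Nat.Divisibility as ℕ-Div
open import Data.Nat.GCD as ℕ-GCD using (module Bézout)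
import Data.Nat.Properties as ℕₚ
open import Data.Nat.Tactic.RingSolver using (solve-∀)
open import Data.Product.Base using (Σ; _×_; _,_; proj₁; proj₂)
open import Data.Sum.Base as Sum using (_⊎_; inj₁; inj₂)
open import Data.Unit.Base using (⊤; tt)
open import Data.Vec.Base as Vec using (Vec; []; _∷_; _∷ʳ_; initLast; replicate)
open import Data.Vec.N-ary using (N-ary; Eq; curryⁿ; curryⁿ-cong; _$ⁿ_)
open import Function.Base using (case_of_)
open import Level using (0ℓ; _⊔_)
open import Relation.Binary.Bundles using (Setoid)
open import Relation.Binary.PropositionalEquality as ≡ using (_≡_)
import Relation.Binary.Reasoning.Setoid as SetoidReasoning
open import Relation.Nullary using (¬_; Dec; yes; no; does)

-- Nested coefficient lists form a commutative ring

-- The obstacle is that (q;q)ₖ vanishes at a root of unity of order o once k ≥ o, so the summands as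
-- written cannot be reduced modulo a divisor of [n]. But (q;q²)ₖ/(q;q)ₖ is a central Gaussian
-- binomial coefficient over (-q;q)ₖ, and for odd o a common divisor of 1 + q^j and 1 - q^o divides
-- 2, hence is a unit. Irreducible factors are avoided throughout. That q is a primitive o-th root
-- of unity modulo h means that h divides 1 - q^o and is coprime to 1 - q^j for 0 < j < o; gcds
-- split [n] into such parts, and in a GCD domain coprimality to h implies regularity modulo h.
-- Coprimality itself comes from substitutions: a divisor of a nonzero polynomial avoids every
-- variable which that polynomial avoids, so a substitution for these variables fixes the divisor,
-- while it can be chosen to turn the other polynomial into 1. For squarefreeness, t² ∣ 1 - q^n
-- forces t to divide the integer n, by differentiation in q; and a common divisor of n and 1 - q^n
-- is a unit, as q = 0 shows.

infix 4 _≋_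

-- A record, so that both sides can be inferred from an equality proof.
record _≋_ {n} (p r : Poly n) : Set where
  constructor coeffs
  field coeffwise : p ≈P r
open _≋_ public

module _ {n : ℕ} where

  ≋-refl : {p : Poly n} → p ≋ p
  ≋-refl = coeffs λ _ → ≡.refl

  ≋-sym : {p r : Poly n} → p ≋ r → r ≋ p
  ≋-sym e = coeffs λ i → ≡.sym (coeffwise e i)

  ≋-trans : {p r s : Poly n} → p ≋ r → r ≋ s → p ≋ s
  ≋-trans e f = coeffs λ i → ≡.trans (coeffwise e i) (coeffwise f i)

polySetoid : ℕ → Setoid 0ℓ 0ℓ
polySetoid n = record
  { Carrier = Poly n
  ; _≈_ = _≋_
  ; isEquivalence = record { refl = ≋-refl ; sym = ≋-sym ; trans = ≋-trans }
  }

coeff-0P : ∀ {n} (e : Vec ℕ n) → coeff 0P e ≡ ℤ.0ℤ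
coeff-0P {zero}  []      = ≡.refl
coeff-0P {suc n} (_ ∷ _) = ≡.refl

coeff-+P : ∀ {n} (p r : Poly n) e → coeff (p +P r) e ≡ coeff p e ℤ.+ coeff r e
coeff-+P {zero}  p        r        []          = ≡.refl
coeff-+P {suc n} []       r        (k ∷ e)     = ≡.sym (ℤₚ.+-identityˡ _)
coeff-+P {suc n} (x ∷ xs) []       (k ∷ e)     = ≡.sym (ℤₚ.+-identityʳ _)
coeff-+P {suc n} (x ∷ xs) (y ∷ ys) (zero ∷ e)  = coeff-+P x y e
coeff-+P {suc n} (x ∷ xs) (y ∷ ys) (suc k ∷ e) = coeff-+P xs ys (k ∷ e)

coeff--P : ∀ {n} (p : Poly n) e → coeff (-P p) e ≡ ℤ.- coeff p e
coeff--P {zero}  p        []          = ≡.refl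
coeff--P {suc n} []       (k ∷ e)     = ≡.refl
coeff--P {suc n} (x ∷ xs) (zero ∷ e)  = coeff--P x e
coeff--P {suc n} (x ∷ xs) (suc k ∷ e) = coeff--P xs (k ∷ e)

module _ {n : ℕ} where

  +P-cong : {p p′ r r′ : Poly n} → p ≋ p′ → r ≋ r′ → p +P r ≋ p′ +P r′
  +P-cong {p} {p′} {r} {r′} f g = coeffs λ e →
    ≡.trans (coeff-+P p r e)
      (≡.trans (≡.cong₂ ℤ._+_ (coeffwise f e) (coeffwise g e)) (≡.sym (coeff-+P p′ r′ e)))

  +P-congˡ : (p : Poly n) {r r′ : Poly n} → r ≋ r′ → p +P r ≋ p +P r′
  +P-congˡ p = +P-cong {p} ≋-refl

  -P-cong : {p p′ : Poly n} → p ≋ p′ → -P p ≋ -P p′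
  -P-cong {p} {p′} f = coeffs λ e →
    ≡.trans (coeff--P p e) (≡.trans (≡.cong ℤ.-_ (coeffwise f e)) (≡.sym (coeff--P p′ e)))

  +P-assoc : (p r s : Poly n) → (p +P r) +P s ≋ p +P (r +P s)
  +P-assoc p r s = coeffs λ e → begin
    coeff ((p +P r) +P s) e                   ≡⟨ coeff-+P (p +P r) s e ⟩
    coeff (p +P r) e ℤ.+ coeff s e            ≡⟨ ≡.cong (ℤ._+ coeff s e) (coeff-+P p r e) ⟩
    coeff p e ℤ.+ coeff r e ℤ.+ coeff s e     ≡⟨ ℤₚ.+-assoc (coeff p e) _ _ ⟩
    coeff p e ℤ.+ (coeff r e ℤ.+ coeff s e)   ≡⟨ ≡.cong (λ z → coeff p e ℤ.+ z) (coeff-+P r s e) ⟨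
    coeff p e ℤ.+ coeff (r +P s) e            ≡⟨ coeff-+P p (r +P s) e ⟨
    coeff (p +P (r +P s)) e                   ∎
    where open ≡.≡-Reasoning

  +P-comm : (p r : Poly n) → p +P r ≋ r +P p
  +P-comm p r = coeffs λ e →
    ≡.trans (coeff-+P p r e) (≡.trans (ℤₚ.+-comm (coeff p e) _) (≡.sym (coeff-+P r p e)))

  +P-identityˡ : (p : Poly n) → 0P +P p ≋ p
  +P-identityˡ p = coeffs λ e →
    ≡.trans (coeff-+P 0P p e)
      (≡.trans (≡.cong (ℤ._+ coeff p e) (coeff-0P e)) (ℤₚ.+-identityˡ _))

  +P-identityʳ : (p : Poly n) → p +P 0P ≋ p
  +P-identityʳ p = ≋-trans (+P-comm p 0P) (+P-identityˡ p)

  -P-inverseˡ : (p : Poly n) → (-P p) +P p ≋ 0P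
  -P-inverseˡ p = coeffs λ e → begin
    coeff ((-P p) +P p) e            ≡⟨ coeff-+P (-P p) p e ⟩
    coeff (-P p) e ℤ.+ coeff p e     ≡⟨ ≡.cong (ℤ._+ coeff p e) (coeff--P p e) ⟩
    (ℤ.- coeff p e) ℤ.+ coeff p e    ≡⟨ ℤₚ.+-inverseˡ (coeff p e) ⟩
    ℤ.0ℤ                             ≡⟨ coeff-0P e ⟨
    coeff 0P e                       ∎
    where open ≡.≡-Reasoning

  +P-interchange : (p r s t : Poly n) → (p +P r) +P (s +P t) ≋ (p +P s) +P (r +P t)
  +P-interchange p r s t = begin
    (p +P r) +P (s +P t)  ≈⟨ +P-assoc p r (s +P t) ⟩
    p +P (r +P (s +P t))  ≈⟨ +P-cong ≋-refl (+P-assoc r s t) ⟨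
    p +P ((r +P s) +P t)  ≈⟨ +P-cong ≋-refl (+P-cong (+P-comm r s) ≋-refl) ⟩
    p +P ((s +P r) +P t)  ≈⟨ +P-cong ≋-refl (+P-assoc s r t) ⟩
    p +P (s +P (r +P t))  ≈⟨ +P-assoc p s (r +P t) ⟨
    (p +P s) +P (r +P t)  ∎
    where open SetoidReasoning (polySetoid n)

  ∷-cong : {x y : Poly n} {xs ys : Poly (suc n)} → x ≋ y → xs ≋ ys →
           _≋_ {suc n} (x ∷ xs) (y ∷ ys)
  ∷-cong f g = coeffs λ { (zero ∷ e) → coeffwise f e ; (suc k ∷ e) → coeffwise g (k ∷ e) }

  ∷-zero : {x : Poly n} {xs : Poly (suc n)} → x ≋ 0P → xs ≋ [] → _≋_ {suc n} (x ∷ xs) []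
  ∷-zero f g = coeffs λ
    { (zero ∷ e) → ≡.trans (coeffwise f e) (coeff-0P e) ; (suc k ∷ e) → coeffwise g (k ∷ e) }

  head-≋ : {x y : Poly n} {xs ys : Poly (suc n)} → _≋_ {suc n} (x ∷ xs) (y ∷ ys) → x ≋ y
  head-≋ f = coeffs λ e → coeffwise f (zero ∷ e)

  tail-≋ : {x y : Poly n} {xs ys : Poly (suc n)} → _≋_ {suc n} (x ∷ xs) (y ∷ ys) → xs ≋ ys
  tail-≋ f = coeffs λ { (k ∷ e) → coeffwise f (suc k ∷ e) }

  head-zero : {x : Poly n} {xs : Poly (suc n)} → _≋_ {suc n} (x ∷ xs) [] → x ≋ 0P
  head-zero f = coeffs λ e → ≡.trans (coeffwise f (zero ∷ e)) (≡.sym (coeff-0P e))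

  tail-zero : {x : Poly n} {xs : Poly (suc n)} → _≋_ {suc n} (x ∷ xs) [] → xs ≋ []
  tail-zero f = coeffs λ { (k ∷ e) → coeffwise f (suc k ∷ e) }

-- A separate bundle, because the laws at `suc n` are derived from those at `n`, by induction on the
-- number of variables.
record MulLaws (n : ℕ) : Set where
  field
    *P-cong      : {p p′ r r′ : Poly n} → p ≋ p′ → r ≋ r′ → p *P r ≋ p′ *P r′
    *P-comm      : (p r : Poly n) → p *P r ≋ r *P p
    *P-assoc     : (p r s : Poly n) → (p *P r) *P s ≋ p *P (r *P s)
    *P-identityˡ : (p : Poly n) → 1P *P p ≋ p
    *P-distribʳ  : (s p r : Poly n) → (p +P r) *P s ≋ (p *P s) +P (r *P s)
    *P-zeroˡ     : (p : Poly n) → 0P *P p ≋ 0P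

  *P-zeroʳ : (p : Poly n) → p *P 0P ≋ 0P
  *P-zeroʳ p = ≋-trans (*P-comm p 0P) (*P-zeroˡ p)

  *P-distribˡ : (s p r : Poly n) → s *P (p +P r) ≋ (s *P p) +P (s *P r)
  *P-distribˡ s p r = ≋-trans (*P-comm s (p +P r))
    (≋-trans (*P-distribʳ s p r) (+P-cong (*P-comm p s) (*P-comm r s)))

module ListMul (n : ℕ) (laws : MulLaws n) where
  open MulLaws laws
  open SetoidReasoning (polySetoid (suc n))

  smul : Poly n → Poly (suc n) → Poly (suc n)
  smul x ys = map (_*P_ {n} x) ys

  shift : Poly (suc n) → Poly (suc n)
  shift xs = 0P ∷ xs

  smul-zero : (x : Poly n) {ys : Poly (suc n)} → ys ≋ [] → smul x ys ≋ []
  smul-zero x {[]}     f = ≋-refl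
  smul-zero x {y ∷ ys} f =
    ∷-zero (≋-trans (*P-cong ≋-refl (head-zero f)) (*P-zeroʳ x)) (smul-zero x (tail-zero f))

  smul-cong : {x y : Poly n} {xs ys : Poly (suc n)} → x ≋ y → xs ≋ ys → smul x xs ≋ smul y ys
  smul-cong {xs = []}     {[]}     f g = ≋-refl
  smul-cong {y = y} {[]}  {_ ∷ _}  f g = ≋-sym (smul-zero y (≋-sym g))
  smul-cong {x = x} {xs = _ ∷ _} {[]} f g = smul-zero x g
  smul-cong {xs = _ ∷ xs} {_ ∷ ys} f g =
    ∷-cong (*P-cong f (head-≋ g)) (smul-cong {xs = xs} {ys} f (tail-≋ g))

  smul-0 : (ys : Poly (suc n)) → smul 0P ys ≋ []
  smul-0 []       = ≋-refl
  smul-0 (y ∷ ys) = ∷-zero (*P-zeroˡ y) (smul-0 ys)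

  smul-+ʳ : (x : Poly n) (ys zs : Poly (suc n)) → smul x (ys +P zs) ≋ smul x ys +P smul x zs
  smul-+ʳ x []       zs       = ≋-refl
  smul-+ʳ x (y ∷ ys) []       = ≋-refl
  smul-+ʳ x (y ∷ ys) (z ∷ zs) = ∷-cong (*P-distribˡ x y z) (smul-+ʳ x ys zs)

  smul-+ˡ : (x y : Poly n) (zs : Poly (suc n)) → smul (x +P y) zs ≋ smul x zs +P smul y zs
  smul-+ˡ x y []       = ≋-refl
  smul-+ˡ x y (z ∷ zs) = ∷-cong (*P-distribʳ z x y) (smul-+ˡ x y zs)

  smul-smul : (x y : Poly n) (zs : Poly (suc n)) → smul (x *P y) zs ≋ smul x (smul y zs)
  smul-smul x y []       = ≋-refl
  smul-smul x y (z ∷ zs) = ∷-cong (*P-assoc x y z) (smul-smul x y zs)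

  smul-1 : (ys : Poly (suc n)) → smul 1P ys ≋ ys
  smul-1 []       = ≋-refl
  smul-1 (y ∷ ys) = ∷-cong (*P-identityˡ y) (smul-1 ys)

  smul-shift : (x : Poly n) (ys : Poly (suc n)) → smul x (shift ys) ≋ shift (smul x ys)
  smul-shift x ys = ∷-cong (*P-zeroʳ x) ≋-refl

  shift-+ : (xs ys : Poly (suc n)) → shift (xs +P ys) ≋ shift xs +P shift ys
  shift-+ xs ys = ∷-cong (≋-sym (+P-identityˡ 0P)) ≋-refl

  shift-cong : {xs ys : Poly (suc n)} → xs ≋ ys → shift xs ≋ shift ys
  shift-cong = ∷-cong ≋-refl

  zero-mul : {xs : Poly (suc n)} (ys : Poly (suc n)) → xs ≋ [] → xs *P ys ≋ []
  zero-mul {[]}     ys f = ≋-refl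
  zero-mul {x ∷ xs} ys f = begin
    smul x ys +P shift (xs *P ys)
      ≈⟨ +P-cong (smul-cong {xs = ys} (head-zero f) ≋-refl) (shift-cong (zero-mul ys (tail-zero f))) ⟩
    smul 0P ys +P shift []  ≈⟨ +P-cong (smul-0 ys) (∷-zero ≋-refl ≋-refl) ⟩
    []                      ∎

  mul-congˡ : {xs xs′ : Poly (suc n)} (ys : Poly (suc n)) → xs ≋ xs′ → xs *P ys ≋ xs′ *P ys
  mul-congˡ {[]}     {xs′}     ys f = ≋-sym (zero-mul ys (≋-sym f))
  mul-congˡ {x ∷ xs} {[]}      ys f = zero-mul ys f
  mul-congˡ {x ∷ xs} {_ ∷ xs′} ys f =
    +P-cong (smul-cong {xs = ys} (head-≋ f) ≋-refl) (shift-cong (mul-congˡ ys (tail-≋ f)))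

  mul-nil : (xs : Poly (suc n)) → xs *P [] ≋ []
  mul-nil []       = ≋-refl
  mul-nil (x ∷ xs) = ∷-zero ≋-refl (mul-nil xs)

  -- Multiplication recurses on its left argument; this is the mirrored recursion on the right one,
  -- and commutativity is the comparison of the two.
  mul-cons : (xs : Poly (suc n)) (y : Poly n) (ys : Poly (suc n)) →
             xs *P (y ∷ ys) ≋ smul y xs +P shift (xs *P ys)
  mul-cons []       y ys = ≋-sym (∷-zero ≋-refl ≋-refl)
  mul-cons (x ∷ xs) y ys = ∷-cong (+P-cong (*P-comm x y) ≋-refl) (begin
    smul x ys +P (xs *P (y ∷ ys))                   ≈⟨ +P-congˡ (smul x ys) (mul-cons xs y ys) ⟩
    smul x ys +P (smul y xs +P shift (xs *P ys))    ≈⟨ +P-assoc (smul x ys) _ _ ⟨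
    (smul x ys +P smul y xs) +P shift (xs *P ys)    ≈⟨ +P-cong (+P-comm (smul x ys) _) ≋-refl ⟩
    (smul y xs +P smul x ys) +P shift (xs *P ys)    ≈⟨ +P-assoc (smul y xs) _ _ ⟩
    smul y xs +P (smul x ys +P shift (xs *P ys))    ∎)

  mul-comm : (xs ys : Poly (suc n)) → xs *P ys ≋ ys *P xs
  mul-comm []       ys = ≋-sym (mul-nil ys)
  mul-comm (x ∷ xs) ys = begin
    smul x ys +P shift (xs *P ys)  ≈⟨ +P-congˡ (smul x ys) (shift-cong (mul-comm xs ys)) ⟩
    smul x ys +P shift (ys *P xs)  ≈⟨ mul-cons ys x xs ⟨
    ys *P (x ∷ xs)                 ∎

  mul-distribʳ : (zs xs ys : Poly (suc n)) → (xs +P ys) *P zs ≋ (xs *P zs) +P (ys *P zs)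
  mul-distribʳ zs []       ys       = ≋-refl
  mul-distribʳ zs (x ∷ xs) []       = ≋-sym (+P-identityʳ ((x ∷ xs) *P zs))
  mul-distribʳ zs (x ∷ xs) (y ∷ ys) = begin
    smul (x +P y) zs +P shift ((xs +P ys) *P zs)
      ≈⟨ +P-cong (smul-+ˡ x y zs) (≋-trans (shift-cong (mul-distribʳ zs xs ys)) (shift-+ (xs *P zs) (ys *P zs))) ⟩
    (smul x zs +P smul y zs) +P (shift (xs *P zs) +P shift (ys *P zs))
      ≈⟨ +P-interchange (smul x zs) _ _ _ ⟩
    (smul x zs +P shift (xs *P zs)) +P (smul y zs +P shift (ys *P zs)) ∎

  smul-mul : (x : Poly n) (ys zs : Poly (suc n)) → smul x ys *P zs ≋ smul x (ys *P zs)
  smul-mul x []       zs = ≋-refl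
  smul-mul x (y ∷ ys) zs = begin
    smul (x *P y) zs +P shift (smul x ys *P zs)
      ≈⟨ +P-cong (smul-smul x y zs) (≋-trans (shift-cong (smul-mul x ys zs)) (≋-sym (smul-shift x (ys *P zs)))) ⟩
    smul x (smul y zs) +P smul x (shift (ys *P zs))
      ≈⟨ smul-+ʳ x (smul y zs) (shift (ys *P zs)) ⟨
    smul x (smul y zs +P shift (ys *P zs)) ∎

  shift-mul : (xs ys : Poly (suc n)) → shift xs *P ys ≋ shift (xs *P ys)
  shift-mul xs ys = +P-cong (smul-0 ys) ≋-refl

  mul-assoc : (xs ys zs : Poly (suc n)) → (xs *P ys) *P zs ≋ xs *P (ys *P zs)
  mul-assoc []       ys zs = ≋-refl
  mul-assoc (x ∷ xs) ys zs = begin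
    (smul x ys +P shift (xs *P ys)) *P zs
      ≈⟨ mul-distribʳ zs (smul x ys) (shift (xs *P ys)) ⟩
    (smul x ys *P zs) +P (shift (xs *P ys) *P zs)
      ≈⟨ +P-cong (smul-mul x ys zs) (≋-trans (shift-mul (xs *P ys) zs) (shift-cong (mul-assoc xs ys zs))) ⟩
    smul x (ys *P zs) +P shift (xs *P (ys *P zs)) ∎

  listLaws : MulLaws (suc n)
  listLaws = record
    { *P-cong = λ {p} {p′} {r} {r′} f g →
        ≋-trans (mul-congˡ r f)
          (≋-trans (mul-comm p′ r) (≋-trans (mul-congˡ p′ g) (mul-comm r′ p′)))
    ; *P-comm = mul-comm
    ; *P-assoc = mul-assoc
    ; *P-identityˡ = λ p →
        ≋-trans (+P-cong (smul-1 p) (∷-zero ≋-refl ≋-refl)) (+P-identityʳ p)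
    ; *P-distribʳ = mul-distribʳ
    ; *P-zeroˡ = λ _ → ≋-refl
    }

≡⇒≋ : {x y : ℤ} → x ≡ y → _≋_ {zero} x y
≡⇒≋ e = coeffs λ { [] → e }

≋⇒≡ : {x y : ℤ} → _≋_ {zero} x y → x ≡ y
≋⇒≡ e = coeffwise e []

-- Opaque, so that normalising a type that mentions the ring does not unfold the proofs of its laws.
opaque
  mulLaws : ∀ n → MulLaws n
  mulLaws zero = record
    { *P-cong = λ f g → ≡⇒≋ (≡.cong₂ ℤ._*_ (≋⇒≡ f) (≋⇒≡ g))
    ; *P-comm = λ p r → ≡⇒≋ (ℤₚ.*-comm p r)
    ; *P-assoc = λ p r s → ≡⇒≋ (ℤₚ.*-assoc p r s)
    ; *P-identityˡ = λ p → ≡⇒≋ (ℤₚ.*-identityˡ p)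
    ; *P-distribʳ = λ s p r → ≡⇒≋ (ℤₚ.*-distribʳ-+ s p r)
    ; *P-zeroˡ = λ p → ≋-refl
    }
  mulLaws (suc n) = ListMul.listLaws n (mulLaws n)

  poly-isCommutativeRing : ∀ n → IsCommutativeRing (_≋_ {n}) _+P_ _*P_ -P_ 0P 1P
  poly-isCommutativeRing n = record
    { isRing = record
      { +-isAbelianGroup = record
        { isGroup = record
          { isMonoid = record
            { isSemigroup = record
              { isMagma = record { isEquivalence = Setoid.isEquivalence (polySetoid n) ; ∙-cong = +P-cong }
              ; assoc = +P-assoc }
            ; identity = +P-identityˡ , +P-identityʳ }
          ; inverse = -P-inverseˡ , (λ p → ≋-trans (+P-comm p (-P p)) (-P-inverseˡ p))
          ; ⁻¹-cong = -P-cong }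
        ; comm = +P-comm }
      ; *-cong = *P-cong
      ; *-assoc = *P-assoc
      ; *-identity = *P-identityˡ , (λ p → ≋-trans (*P-comm p 1P) (*P-identityˡ p))
      ; distrib = *P-distribˡ , *P-distribʳ }
    ; *-comm = *P-comm }
    where open MulLaws (mulLaws n)

polyRing : ℕ → CommutativeRing 0ℓ 0ℓ
polyRing n = record { isCommutativeRing = poly-isCommutativeRing n }

-- Evaluation, and a ring solver based on it

module _ {n : ℕ} where
  open MulLaws (mulLaws n) public

isZeroP : ∀ {n} → Poly n → Bool
isZeroP {zero}  (+ 0)      = true
isZeroP {zero}  _          = false
isZeroP {suc n} []         = true
isZeroP {suc n} (x ∷ xs)   = isZeroP x ∧ isZeroP {suc n} xs

isZeroP-sound : ∀ {n} (p : Poly n) → T (isZeroP p) → p ≋ 0P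
isZeroP-sound {zero}  (+ 0)    _ = ≋-refl
isZeroP-sound {suc n} []       _ = ≋-refl
isZeroP-sound {suc n} (x ∷ xs) t with isZeroP x in eq
... | true = ∷-zero (isZeroP-sound x (≡.subst T (≡.sym eq) _)) (isZeroP-sound xs t)

module Evaluation {c ℓ} (E : CommutativeRing c ℓ) where
  open CommutativeRing E hiding (zero)
  open RingProperties ring
  open CommutativeSemigroupProperties +-commutativeSemigroup using (interchange)
  open Mult semiring using (×-homo-+; ×1-homo-*) renaming (_×_ to _·_)
  open SetoidReasoning setoid

  fromℤ : ℤ → Carrier
  fromℤ (+ n)    = n · 1#
  fromℤ -[1+ n ] = - (suc n · 1#)

  fromℤ-1 : fromℤ ℤ.1ℤ ≈ 1#
  fromℤ-1 = +-identityʳ 1#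

  fromℤ-⊖ : ∀ m n → fromℤ (m ℤ.⊖ n) ≈ m · 1# + - (n · 1#)
  fromℤ-⊖ m zero = begin
    fromℤ (m ℤ.⊖ 0)    ≡⟨ ≡.cong fromℤ (ℤₚ.⊖-≥ {m} ℕ.z≤n) ⟩
    m · 1#             ≈⟨ +-identityʳ _ ⟨
    m · 1# + 0#        ≈⟨ +-congˡ -0#≈0# ⟨
    m · 1# + - 0#      ∎
  fromℤ-⊖ zero (suc n) = sym (+-identityˡ _)
  fromℤ-⊖ (suc m) (suc n) = begin
    fromℤ (suc m ℤ.⊖ suc n)             ≡⟨ ≡.cong fromℤ (ℤₚ.[1+m]⊖[1+n]≡m⊖n m n) ⟩
    fromℤ (m ℤ.⊖ n)                     ≈⟨ fromℤ-⊖ m n ⟩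
    m · 1# + - (n · 1#)                 ≈⟨ +-identityˡ _ ⟨
    0# + (m · 1# + - (n · 1#))          ≈⟨ +-congʳ (-‿inverseʳ 1#) ⟨
    (1# + - 1#) + (m · 1# + - (n · 1#)) ≈⟨ interchange 1# _ _ _ ⟩
    suc m · 1# + (- 1# + - (n · 1#))    ≈⟨ +-congˡ (-‿+-comm 1# _) ⟩
    suc m · 1# + - (suc n · 1#)         ∎

  fromℤ-neg : ∀ i → fromℤ (ℤ.- i) ≈ - fromℤ i
  fromℤ-neg (+ 0)       = sym -0#≈0#
  fromℤ-neg (+ suc n)   = refl
  fromℤ-neg -[1+ n ]    = sym (-‿involutive _)

  fromℤ-+ : ∀ i j → fromℤ (i ℤ.+ j) ≈ fromℤ i + fromℤ j
  fromℤ-+ (+ m)    (+ n)    = ×-homo-+ 1# m n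
  fromℤ-+ (+ m)    -[1+ n ] = fromℤ-⊖ m (suc n)
  fromℤ-+ -[1+ m ] (+ n)    = trans (fromℤ-⊖ n (suc m)) (+-comm _ _)
  fromℤ-+ -[1+ m ] -[1+ n ] = begin
    - (suc (suc (m ℕ.+ n)) · 1#)       ≈⟨ -‿cong (+-congˡ (×-homo-+ 1# (suc m) n)) ⟩
    - (1# + (suc m · 1# + n · 1#))     ≈⟨ -‿cong (+-assoc 1# _ _) ⟨
    - ((1# + suc m · 1#) + n · 1#)     ≈⟨ -‿cong (+-congʳ (+-comm 1# _)) ⟩
    - ((suc m · 1# + 1#) + n · 1#)     ≈⟨ -‿cong (+-assoc _ 1# _) ⟩
    - (suc m · 1# + suc n · 1#)        ≈⟨ -‿+-comm _ _ ⟨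
    - (suc m · 1#) + - (suc n · 1#)    ∎

  fromℤ-pos* : ∀ m j → fromℤ (+ m ℤ.* j) ≈ m · 1# * fromℤ j
  fromℤ-pos* m (+ n) = begin
    fromℤ (+ m ℤ.* + n)  ≡⟨ ≡.cong fromℤ (ℤₚ.pos-* m n) ⟨
    (m ℕ.* n) · 1#       ≈⟨ ×1-homo-* m n ⟩
    m · 1# * (n · 1#)    ∎
  fromℤ-pos* m -[1+ n ] = begin
    fromℤ (+ m ℤ.* -[1+ n ])       ≡⟨ ≡.cong fromℤ (ℤₚ.neg-distribʳ-* (+ m) (+ suc n)) ⟨
    fromℤ (ℤ.- (+ m ℤ.* + suc n))  ≈⟨ fromℤ-neg (+ m ℤ.* + suc n) ⟩
    - fromℤ (+ m ℤ.* + suc n)      ≈⟨ -‿cong (fromℤ-pos* m (+ suc n)) ⟩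
    - (m · 1# * (suc n · 1#))      ≈⟨ -‿distribʳ-* _ _ ⟩
    m · 1# * - (suc n · 1#)        ∎

  fromℤ-* : ∀ i j → fromℤ (i ℤ.* j) ≈ fromℤ i * fromℤ j
  fromℤ-* (+ m) j = fromℤ-pos* m j
  fromℤ-* -[1+ m ] j = begin
    fromℤ (-[1+ m ] ℤ.* j)        ≡⟨ ≡.cong fromℤ (ℤₚ.neg-distribˡ-* (+ suc m) j) ⟨
    fromℤ (ℤ.- (+ suc m ℤ.* j))   ≈⟨ fromℤ-neg (+ suc m ℤ.* j) ⟩
    - fromℤ (+ suc m ℤ.* j)       ≈⟨ -‿cong (fromℤ-pos* (suc m) j) ⟩
    - (suc m · 1# * fromℤ j)      ≈⟨ -‿distribˡ-* _ _ ⟩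
    - (suc m · 1#) * fromℤ j      ∎

  eval : ∀ {n} → (Fin n → Carrier) → Poly n → Carrier
  eval {zero}  ρ z        = fromℤ z
  eval {suc n} ρ []       = 0#
  eval {suc n} ρ (p ∷ ps) = eval (λ i → ρ (suc i)) p + ρ zero * eval ρ ps

  eval-0 : ∀ {n} (ρ : Fin n → Carrier) → eval ρ 0P ≈ 0#
  eval-0 {zero}  ρ = refl
  eval-0 {suc n} ρ = refl

  eval-zero : ∀ {n} (ρ : Fin n → Carrier) {p : Poly n} → p ≋ 0P → eval ρ p ≈ 0#
  eval-zero {zero}  ρ e = reflexive (≡.cong fromℤ (≋⇒≡ e))
  eval-zero {suc n} ρ {[]} e = refl
  eval-zero {suc n} ρ {p ∷ ps} e = begin
    eval (λ i → ρ (suc i)) p + ρ zero * eval ρ ps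
      ≈⟨ +-cong (eval-zero _ (head-zero e)) (*-congˡ (eval-zero ρ (tail-zero e))) ⟩
    0# + ρ zero * 0#   ≈⟨ +-identityˡ _ ⟩
    ρ zero * 0#        ≈⟨ zeroʳ _ ⟩
    0#                 ∎

  eval-cong : ∀ {n} (ρ : Fin n → Carrier) {p r : Poly n} → p ≋ r → eval ρ p ≈ eval ρ r
  eval-cong {zero}  ρ e = reflexive (≡.cong fromℤ (≋⇒≡ e))
  eval-cong {suc n} ρ {[]}     {r}      e = sym (eval-zero ρ (≋-sym e))
  eval-cong {suc n} ρ {p ∷ ps} {[]}     e = eval-zero ρ e
  eval-cong {suc n} ρ {p ∷ ps} {r ∷ rs} e =
    +-cong (eval-cong _ (head-≋ e)) (*-congˡ (eval-cong ρ (tail-≋ e)))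

  eval-congᵉ : ∀ {n} {ρ σ : Fin n → Carrier} → (∀ i → ρ i ≈ σ i) → (p : Poly n) → eval ρ p ≈ eval σ p
  eval-congᵉ {zero}  e p = refl
  eval-congᵉ {suc n} e [] = refl
  eval-congᵉ {suc n} e (p ∷ ps) =
    +-cong (eval-congᵉ (λ i → e (suc i)) p) (*-cong (e zero) (eval-congᵉ e ps))

  eval-const : ∀ {n} (ρ : Fin n → Carrier) z → eval ρ (constP z) ≈ fromℤ z
  eval-const {zero}  ρ z = refl
  eval-const {suc n} ρ z = begin
    eval (λ i → ρ (suc i)) (constP z) + ρ zero * 0#  ≈⟨ +-cong (eval-const {n} _ z) (zeroʳ _) ⟩
    fromℤ z + 0#                                     ≈⟨ +-identityʳ _ ⟩
    fromℤ z                                          ∎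

  eval-1 : ∀ {n} (ρ : Fin n → Carrier) → eval ρ 1P ≈ 1#
  eval-1 ρ = trans (eval-const ρ ℤ.1ℤ) fromℤ-1

  eval-var : ∀ {n} (ρ : Fin n → Carrier) i → eval ρ (varP i) ≈ ρ i
  eval-var {suc n} ρ zero = begin
    eval (λ i → ρ (suc i)) 0P + ρ zero * (eval (λ i → ρ (suc i)) 1P + ρ zero * 0#)
      ≈⟨ +-cong (eval-0 {n} _) (*-congˡ (+-cong (eval-1 {n} _) (zeroʳ _))) ⟩
    0# + ρ zero * (1# + 0#)  ≈⟨ +-identityˡ _ ⟩
    ρ zero * (1# + 0#)       ≈⟨ *-congˡ (+-identityʳ _) ⟩
    ρ zero * 1#              ≈⟨ *-identityʳ _ ⟩
    ρ zero                   ∎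
  eval-var {suc n} ρ (suc i) = begin
    eval (λ i → ρ (suc i)) (varP i) + ρ zero * 0#  ≈⟨ +-cong (eval-var _ i) (zeroʳ _) ⟩
    ρ (suc i) + 0#                                 ≈⟨ +-identityʳ _ ⟩
    ρ (suc i)                                      ∎

  eval-+ : ∀ {n} (ρ : Fin n → Carrier) (p r : Poly n) → eval ρ (p +P r) ≈ eval ρ p + eval ρ r
  eval-+ {zero}  ρ p r = fromℤ-+ p r
  eval-+ {suc n} ρ [] r = sym (+-identityˡ _)
  eval-+ {suc n} ρ (p ∷ ps) [] = sym (+-identityʳ _)
  eval-+ {suc n} ρ (p ∷ ps) (r ∷ rs) = begin
    eval _ (p +P r) + ρ zero * eval ρ (ps +P rs)
      ≈⟨ +-cong (eval-+ _ p r) (*-congˡ (eval-+ ρ ps rs)) ⟩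
    (eval _ p + eval _ r) + ρ zero * (eval ρ ps + eval ρ rs)
      ≈⟨ +-congˡ (distribˡ _ _ _) ⟩
    (eval _ p + eval _ r) + (ρ zero * eval ρ ps + ρ zero * eval ρ rs)
      ≈⟨ interchange _ _ _ _ ⟩
    eval ρ (p ∷ ps) + eval ρ (r ∷ rs) ∎

  eval-neg : ∀ {n} (ρ : Fin n → Carrier) (p : Poly n) → eval ρ (-P p) ≈ - eval ρ p
  eval-neg {zero}  ρ p = fromℤ-neg p
  eval-neg {suc n} ρ [] = sym -0#≈0#
  eval-neg {suc n} ρ (p ∷ ps) = begin
    eval _ (-P p) + ρ zero * eval ρ (-P ps)   ≈⟨ +-cong (eval-neg _ p) (*-congˡ (eval-neg ρ ps)) ⟩
    - eval _ p + ρ zero * - eval ρ ps         ≈⟨ +-congˡ (-‿distribʳ-* _ _) ⟨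
    - eval _ p + - (ρ zero * eval ρ ps)       ≈⟨ -‿+-comm _ _ ⟩
    - (eval _ p + ρ zero * eval ρ ps)         ∎

  eval-* : ∀ {n} (ρ : Fin n → Carrier) (p r : Poly n) → eval ρ (p *P r) ≈ eval ρ p * eval ρ r
  eval-* {zero}  ρ p r = fromℤ-* p r
  eval-* {suc n} ρ [] r = sym (zeroˡ _)
  eval-* {suc n} ρ (p ∷ ps) rs = begin
    eval ρ (smul p rs +P shift (ps *P rs))
      ≈⟨ eval-+ ρ (smul p rs) (shift (ps *P rs)) ⟩
    eval ρ (smul p rs) + (eval (λ i → ρ (suc i)) 0P + ρ zero * eval ρ (ps *P rs))
      ≈⟨ +-cong (eval-smul rs) (trans (+-congʳ (eval-0 {n} _)) (+-identityˡ _)) ⟩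
    eval _ p * eval ρ rs + ρ zero * eval ρ (ps *P rs)
      ≈⟨ +-congˡ (trans (*-congˡ (eval-* ρ ps rs)) (sym (*-assoc _ _ _))) ⟩
    eval _ p * eval ρ rs + ρ zero * eval ρ ps * eval ρ rs
      ≈⟨ distribʳ _ _ _ ⟨
    (eval _ p + ρ zero * eval ρ ps) * eval ρ rs ∎
    where
    open ListMul n (mulLaws n) using (smul; shift)
    eval-smul : (rs : Poly (suc n)) → eval ρ (smul p rs) ≈ eval (λ i → ρ (suc i)) p * eval ρ rs
    eval-smul [] = sym (zeroʳ _)
    eval-smul (r ∷ rs) = begin
      eval _ (p *P r) + ρ zero * eval ρ (smul p rs)
        ≈⟨ +-cong (eval-* _ p r) (*-congˡ (eval-smul rs)) ⟩
      eval _ p * eval _ r + ρ zero * (eval _ p * eval ρ rs)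
        ≈⟨ +-congˡ (trans (sym (*-assoc _ _ _)) (trans (*-congʳ (*-comm _ _)) (*-assoc _ _ _))) ⟩
      eval _ p * eval _ r + eval _ p * (ρ zero * eval ρ rs)
        ≈⟨ distribˡ _ _ _ ⟨
      eval _ p * eval ρ (r ∷ rs) ∎

data Expr (n : ℕ) : Set where
  var         : Fin n → Expr n
  con         : ℤ → Expr n
  _:+_ _:*_ _:-_ : Expr n → Expr n → Expr n
  :-_         : Expr n → Expr n

infixl 6 _:+_ _:-_
infixl 7 _:*_
infix 8 :-_
infix 4 _:=_

:1 : ∀ {n} → Expr n
:1 = con ℤ.1ℤ

:0 : ∀ {n} → Expr n
:0 = con ℤ.0ℤ

_:=_ : ∀ {n} → Expr n → Expr n → Expr n × Expr n
_:=_ = _,_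

normalise : ∀ {n} → Expr n → Poly n
normalise (var i)  = varP i
normalise (con z)  = constP z
normalise (e :+ f) = normalise e +P normalise f
normalise (e :* f) = normalise e *P normalise f
normalise (e :- f) = normalise e -P normalise f
normalise (:- e)   = -P normalise e

-- A ring solver whose normal forms are the integer polynomials themselves.
module Solver {c ℓ} (E : CommutativeRing c ℓ) where
  open CommutativeRing E
  open RingProperties ring
  open Evaluation E
  open SetoidReasoning setoid

  -- 0 and 1 are singled out because `fromℤ` sends 1 to 1# + 0#, whereas `:0` and `:1` have to
  -- denote 0# and 1# definitionally.
  ⟦con⟧ : ℤ → Carrier
  ⟦con⟧ (+ 0) = 0#
  ⟦con⟧ (+ 1) = 1#
  ⟦con⟧ z     = fromℤ z

  ⟦_⟧ : ∀ {n} → Expr n → Vec Carrier n → Carrier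
  ⟦ var i ⟧  ρ = Vec.lookup ρ i
  ⟦ con z ⟧  ρ = ⟦con⟧ z
  ⟦ e :+ f ⟧ ρ = ⟦ e ⟧ ρ + ⟦ f ⟧ ρ
  ⟦ e :* f ⟧ ρ = ⟦ e ⟧ ρ * ⟦ f ⟧ ρ
  ⟦ e :- f ⟧ ρ = ⟦ e ⟧ ρ - ⟦ f ⟧ ρ
  ⟦ :- e ⟧   ρ = - ⟦ e ⟧ ρ

  con-correct : ∀ z → fromℤ z ≈ ⟦con⟧ z
  con-correct (+ 0)           = refl
  con-correct (+ 1)           = fromℤ-1
  con-correct (+ suc (suc n)) = refl
  con-correct -[1+ n ]        = refl

  normalise-correct : ∀ {n} (e : Expr n) ρ → eval (Vec.lookup ρ) (normalise e) ≈ ⟦ e ⟧ ρ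
  normalise-correct (var i)  ρ = eval-var _ i
  normalise-correct {n} (con z)  ρ = trans (eval-const {n} _ z) (con-correct z)
  normalise-correct (e :+ f) ρ =
    trans (eval-+ _ (normalise e) _) (+-cong (normalise-correct e ρ) (normalise-correct f ρ))
  normalise-correct (e :* f) ρ =
    trans (eval-* _ (normalise e) _) (*-cong (normalise-correct e ρ) (normalise-correct f ρ))
  normalise-correct (e :- f) ρ =
    trans (eval-+ _ (normalise e) _)
      (+-cong (normalise-correct e ρ) (trans (eval-neg _ (normalise f)) (-‿cong (normalise-correct f ρ))))
  normalise-correct (:- e)   ρ =
    trans (eval-neg _ (normalise e)) (-‿cong (normalise-correct e ρ))

  -- The identity is checked by computation: if all coefficients of the difference of the normal
  -- forms evaluate to 0, the type of the implicit argument reduces to ⊤ and the argument is filled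
  -- in by unification.
  solve : ∀ n (f : N-ary n (Expr n) (Expr n × Expr n)) →
          let (e₁ , e₂) = f $ⁿ Vec.map var (Vec.allFin n) in
          {T (isZeroP (normalise e₁ -P normalise e₂))} →
          Eq n _≈_ (curryⁿ ⟦ e₁ ⟧) (curryⁿ ⟦ e₂ ⟧)
  solve n f {t} = curryⁿ-cong _≈_ ⟦ e₁ ⟧ ⟦ e₂ ⟧ λ ρ → begin
    ⟦ e₁ ⟧ ρ          ≈⟨ normalise-correct e₁ ρ ⟨
    eval (Vec.lookup ρ) (normalise e₁)   ≈⟨ eval-cong (Vec.lookup ρ) equal ⟩
    eval (Vec.lookup ρ) (normalise e₂)   ≈⟨ normalise-correct e₂ ρ ⟩
    ⟦ e₂ ⟧ ρ          ∎
    where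
    es = f $ⁿ Vec.map var (Vec.allFin n)
    e₁ = proj₁ es
    e₂ = proj₂ es
    equal : normalise e₁ ≋ normalise e₂
    equal = GroupProperties.x∙y⁻¹≈ε⇒x≈y (CommutativeRing.+-group (polyRing n)) _ _ (isZeroP-sound _ t)

-- Divisibility and GCD domains

module Divisibility {c ℓ} (R : CommutativeRing c ℓ) where
  open CommutativeRing R
  open Solver R

  infix 4 _∣_

  record _∣_ (x y : Carrier) : Set (c ⊔ ℓ) where
    constructor _,_
    field
      quotient : Carrier
      equality : y ≈ x * quotient

  ∣-refl : ∀ {x} → x ∣ x
  ∣-refl = 1# , sym (*-identityʳ _)

  ∣-trans : ∀ {x y z} → x ∣ y → y ∣ z → x ∣ z
  ∣-trans (r , e) (s , f) = r * s , trans f (trans (*-congʳ e) (*-assoc _ r s))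

  ∣-respʳ : ∀ {x y z} → y ≈ z → x ∣ y → x ∣ z
  ∣-respʳ e (r , f) = r , trans (sym e) f

  ∣-respˡ : ∀ {x y z} → x ≈ y → x ∣ z → y ∣ z
  ∣-respˡ e (r , f) = r , trans f (*-congʳ e)

  ∣-*ʳ : ∀ {x y} z → x ∣ y → x ∣ y * z
  ∣-*ʳ z (r , e) = r * z , trans (*-congʳ e) (*-assoc _ r z)

  ∣-*ˡ : ∀ {x y} z → x ∣ y → x ∣ z * y
  ∣-*ˡ z d = ∣-respʳ (*-comm _ z) (∣-*ʳ z d)

  ∣-* : ∀ {x y z w} → x ∣ y → z ∣ w → x * z ∣ y * w
  ∣-* {x} {y} {z} {w} (r , e) (s , f) =
    r * s , trans (*-cong e f) (solve 4 (λ x r z s → x :* r :* (z :* s) := x :* z :* (r :* s)) x r z s)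

  ∣-0 : ∀ {x} → x ∣ 0#
  ∣-0 = 0# , sym (zeroʳ _)

  ∣-+ : ∀ {x y z} → x ∣ y → x ∣ z → x ∣ y + z
  ∣-+ (r , e) (s , f) = r + s , trans (+-cong e f) (sym (distribˡ _ r s))

  ∣-neg : ∀ {x y} → x ∣ y → x ∣ - y
  ∣-neg {x} (r , e) = - r , trans (-‿cong e) (solve 2 (λ x r → :- (x :* r) := x :* :- r) x r)

  ∣-minus : ∀ {x y z} → x ∣ y → x ∣ z → x ∣ y - z
  ∣-minus d e = ∣-+ d (∣-neg e)

  ∣-cancel-+ : ∀ {x y z} → x ∣ y + z → x ∣ y → x ∣ z
  ∣-cancel-+ {x} {y} {z} d e =
    ∣-respʳ (solve 2 (λ y z → y :+ z :- y := z) y z) (∣-minus d e)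

  Coprime : Carrier → Carrier → Set (c ⊔ ℓ)
  Coprime x y = ∀ h → h ∣ x → h ∣ y → h ∣ 1#

module Rearrange {c ℓ} (R : CommutativeRing c ℓ) where
  open CommutativeRing R
  open Solver R

  x*yz≈y*xz : ∀ x y z → x * (y * z) ≈ y * (x * z)
  x*yz≈y*xz = solve 3 λ x y z → x :* (y :* z) := y :* (x :* z)

  division-step : ∀ a q g r b → a * (q * g + r) ≈ (a * q + b) * g + (a * r - b * g)
  division-step = solve 5 λ a q g r b → a :* (q :* g :+ r) := (a :* q :+ b) :* g :+ (a :* r :- b :* g)

module _ {c ℓ} (R : CommutativeRing c ℓ) where
  open CommutativeRing R

  NoZeroDivisors : Set (c ⊔ ℓ)
  NoZeroDivisors = ∀ x y → x * y ≈ 0# → x ≈ 0# ⊎ y ≈ 0#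

  Nontrivial : Set ℓ
  Nontrivial = 1# ≉ 0#

module Integral {c ℓ} (R : CommutativeRing c ℓ) (integral : NoZeroDivisors R) where
  open CommutativeRing R
  open Solver R
  open Divisibility R
  open SetoidReasoning setoid

  *-cancelˡ : ∀ {x y z} → x ≉ 0# → x * y ≈ x * z → y ≈ z
  *-cancelˡ {x} {y} {z} x≉0 e with integral x (y - z) (begin
    x * (y - z)      ≈⟨ solve 3 (λ x y z → x :* (y :- z) := x :* y :- x :* z) x y z ⟩
    x * y - x * z    ≈⟨ +-congʳ e ⟩
    x * z - x * z    ≈⟨ -‿inverseʳ _ ⟩
    0#               ∎)
  ... | inj₁ x≈0   = ⊥-elim (x≉0 x≈0)
  ... | inj₂ y-z≈0 = GroupProperties.x∙y⁻¹≈ε⇒x≈y +-group y z y-z≈0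

  *-nonzero : ∀ {x y} → x ≉ 0# → y ≉ 0# → x * y ≉ 0#
  *-nonzero x≉0 y≉0 e with integral _ _ e
  ... | inj₁ z = x≉0 z
  ... | inj₂ z = y≉0 z

  ∣-cancelˡ : ∀ {x y z} → x ≉ 0# → x * y ∣ x * z → y ∣ z
  ∣-cancelˡ x≉0 (r , e) = r , *-cancelˡ x≉0 (trans e (*-assoc _ _ r))

record IsGCDDomain {c ℓ} (R : CommutativeRing c ℓ) : Set (c ⊔ ℓ) where
  open CommutativeRing R
  open Divisibility R
  field
    zero?     : ∀ x → Dec (x ≈ 0#)
    integral  : NoZeroDivisors R
    gcd       : ∀ x y → Σ Carrier λ g → g ∣ x × g ∣ y × (∀ h → h ∣ x → h ∣ y → h ∣ g)
    nontrivial : Nontrivial R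

module GCDDomain {c ℓ} {R : CommutativeRing c ℓ} (D : IsGCDDomain R) where
  open CommutativeRing R
  open Divisibility R
  open IsGCDDomain D

  open Integral R integral public

  nonzero-∣ : ∀ {x y} → y ≉ 0# → x ∣ y → x ≉ 0#
  nonzero-∣ y≉0 (r , e) x≈0 = y≉0 (trans e (trans (*-congʳ x≈0) (zeroˡ r)))

  -- Euclid's lemma without Bézout: gcd (zx, zy) has the form zt, and t divides x and y, so it is a
  -- unit; x divides both zx and zy, hence zt, hence z.
  coprime-∣ : ∀ {x y} z → Coprime x y → x ∣ y * z → x ∣ z
  coprime-∣ {x} {y} z cop x∣yz with zero? z
  ... | yes z≈0 = ∣-respʳ (sym z≈0) ∣-0
  ... | no  z≉0 with gcd (z * x) (z * y)
  ... | g , g∣zx , g∣zy , greatest with greatest z (∣-*ʳ x ∣-refl) (∣-*ʳ y ∣-refl)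
  ... | t , g≈zt = ∣-trans (greatest x (∣-*ˡ z ∣-refl) (∣-respʳ (*-comm y z) x∣yz))
    (∣-respˡ (sym g≈zt) (∣-respʳ (*-identityʳ z) (∣-* ∣-refl t∣1)))
    where
    t∣1 = cop t (∣-cancelˡ z≉0 (∣-respˡ g≈zt g∣zx)) (∣-cancelˡ z≉0 (∣-respˡ g≈zt g∣zy))

  -- A common divisor of x and yz is itself coprime to y, so Euclid's lemma makes it a divisor of z.
  coprime-* : ∀ {x y z} → Coprime x y → Coprime x z → Coprime x (y * z)
  coprime-* {z = z} cop₁ cop₂ h h∣x h∣yz =
    cop₂ h h∣x (coprime-∣ z (λ k k∣h k∣y → cop₁ k (∣-trans k∣h h∣x) k∣y) h∣yz)

  coprime-sym : ∀ {x y} → Coprime x y → Coprime y x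
  coprime-sym cop h h∣y h∣x = cop h h∣x h∣y

  coprime-∣ˡ : ∀ {x y z} → x ∣ y → Coprime y z → Coprime x z
  coprime-∣ˡ x∣y cop h h∣x h∣z = cop h (∣-trans h∣x x∣y) h∣z

  coprime-product-∣ : ∀ {x y z} → Coprime x y → x ∣ z → y ∣ z → x * y ∣ z
  coprime-product-∣ {x} {y} cop (r , e) y∣z =
    ∣-respʳ (sym e) (∣-* ∣-refl (coprime-∣ r (coprime-sym cop) (∣-respʳ e y∣z)))

  reduce : ∀ x {y} → y ≉ 0# → Σ Carrier λ g → Σ Carrier λ x′ → Σ Carrier λ y′ →
           g ≉ 0# × x ≈ g * x′ × y ≈ g * y′ × Coprime x′ y′
  reduce x {y} y≉0 with gcd x y
  ... | g , (x′ , ex) , (y′ , ey) , greatest = g , x′ , y′ , g≉0 , ex , ey , λ h h∣x′ h∣y′ →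
      ∣-cancelˡ g≉0 (∣-respʳ (sym (*-identityʳ g))
        (greatest (g * h) (∣-respʳ (sym ex) (∣-* ∣-refl h∣x′)) (∣-respʳ (sym ey) (∣-* ∣-refl h∣y′))))
    where g≉0 = nonzero-∣ y≉0 (y′ , ey)

-- Polynomials over a GCD domain: contents, Gauss's lemma, pseudo-division

module PolyGCD (n : ℕ) (D : IsGCDDomain (polyRing n)) where
  open ListMul n (mulLaws n)
  open Divisibility (polyRing n) using () renaming (_∣_ to _∣ᴷ_; _,_ to _,ᴷ_)
  module K∣ where
    open Divisibility (polyRing n) public
    open _∣_ public using (quotient; equality)
  module K = CommutativeRing (polyRing n)
  module KD = GCDDomain D
  open IsGCDDomain D using () renaming (zero? to zeroᴷ?; integral to integralᴷ; gcd to gcdᴷ; nontrivial to 1≉0ᴷ)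
  open CommutativeRing (polyRing (suc n)) using (_≉_; trans; sym; refl; *-assoc; *-comm; *-cong; *-congˡ; *-congʳ; +-cong; +-congʳ; +-congˡ; zeroˡ; zeroʳ; *-identityʳ)
  open Divisibility (polyRing (suc n))
  open Rearrange (polyRing (suc n))
  open SetoidReasoning (polySetoid (suc n))

  P : Set
  P = Poly (suc n)

  opaque
    C : Poly n → P
    C c = c ∷ []

    C-def : ∀ c → C c ≋ c ∷ []
    C-def c = ≋-refl

    C-* : ∀ c (p : P) → C c *P p ≋ smul c p
    C-* c p = trans (+P-congˡ (smul c p) (∷-zero ≋-refl ≋-refl)) (+P-identityʳ _)

    C-cong : ∀ {c d} → c ≋ d → C c ≋ C d
    C-cong e = ∷-cong e ≋-refl

    C-homo-* : ∀ c d → C (c *P d) ≋ C c *P C d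
    C-homo-* c d = sym (C-* c (c′ d))
      where
      c′ : Poly n → P
      c′ d = d ∷ []

    C-zero : ∀ {c} → c ≋ 0P → C c ≋ []
    C-zero e = ∷-zero e ≋-refl

    C-nonzero : ∀ {c} → ¬ c ≋ 0P → ¬ C c ≋ []
    C-nonzero c≉0 e = c≉0 (head-zero e)

  C-homo-∣ : ∀ {c d} → c ∣ᴷ d → C c ∣ C d
  C-homo-∣ {c} (r ,ᴷ e) = C r , trans (C-cong e) (C-homo-* c r)

  ∣-head : ∀ {c x} {xs : P} → C c ∣ (x ∷ xs) → c ∣ᴷ x
  ∣-head {c} ([] , e) = K∣.∣-respʳ (≋-sym (head-zero (trans e (C-* c [])))) K∣.∣-0
  ∣-head {c} (y ∷ ys , e) = y ,ᴷ head-≋ (trans e (C-* c (y ∷ ys)))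

  ∣-tail : ∀ {c x} {xs : P} → C c ∣ (x ∷ xs) → C c ∣ xs
  ∣-tail {c} ([] , e) = [] , trans (tail-zero (trans e (C-* c []))) (sym (C-* c []))
  ∣-tail {c} (y ∷ ys , e) = ys , trans (tail-≋ (trans e (C-* c (y ∷ ys)))) (sym (C-* c ys))

  ∣-cons : ∀ {c x} {xs : P} → c ∣ᴷ x → C c ∣ xs → C c ∣ (x ∷ xs)
  ∣-cons {c} (y ,ᴷ e) (ys , f) = y ∷ ys , trans (∷-cong e (trans f (C-* c ys))) (sym (C-* c (y ∷ ys)))

  ∣-smul : ∀ {c x} (p : P) → c ∣ᴷ x → C c ∣ smul x p
  ∣-smul {x = x} p d = ∣-respʳ (C-* x p) (∣-*ʳ p (C-homo-∣ d))

  -- Zero constant terms are stripped from either factor; two nonzero constant terms would give the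
  -- product a nonzero constant term.
  P-integral : (p r : P) → p *P r ≋ [] → p ≋ [] ⊎ r ≋ []
  P-integral [] r e = inj₁ ≋-refl
  P-integral (x ∷ p) [] e = inj₂ ≋-refl
  P-integral (x ∷ p) (y ∷ r) e = cases (zeroᴷ? x) (zeroᴷ? y)
    (λ x≈0 → P-integral p (y ∷ r) (tail-zero {xs = p *P (y ∷ r)} (begin
      shift (p *P (y ∷ r))                    ≈⟨ +P-cong (smul-0 (y ∷ r)) (≋-refl {p = shift (p *P (y ∷ r))}) ⟨
      smul 0P (y ∷ r) +P shift (p *P (y ∷ r))
        ≈⟨ +P-cong (smul-cong {xs = y ∷ r} x≈0 ≋-refl) (≋-refl {p = shift (p *P (y ∷ r))}) ⟨
      (x ∷ p) *P (y ∷ r)                      ≈⟨ e ⟩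
      []                                      ∎)))
    (λ y≈0 → P-integral (x ∷ p) r (tail-zero {xs = (x ∷ p) *P r} (begin
      shift ((x ∷ p) *P r)                    ≈⟨ +P-cong (smul-0 (x ∷ p)) (≋-refl {p = shift ((x ∷ p) *P r)}) ⟨
      smul 0P (x ∷ p) +P shift ((x ∷ p) *P r)
        ≈⟨ +P-cong (smul-cong {xs = x ∷ p} y≈0 ≋-refl) (≋-refl {p = shift ((x ∷ p) *P r)}) ⟨
      smul y (x ∷ p) +P shift ((x ∷ p) *P r)  ≈⟨ mul-cons (x ∷ p) y r ⟨
      (x ∷ p) *P (y ∷ r)                      ≈⟨ e ⟩
      []                                      ∎)))
    where
    cases : Dec (x ≋ 0P) → Dec (y ≋ 0P) →
            (x ≋ 0P → p ≋ [] ⊎ (y ∷ r) ≋ []) → (y ≋ 0P → (x ∷ p) ≋ [] ⊎ r ≋ []) →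
            (x ∷ p) ≋ [] ⊎ (y ∷ r) ≋ []
    cases (yes x≈0) _ IHp _ with IHp x≈0
    ... | inj₁ p≈0 = inj₁ (∷-zero x≈0 p≈0)
    ... | inj₂ r≈0 = inj₂ r≈0
    cases _ (yes y≈0) _ IHr with IHr y≈0
    ... | inj₁ p≈0 = inj₁ p≈0
    ... | inj₂ r≈0 = inj₂ (∷-zero y≈0 r≈0)
    cases (no x≉0) (no y≉0) _ _ =
      ⊥-elim (KD.*-nonzero x≉0 y≉0 (≋-trans (≋-sym (+P-identityʳ (x *P y))) (head-zero e)))

  P-zero? : (p : P) → Dec (p ≋ [])
  P-zero? [] = yes ≋-refl
  P-zero? (x ∷ p) with zeroᴷ? x | P-zero? p
  ... | yes e | yes f = yes (∷-zero e f)
  ... | no ¬e | _     = no λ g → ¬e (head-zero g)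
  ... | _     | no ¬f = no λ g → ¬f (tail-zero g)

  open Integral (polyRing (suc n)) P-integral using () renaming (*-cancelˡ to P-cancelˡ; ∣-cancelˡ to P-∣-cancelˡ)

  Primitive : P → Set
  Primitive p = ∀ t → C t ∣ p → t ∣ᴷ 1P

  CoprimeC : Poly n → P → Set
  CoprimeC s p = ∀ t → t ∣ᴷ s → C t ∣ p → t ∣ᴷ 1P

  -- Gauss's lemma without primes: a common divisor of s and an extreme coefficient
  -- of one factor still satisfies the hypotheses with that coefficient removed.
  gauss : ∀ s (h u : P) → C s ∣ h *P u → CoprimeC s h → CoprimeC s u → s ∣ᴷ 1P
  gauss s [] u d cop₁ cop₂ = cop₁ s K∣.∣-refl ∣-0
  gauss s (b ∷ h) [] d cop₁ cop₂ = cop₂ s K∣.∣-refl ∣-0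
  gauss s (b ∷ h) (a ∷ u) d cop₁ cop₂ =
    KD.coprime-* {s} {b} {a}
      (λ t t∣s t∣b → gauss t h (a ∷ u)
        (∣-tail (∣-cancel-+ (C-∣ t∣s) (∣-smul (a ∷ u) t∣b)))
        (λ w w∣t w∣h → cop₁ w (K∣.∣-trans w∣t t∣s) (∣-cons (K∣.∣-trans w∣t t∣b) w∣h))
        (λ w w∣t → cop₂ w (K∣.∣-trans w∣t t∣s)))
      (λ t t∣s t∣a → gauss t (b ∷ h) u
        (∣-tail (∣-cancel-+ (∣-respʳ (mul-cons (b ∷ h) a u) (C-∣ t∣s)) (∣-smul (b ∷ h) t∣a)))
        (λ w w∣t → cop₁ w (K∣.∣-trans w∣t t∣s))
        (λ w w∣t w∣u → cop₂ w (K∣.∣-trans w∣t t∣s) (∣-cons (K∣.∣-trans w∣t t∣a) w∣u)))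
      s K∣.∣-refl (K∣.∣-respʳ (+P-identityʳ (b *P a)) (∣-head d))
    where
    C-∣ : ∀ {t} → t ∣ᴷ s → C t ∣ ((b ∷ h) *P (a ∷ u))
    C-∣ t∣s = ∣-trans (C-homo-∣ t∣s) d

  Content : P → Set
  Content p = Σ (Poly n) λ c → C c ∣ p × (∀ t → C t ∣ p → t ∣ᴷ c)

  content : (p : P) → Content p
  content [] = 0P , ∣-0 , λ t _ → K∣.∣-0
  content (x ∷ p) with content p
  ... | c , c∣p , univ with gcdᴷ x c
  ... | g , g∣x , g∣c , greatest =
    g , ∣-cons g∣x (∣-trans (C-homo-∣ g∣c) c∣p) , λ t d → greatest t (∣-head d) (univ t (∣-tail d))

  PrimitivePart : P → Set
  PrimitivePart p = Σ (Poly n) λ c → Σ P λ p′ → ¬ c ≋ 0P × p ≋ C c *P p′ × Primitive p′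

  primitivePart : (p : P) → ¬ p ≋ [] → PrimitivePart p
  primitivePart p p≉0 = split (content p)
    where
    split : Content p → PrimitivePart p
    split (c , (p′ , e) , univ) = c , p′ , c≉0 , e , prim
      where
      c≉0 : ¬ c ≋ 0P
      c≉0 z = p≉0 (trans e (zero-mul p′ (C-zero z)))
      prim : Primitive p′
      prim t d = KD.∣-cancelˡ c≉0 (K∣.∣-respʳ (≋-sym (K.*-identityʳ c)) (univ (c *P t)
        (∣-respʳ (sym e) (∣-respˡ (sym (C-homo-* c t)) (∣-* (∣-refl {C c}) d)))))

  primitive-∣ : ∀ {h p : P} → h ∣ p → Primitive p → Primitive h
  primitive-∣ h∣p prim t d = prim t (∣-trans d h∣p)

  -- Let g be the gcd of s and the content of u, with s = g s′ and u = g u′. A constant dividing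
  -- both s′ and u′ is a unit, so Gauss's lemma for s′, h and u′ makes s′ a unit; thus s divides g,
  -- which divides u.
  constant-∣ : ∀ {s} (h u : P) → ¬ s ≋ 0P → Primitive h → C s ∣ h *P u → C s ∣ u
  constant-∣ {s} h u s≉0 prim d = helper (content u)
    where
    helper : Content u → C s ∣ u
    helper (c , c∣u , univ) = helper′ (KD.reduce c s≉0)
      where
      helper′ : (Σ (Poly n) λ g → Σ (Poly n) λ c′ → Σ (Poly n) λ s′ →
                 ¬ g ≋ 0P × c ≋ g *P c′ × s ≋ g *P s′ × K∣.Coprime c′ s′) → C s ∣ u
      helper′ (g , c′ , s′ , g≉0 , c≈gc′ , s≈gs′ , cop) = go (∣-trans (C-homo-∣ (c′ ,ᴷ c≈gc′)) c∣u)
        where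
        go : C g ∣ u → C s ∣ u
        go (u′ , u≈gu′) = ∣-trans (C-homo-∣ s∣g) (u′ , u≈gu′)
          where
          gs′∣ghu′ : C g *P C s′ ∣ C g *P (h *P u′)
          gs′∣ghu′ = ∣-respˡ (trans (C-cong s≈gs′) (C-homo-* g s′)) (∣-respʳ (begin
            h *P u            ≈⟨ *-congˡ {h} u≈gu′ ⟩
            h *P (C g *P u′)  ≈⟨ x*yz≈y*xz h (C g) u′ ⟩
            C g *P (h *P u′)  ∎) d)
          gt∣u : ∀ t → C t ∣ u′ → C (g *P t) ∣ u
          gt∣u t t∣u′ = ∣-respʳ (sym u≈gu′) (∣-respˡ (sym (C-homo-* g t)) (∣-* (∣-refl {C g}) t∣u′))
          s′∣1 : s′ ∣ᴷ 1P
          s′∣1 = gauss s′ h u′ (P-∣-cancelˡ (C-nonzero g≉0) gs′∣ghu′) (λ t _ → prim t)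
            (λ t t∣s′ t∣u′ → cop t (KD.∣-cancelˡ g≉0 (K∣.∣-respʳ c≈gc′ (univ (g *P t) (gt∣u t t∣u′)))) t∣s′)
          s∣g : s ∣ᴷ g
          s∣g = K∣.∣-respˡ (≋-sym s≈gs′) (K∣.∣-respʳ (K.*-identityʳ g) (K∣.∣-* (K∣.∣-refl {g}) s′∣1))

  -- As h is primitive, the constant c divides the cofactor of h and cancels. This removes the
  -- constants which pseudo-division introduces.
  primitive-cancel : ∀ {c} (h p : P) → ¬ c ≋ 0P → Primitive h → h ∣ C c *P p → h ∣ p
  primitive-cancel {c} h p c≉0 prim (u , e) = case constant-∣ h u c≉0 prim (∣-respʳ e (∣-*ʳ p ∣-refl)) of λ
    { (v , u≈cv) → v , P-cancelˡ (C-nonzero c≉0) (begin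
    C c *P p         ≈⟨ e ⟩
    h *P u           ≈⟨ *-congˡ {h} u≈cv ⟩
    h *P (C c *P v)  ≈⟨ x*yz≈y*xz h (C c) v ⟩
    C c *P (h *P v)  ∎) }

  fromVec : ∀ {m} → Vec (Poly n) m → P
  fromVec []      = []
  fromVec (x ∷ v) = x ∷ fromVec v

  -- Coefficient lists may end in zeros; here the last entry is the true leading coefficient.
  -- `degree<` is what makes the Euclidean algorithm terminate.
  record Leading (p : P) (bound : ℕ) : Set where
    constructor leading
    field
      {degree} : ℕ
      degree<  : degree ℕ.< bound
      lower    : Vec (Poly n) degree
      top      : Poly n
      top≉0    : ¬ top ≋ 0P
      equal    : p ≋ fromVec (lower ∷ʳ top)

  trimVec : ∀ {m} (v : Vec (Poly n) m) → fromVec v ≋ [] ⊎ Leading (fromVec v) m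
  trimVec [] = inj₁ ≋-refl
  trimVec (x ∷ v) with trimVec v
  ... | inj₂ (leading lt w a a≉0 e) = inj₂ (leading (s≤s lt) (x ∷ w) a a≉0 (∷-cong ≋-refl e))
  ... | inj₁ v≈0 with zeroᴷ? x
  ...   | yes x≈0 = inj₁ (∷-zero x≈0 v≈0)
  ...   | no  x≉0 = inj₂ (leading (s≤s z≤n) [] x x≉0 (∷-cong ≋-refl v≈0))

  toVec : (p : P) → Σ ℕ λ m → Σ (Vec (Poly n) m) λ v → fromVec v ≡ p
  toVec [] = 0 , [] , ≡.refl
  toVec (x ∷ p) with toVec p
  ... | m , v , ≡.refl = suc m , x ∷ v , ≡.refl

  divideVec : ∀ {m c} (v : Vec (Poly n) m) → C c ∣ fromVec v →
              Σ (Vec (Poly n) m) λ v′ → fromVec v ≋ C c *P fromVec v′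
  divideVec {c = c} [] d = [] , sym (C-* c [])
  divideVec {c = c} (x ∷ v) d with divideVec v (∣-tail d) | ∣-head d
  ... | v′ , e | y ,ᴷ f = y ∷ v′ , trans (∷-cong f (trans e (C-* c (fromVec v′)))) (sym (C-* c (y ∷ fromVec v′)))

  cancelTop : ∀ {m} (v w : Vec (Poly n) m) (x a : Poly n) →
    fromVec (Vec.zipWith (λ y z → (a *P y) -P (x *P z)) v w)
      ≋ (C a *P fromVec (v ∷ʳ x)) -P (C x *P fromVec (w ∷ʳ a))
  cancelTop {m} v w x a = begin
    fromVec (Vec.zipWith _ v w)                          ≈⟨ go v w ⟩
    smul a (fromVec (v ∷ʳ x)) -P smul x (fromVec (w ∷ʳ a))
      ≈⟨ +P-cong (sym (C-* a (fromVec (v ∷ʳ x)))) (-P-cong (sym (C-* x (fromVec (w ∷ʳ a))))) ⟩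
    _ ∎
    where
    go : ∀ {m} (v w : Vec (Poly n) m) → fromVec (Vec.zipWith (λ y z → (a *P y) -P (x *P z)) v w)
           ≋ smul a (fromVec (v ∷ʳ x)) -P smul x (fromVec (w ∷ʳ a))
    go [] [] = sym (∷-zero (≋-trans (K.+-congʳ (K.*-comm a x)) (K.-‿inverseʳ (x *P a))) ≋-refl)
    go (y ∷ v) (z ∷ w) = ∷-cong ≋-refl (go v w)

  record PseudoDivision (f g : P) (m : ℕ) : Set where
    constructor pseudo
    field
      scale     : Poly n
      scale≉0   : ¬ scale ≋ 0P
      quotient  : P
      remainder : Vec (Poly n) m
      division  : C scale *P f ≋ (quotient *P g) +P fromVec remainder

  -- Recursion in the manner of Horner: from a remainder r of f, the list (s x) ∷ r is one entry too
  -- long for a remainder of x ∷ f. Scaling by the leading coefficient a of the divisor and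
  -- subtracting b times the divisor cancels its last entry b.
  pseudoDivide : ∀ {m} (w : Vec (Poly n) m) a → ¬ a ≋ 0P → (f : P) →
                 PseudoDivision f (fromVec (w ∷ʳ a)) m
  pseudoDivide {m} w a a≉0 [] = pseudo 1P 1≉0ᴷ [] (Vec.replicate m 0P) (begin
    C 1P *P []                      ≈⟨ mul-nil (C 1P) ⟩
    []                              ≈⟨ zeros m ⟨
    fromVec (Vec.replicate m 0P)    ∎)
    where
    zeros : ∀ m → fromVec (Vec.replicate m 0P) ≋ []
    zeros zero    = ≋-refl
    zeros (suc m) = ∷-zero ≋-refl (zeros m)
  pseudoDivide {m} w a a≉0 (x ∷ f) with pseudoDivide w a a≉0 f
  ... | pseudo s s≉0 Q r e with initLast ((s *P x) ∷ r)
  ... | r′ , b , eq = pseudo (a *P s) (KD.*-nonzero a≉0 s≉0)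
        ((C a *P shift Q) +P C b) (Vec.zipWith (λ y z → (a *P y) -P (b *P z)) r′ w) (begin
    C (a *P s) *P (x ∷ f)
      ≈⟨ *-congʳ {x ∷ f} (C-homo-* a s) ⟩
    C a *P C s *P (x ∷ f)
      ≈⟨ *-assoc (C a) (C s) (x ∷ f) ⟩
    C a *P (C s *P (x ∷ f))
      ≈⟨ *-congˡ {C a} step ⟩
    C a *P ((shift Q *P g) +P fromVec (r′ ∷ʳ b))
      ≈⟨ division-step (C a) (shift Q) g (fromVec (r′ ∷ʳ b)) (C b) ⟩
    (((C a *P shift Q) +P C b) *P g) +P ((C a *P fromVec (r′ ∷ʳ b)) -P (C b *P g))
      ≈⟨ +P-congˡ (((C a *P shift Q) +P C b) *P g) (cancelTop r′ w b a) ⟨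
    (((C a *P shift Q) +P C b) *P g) +P fromVec (Vec.zipWith (λ y z → (a *P y) -P (b *P z)) r′ w) ∎)
    where
    g = fromVec (w ∷ʳ a)
    step : C s *P (x ∷ f) ≋ (shift Q *P g) +P fromVec (r′ ∷ʳ b)
    step = begin
      C s *P (x ∷ f)                              ≈⟨ C-* s (x ∷ f) ⟩
      (s *P x) ∷ smul s f                         ≈⟨ ∷-cong ≋-refl (trans (sym (C-* s f)) e) ⟩
      (s *P x) ∷ ((Q *P g) +P fromVec r)          ≈⟨ ∷-cong (≋-sym (+P-identityˡ (s *P x))) ≋-refl ⟩
      shift (Q *P g) +P fromVec ((s *P x) ∷ r)    ≡⟨ ≡.cong (λ v → shift (Q *P g) +P fromVec v) eq ⟩
      shift (Q *P g) +P fromVec (r′ ∷ʳ b)         ≈⟨ +P-cong (shift-mul Q g) ≋-refl ⟨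
      (shift Q *P g) +P fromVec (r′ ∷ʳ b)         ∎

  HasGCD : P → P → Set
  HasGCD f g = Σ P λ d → d ∣ f × d ∣ g × (∀ h → h ∣ f → h ∣ g → h ∣ d)

  primitive-cong : {p r : P} → p ≋ r → Primitive p → Primitive r
  primitive-cong e prim t d = prim t (∣-respʳ (sym e) d)

  -- The pseudo-Euclidean algorithm; the fuel bounds the degree of the divisor.
  primitiveGCD : ∀ fuel {m} (w : Vec (Poly n) m) a → m ℕ.< fuel → ¬ a ≋ 0P →
                 Primitive (fromVec (w ∷ʳ a)) → (f : P) → HasGCD f (fromVec (w ∷ʳ a))
  primitiveGCD (suc fuel) {m} w a m<fuel a≉0 prim f = divided (pseudoDivide w a a≉0 f)
    where
    g : P
    g = fromVec (w ∷ʳ a)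
    divided : PseudoDivision f g m → HasGCD f g
    divided (pseudo s s≉0 Q r e) = trimmed (trimVec r)
      where
      trimmed : fromVec r ≋ [] ⊎ Leading (fromVec r) m → HasGCD f g
      trimmed (inj₁ r≈0) = g , primitive-cancel g f s≉0 prim (Q , (begin
        C s *P f                  ≈⟨ e ⟩
        (Q *P g) +P fromVec r     ≈⟨ +P-congˡ (Q *P g) r≈0 ⟩
        (Q *P g) +P []            ≈⟨ +P-identityʳ (Q *P g) ⟩
        Q *P g                    ≈⟨ *-comm Q g ⟩
        g *P Q                    ∎)) , ∣-refl , λ h _ h∣g → h∣g
      trimmed (inj₂ (leading _ v b b≉0 r≈)) = reduced (primitivePart (fromVec r) λ z → b≉0 (top-zero v (trans (sym r≈) z)))
        where
        top-zero : ∀ {k} (v : Vec (Poly n) k) → fromVec (v ∷ʳ b) ≋ [] → b ≋ 0P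
        top-zero []      z = head-zero z
        top-zero (_ ∷ v) z = top-zero v (tail-zero z)
        reduced : PrimitivePart (fromVec r) →
                  HasGCD f g
        reduced (c , p , c≉0 , r≈cp , prim-p) = onVec (divideVec r (p , r≈cp))
          where
          onVec : (Σ (Vec (Poly n) m) λ r′ → fromVec r ≋ C c *P fromVec r′) → HasGCD f g
          onVec (r′ , r≈cr′) = recurse (trimVec r′)
            where
            p≈r′ : p ≋ fromVec r′
            p≈r′ = P-cancelˡ (C-nonzero c≉0) (trans (sym r≈cp) r≈cr′)
            recurse : fromVec r′ ≋ [] ⊎ Leading (fromVec r′) m → HasGCD f g
            -- The zero polynomial is not primitive: the constant 0 divides it and would have to
            -- divide 1.
            recurse (inj₁ r′≈0) = ⊥-elim (1≉0ᴷ (≋-trans (K∣.equality 0∣1) (K.zeroˡ (K∣.quotient 0∣1))))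
              where
              0∣1 : 0P ∣ᴷ 1P
              0∣1 = prim-p 0P (∣-respʳ (sym (trans p≈r′ r′≈0)) ∣-0)
            recurse (inj₂ (leading k<m w′ a′ a′≉0 r′≈)) =
              lift (primitiveGCD fuel w′ a′ (ℕₚ.<-≤-trans k<m (ℕ.s≤s⁻¹ m<fuel)) a′≉0 (primitive-cong p≈g′ prim-p) g)
              where
              g′ : P
              g′ = fromVec (w′ ∷ʳ a′)
              p≈g′ : p ≋ g′
              p≈g′ = trans p≈r′ r′≈
              r≈cg′ : fromVec r ≋ C c *P g′
              r≈cg′ = trans r≈cp (*-congˡ {C c} p≈g′)
              lift : HasGCD g g′ → HasGCD f g
              lift (d , d∣g , d∣g′ , greatest) = d ,
                primitive-cancel d f s≉0 (primitive-∣ d∣g prim)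
                  (∣-respʳ (sym e) (∣-+ (∣-*ˡ Q d∣g) (∣-respʳ (sym r≈cg′) (∣-*ˡ (C c) d∣g′)))) ,
                d∣g ,
                λ h h∣f h∣g → greatest h h∣g (primitive-cancel h g′ c≉0 (primitive-∣ h∣g prim)
                  (∣-respʳ r≈cg′ (∣-cancel-+ (∣-respʳ e (∣-*ˡ (C s) h∣f)) (∣-*ˡ Q h∣g))))

  -- The gcd of the contents times the gcd of the primitive parts. A common divisor is split in the
  -- same way: its content divides both contents, its primitive part both primitive parts.
  P-gcd : (f g : P) → HasGCD f g
  P-gcd f g = cases (P-zero? f) (P-zero? g)
    where
    cases : Dec (f ≋ []) → Dec (g ≋ []) → HasGCD f g
    cases (yes f≈0) _ = g , ∣-respʳ (sym f≈0) ∣-0 , ∣-refl , λ h _ h∣g → h∣g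
    cases (no _) (yes g≈0) = f , ∣-refl , ∣-respʳ (sym g≈0) ∣-0 , λ h h∣f _ → h∣f
    cases (no f≉0) (no g≉0) = split (primitivePart f f≉0) (primitivePart g g≉0)
      where
      split : PrimitivePart f →
              PrimitivePart g →
              HasGCD f g
      split (cf , f′ , cf≉0 , f≈ , prim-f) (cg , g′ , cg≉0 , g≈ , prim-g) = onVec (toVec g′)
        where
        onVec : (Σ ℕ λ m → Σ (Vec (Poly n) m) λ v → fromVec v ≡ g′) → HasGCD f g
        onVec (m , v , v≡g′) = trimmed (trimVec v)
          where
          trimmed : fromVec v ≋ [] ⊎ Leading (fromVec v) m → HasGCD f g
          trimmed (inj₁ v≈0) = ⊥-elim (g≉0 (trans g≈
            (trans (*-congˡ {C cg} (≡.subst (_≋ []) v≡g′ v≈0)) (mul-nil (C cg)))))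
          trimmed (inj₂ (leading {k} _ w a a≉0 v≈)) =
            assemble (primitiveGCD (suc k) w a ℕₚ.≤-refl a≉0 (primitive-cong g′≈ prim-g) f′) (gcdᴷ cf cg)
            where
            g′≈ : g′ ≋ fromVec (w ∷ʳ a)
            g′≈ = ≡.subst (_≋ fromVec (w ∷ʳ a)) v≡g′ v≈
            assemble : HasGCD f′ (fromVec (w ∷ʳ a)) →
              (Σ (Poly n) λ γ → γ ∣ᴷ cf × γ ∣ᴷ cg × (∀ h → h ∣ᴷ cf → h ∣ᴷ cg → h ∣ᴷ γ)) →
              HasGCD f g
            assemble (d , d∣f′ , d∣w , greatest) (γ , γ∣cf , γ∣cg , greatestᴷ) =
              C γ *P d , ∣-respʳ (sym f≈) (∣-* (C-homo-∣ γ∣cf) d∣f′) ,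
              ∣-respʳ (sym g≈) (∣-* (C-homo-∣ γ∣cg) (∣-respʳ (sym g′≈) d∣w)) ,
              λ h h∣f h∣g → univ h h∣f h∣g (primitivePart h λ z → h≉0 h∣f z)
              where
              h≉0 : ∀ {h} → h ∣ f → ¬ h ≋ []
              h≉0 (r , e) z = f≉0 (trans e (zero-mul r z))
              univ : ∀ h → h ∣ f → h ∣ g →
                PrimitivePart h → h ∣ C γ *P d
              univ h h∣f h∣g (ch , h′ , ch≉0 , h≈ , prim-h) = ∣-respˡ (sym h≈) (∣-*
                (C-homo-∣ (greatestᴷ ch (content-∣ f′ prim-f (∣-respʳ f≈ (∣-trans ch∣h h∣f)))
                                       (content-∣ g′ prim-g (∣-respʳ g≈ (∣-trans ch∣h h∣g)))))
                (greatest h′ (primitive-cancel h′ f′ cf≉0 prim-h (∣-respʳ f≈ (∣-trans h′∣h h∣f)))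
                  (∣-respʳ g′≈ (primitive-cancel h′ g′ cg≉0 prim-h (∣-respʳ g≈ (∣-trans h′∣h h∣g))))))
                where
                ch∣h : C ch ∣ h
                ch∣h = h′ , h≈
                h′∣h : h′ ∣ h
                h′∣h = C ch , trans h≈ (*-comm (C ch) h′)
                content-∣ : ∀ {c} (p : P) → Primitive p → C ch ∣ C c *P p → ch ∣ᴷ c
                content-∣ {c} p prim d =
                  ∣-head (∣-respʳ (C-def c) (constant-∣ p (C c) ch≉0 prim (∣-respʳ (*-comm (C c) p) d)))

  isGCDDomain : IsGCDDomain (polyRing (suc n))
  isGCDDomain = record
    { zero? = P-zero?
    ; integral = P-integral
    ; gcd = P-gcd
    ; nontrivial = λ e → 1≉0ᴷ (head-zero e)
    }

ℤ-isGCDDomain : IsGCDDomain (polyRing 0)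
ℤ-isGCDDomain = record
  { zero? = zeroℤ?
  ; integral = λ x y e → integral (ℤₚ.i*j≡0⇒i≡0∨j≡0 x (≋⇒≡ e))
  ; gcd = λ x y → ℤ-GCD.gcd x y ,
      to (ℤ-Div.∣ᵤ⇒∣ (ℤ-GCD.gcd[i,j]∣i x y)) , to (ℤ-Div.∣ᵤ⇒∣ (ℤ-GCD.gcd[i,j]∣j x y)) ,
      λ h h∣x h∣y → to (ℤ-Div.∣ᵤ⇒∣ (ℤ-GCD.gcd-greatest {x} {y} {h} (ℤ-Div.∣⇒∣ᵤ (from h∣x)) (ℤ-Div.∣⇒∣ᵤ (from h∣y))))
  ; nontrivial = λ e → 1≢0 (≋⇒≡ e)
  }
  where
  open Divisibility (polyRing 0)
  1≢0 : ¬ ℤ.1ℤ ≡ ℤ.0ℤ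
  1≢0 ()
  zeroℤ? : (x : ℤ) → Dec (_≋_ {0} x ℤ.0ℤ)
  zeroℤ? x with x ℤₚ.≟ ℤ.0ℤ
  ... | yes e = yes (≡⇒≋ e)
  ... | no ¬e = no λ e → ¬e (≋⇒≡ e)
  integral : {x y : ℤ} → x ≡ ℤ.0ℤ ⊎ y ≡ ℤ.0ℤ → _≋_ {0} x ℤ.0ℤ ⊎ _≋_ {0} y ℤ.0ℤ
  integral (inj₁ e) = inj₁ (≡⇒≋ e)
  integral (inj₂ e) = inj₂ (≡⇒≋ e)
  to : {x y : ℤ} → x ℤ-Div.∣ y → x ∣ y
  to {x} (ℤ-Div.divides k e) = k , ≡⇒≋ (≡.trans e (ℤₚ.*-comm k x))
  from : {x y : ℤ} → x ∣ y → x ℤ-Div.∣ y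
  from {x} (k , e) = ℤ-Div.divides k (≡.trans (≋⇒≡ e) (ℤₚ.*-comm x k))

polyGCDDomain : ∀ n → IsGCDDomain (polyRing n)
polyGCDDomain zero    = ℤ-isGCDDomain
polyGCDDomain (suc n) = PolyGCD.isGCDDomain n (polyGCDDomain n)

-- Substitutions and degrees

module EvaluationLemmas {c ℓ} (E : CommutativeRing c ℓ) {n : ℕ} (ρ : Fin n → CommutativeRing.Carrier E) where
  open CommutativeRing E hiding (zero)
  open Exp semiring using (_^_)
  open Exp (CommutativeRing.semiring (polyRing n)) using () renaming (_^_ to _^ᴾ_)
  open Evaluation E
  open Divisibility E using (_∣_; _,_)
  open Divisibility (polyRing n) using () renaming (_∣_ to _∣ᴾ_; _,_ to _,ᴾ_)
  open Solver E using (solve)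
  open SetoidReasoning setoid

  eval-minus : ∀ p r → eval ρ (p -P r) ≈ eval ρ p - eval ρ r
  eval-minus p r = trans (eval-+ ρ p (-P r)) (+-congˡ (eval-neg ρ r))

  eval-^ : ∀ (p : Poly n) k → eval ρ (p ^ᴾ k) ≈ eval ρ p ^ k
  eval-^ p zero    = eval-1 {n} ρ
  eval-^ p (suc k) = trans (eval-* ρ p (p ^ᴾ k)) (*-congˡ (eval-^ p k))

  eval-∣ : ∀ {p r} → p ∣ᴾ r → eval ρ p ∣ eval ρ r
  eval-∣ {p} (s ,ᴾ e) = eval ρ s , trans (eval-cong ρ e) (eval-* ρ p s)

  eval-fromℤ : ∀ z → eval ρ (Evaluation.fromℤ (polyRing n) z) ≈ fromℤ z
  eval-fromℤ z = go z
    where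
    module S = Evaluation (polyRing n)
    nat : ∀ k → eval ρ (S.fromℤ (+ k)) ≈ fromℤ (+ k)
    nat zero    = eval-0 {n} ρ
    nat (suc k) = trans (eval-+ ρ 1P (S.fromℤ (+ k))) (+-cong (eval-1 {n} ρ) (nat k))
    go : ∀ z → eval ρ (S.fromℤ z) ≈ fromℤ z
    go (+ k)    = nat k
    go -[1+ k ] = trans (eval-neg ρ (S.fromℤ (+ suc k))) (-‿cong (nat (suc k)))

  eval-eval : ∀ {m} (σ : Fin m → Poly n) (p : Poly m) →
    eval ρ (Evaluation.eval (polyRing n) σ p) ≈ eval (λ i → eval ρ (σ i)) p
  eval-eval {zero}  σ z = eval-fromℤ z
  eval-eval {suc m} σ [] = eval-0 {n} ρ
  eval-eval {suc m} σ (p ∷ ps) = begin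
    eval ρ (S.eval (λ i → σ (suc i)) p +P (σ zero *P S.eval σ ps))
      ≈⟨ eval-+ ρ (S.eval (λ i → σ (suc i)) p) (σ zero *P S.eval σ ps) ⟩
    eval ρ (S.eval (λ i → σ (suc i)) p) + eval ρ (σ zero *P S.eval σ ps)
      ≈⟨ +-cong (eval-eval (λ i → σ (suc i)) p) (trans (eval-* ρ (σ zero) (S.eval σ ps)) (*-congˡ (eval-eval σ ps))) ⟩
    eval (λ i → eval ρ (σ i)) (p ∷ ps) ∎
    where module S = Evaluation (polyRing n)

  -- This and the next four lemmas give the substitutions that turn the factors occurring in the
  -- denominators into 1; the proofs of coprimality rest on them.
  eval-1-x*y : ∀ i y → ρ i ≈ 0# → eval ρ (1P -P (varP i *P y)) ≈ 1#
  eval-1-x*y i y h = begin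
    eval ρ (1P -P (varP i *P y))        ≈⟨ eval-minus 1P (varP i *P y) ⟩
    eval ρ 1P - eval ρ (varP i *P y)    ≈⟨ +-cong (eval-1 {n} ρ) (-‿cong (eval-* ρ (varP i) y)) ⟩
    1# - eval ρ (varP i) * eval ρ y     ≈⟨ +-congˡ (-‿cong (*-congʳ (trans (eval-var ρ i) h))) ⟩
    1# - 0# * eval ρ y                  ≈⟨ solve 1 (λ y → :1 :- :0 :* y := :1) (eval ρ y) ⟩
    1#                                  ∎

  eval-1+x*y : ∀ i y → ρ i ≈ 0# → eval ρ (1P +P (varP i *P y)) ≈ 1#
  eval-1+x*y i y h = begin
    eval ρ (1P +P (varP i *P y))        ≈⟨ eval-+ ρ 1P (varP i *P y) ⟩
    eval ρ 1P + eval ρ (varP i *P y)    ≈⟨ +-cong (eval-1 {n} ρ) (eval-* ρ (varP i) y) ⟩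
    1# + eval ρ (varP i) * eval ρ y     ≈⟨ +-congˡ (*-congʳ (trans (eval-var ρ i) h)) ⟩
    1# + 0# * eval ρ y                  ≈⟨ solve 1 (λ y → :1 :+ :0 :* y := :1) (eval ρ y) ⟩
    1#                                  ∎

  eval-x-y : ∀ i y z → eval ρ y ≈ z → ρ i ≈ 1# + z → eval ρ (varP i -P y) ≈ 1#
  eval-x-y i y z h k = begin
    eval ρ (varP i -P y)          ≈⟨ eval-minus (varP i) y ⟩
    eval ρ (varP i) - eval ρ y    ≈⟨ +-cong (trans (eval-var ρ i) k) (-‿cong h) ⟩
    1# + z - z                    ≈⟨ solve 1 (λ z → :1 :+ z :- z := :1) z ⟩
    1#                            ∎

  eval-xx′-y : ∀ i j y z → eval ρ y ≈ z → ρ i ≈ 1# + z → ρ j ≈ 1# → eval ρ ((varP i *P varP j) -P y) ≈ 1#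
  eval-xx′-y i j y z h k l = begin
    eval ρ ((varP i *P varP j) -P y)              ≈⟨ eval-minus (varP i *P varP j) y ⟩
    eval ρ (varP i *P varP j) - eval ρ y
      ≈⟨ +-cong (trans (eval-* ρ (varP i) (varP j)) (*-cong (trans (eval-var ρ i) k) (trans (eval-var ρ j) l))) (-‿cong h) ⟩
    (1# + z) * 1# - z                             ≈⟨ solve 1 (λ z → (:1 :+ z) :* :1 :- z := :1) z ⟩
    1#                                            ∎

  eval-xy-x′ : ∀ i j y → ρ i ≈ 0# → ρ j ≈ - 1# → eval ρ ((varP i *P y) -P varP j) ≈ 1#
  eval-xy-x′ i j y k l = begin
    eval ρ ((varP i *P y) -P varP j)              ≈⟨ eval-minus (varP i *P y) (varP j) ⟩
    eval ρ (varP i *P y) - eval ρ (varP j)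
      ≈⟨ +-cong (trans (eval-* ρ (varP i) y) (*-congʳ (trans (eval-var ρ i) k))) (-‿cong (trans (eval-var ρ j) l)) ⟩
    0# * eval ρ y - - 1#                          ≈⟨ solve 1 (λ y → :0 :* y :- :- :1 := :1) (eval ρ y) ⟩
    1#                                            ∎

module _ where
  open Evaluation

  eval-constants : ∀ {k n} (ρ : Fin k → Poly n) (p : Poly k) →
    eval (polyRing (suc n)) (λ i → ρ i ∷ []) p ≋ eval (polyRing n) ρ p ∷ []
  eval-constants {zero} {n} ρ z = go z
    where
    nat : ∀ k → fromℤ (polyRing (suc n)) (+ k) ≋ fromℤ (polyRing n) (+ k) ∷ []
    nat zero    = ≋-sym (∷-zero ≋-refl ≋-refl)
    nat (suc k) = +P-congˡ (1P ∷ []) (nat k)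
    go : ∀ z → fromℤ (polyRing (suc n)) z ≋ fromℤ (polyRing n) z ∷ []
    go (+ k)    = nat k
    go -[1+ k ] = -P-cong (nat (suc k))
  eval-constants {suc k} ρ [] = ≋-sym (∷-zero ≋-refl ≋-refl)
  eval-constants {suc k} {n} ρ (p ∷ ps) = begin
    eval (polyRing (suc n)) (λ i → ρ (suc i) ∷ []) p +P ((ρ zero ∷ []) *P eval (polyRing (suc n)) (λ i → ρ i ∷ []) ps)
      ≈⟨ +P-cong (eval-constants (λ i → ρ (suc i)) p)
           (MulLaws.*P-cong (mulLaws (suc n)) (≋-refl {p = ρ zero ∷ []}) (eval-constants ρ ps)) ⟩
    (eval (polyRing n) (λ i → ρ (suc i)) p +P ((ρ zero *P eval (polyRing n) ρ ps) +P 0P)) ∷ []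
      ≈⟨ ∷-cong (+P-congˡ (eval (polyRing n) (λ i → ρ (suc i)) p) (+P-identityʳ (ρ zero *P eval (polyRing n) ρ ps))) ≋-refl ⟩
    eval (polyRing n) ρ (p ∷ ps) ∷ [] ∎
    where open SetoidReasoning (polySetoid (suc n))

  eval-varP : ∀ {n} (p : Poly n) → eval (polyRing n) varP p ≋ p
  eval-varP {zero} (+ k) = ≡⇒≋ (nat k)
    where
    nat : ∀ k → fromℤ (polyRing 0) (+ k) ≡ + k
    nat zero    = ≡.refl
    nat (suc k) = ≡.cong (λ z → ℤ.1ℤ ℤ.+ z) (nat k)
  eval-varP {zero} -[1+ k ] = -P-cong (eval-varP {zero} (+ suc k))
  eval-varP {suc n} [] = ≋-refl
  eval-varP {suc n} (p ∷ ps) = begin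
    eval (polyRing (suc n)) (λ i → varP i ∷ []) p +P (varP {suc n} zero *P eval (polyRing (suc n)) varP ps)
      ≈⟨ +P-cong (eval-constants varP p)
           (MulLaws.*P-cong (mulLaws (suc n)) (≋-refl {p = varP zero}) (eval-varP ps)) ⟩
    (eval (polyRing n) varP p ∷ []) +P (varP {suc n} zero *P ps)
      ≈⟨ +P-cong (∷-cong (eval-varP p) ≋-refl) (shift-mul (1P ∷ []) ps) ⟩
    (p ∷ []) +P shift (1P *P ps)
      ≈⟨ ∷-cong (+P-identityʳ p) (MulLaws.*P-identityˡ (mulLaws (suc n)) ps) ⟩
    p ∷ ps ∎
    where
    open SetoidReasoning (polySetoid (suc n))
    open ListMul n (mulLaws n)

module Degree {n : ℕ} (D : IsGCDDomain (polyRing n)) where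
  open ListMul n (mulLaws n)
  open GCDDomain D using (*-nonzero)
  open IsGCDDomain D using (zero?)

  nth : Poly (suc n) → ℕ → Poly n
  nth []      _       = 0P
  nth (x ∷ p) zero    = x
  nth (x ∷ p) (suc k) = nth p k

  nth-cong : ∀ {p r : Poly (suc n)} → p ≋ r → ∀ k → nth p k ≋ nth r k
  nth-cong {[]}    {[]}    e k       = ≋-refl
  nth-cong {[]}    {y ∷ r} e zero    = ≋-sym (head-zero (≋-sym e))
  nth-cong {[]}    {y ∷ r} e (suc k) = nth-cong (≋-sym (tail-zero (≋-sym e))) k
  nth-cong {x ∷ p} {[]}    e zero    = head-zero e
  nth-cong {x ∷ p} {[]}    e (suc k) = nth-cong (tail-zero e) k
  nth-cong {x ∷ p} {y ∷ r} e zero    = head-≋ e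
  nth-cong {x ∷ p} {y ∷ r} e (suc k) = nth-cong (tail-≋ e) k

  nth-zero : (p : Poly (suc n)) → (∀ k → nth p k ≋ 0P) → p ≋ []
  nth-zero []      _ = ≋-refl
  nth-zero (x ∷ p) z = ∷-zero (z 0) (nth-zero p λ k → z (suc k))

  nth-+ : (p r : Poly (suc n)) → ∀ k → nth (p +P r) k ≋ nth p k +P nth r k
  nth-+ []      r       k       = ≋-sym (+P-identityˡ (nth r k))
  nth-+ (x ∷ p) []      k       = ≋-sym (+P-identityʳ (nth (x ∷ p) k))
  nth-+ (x ∷ p) (y ∷ r) zero    = ≋-refl
  nth-+ (x ∷ p) (y ∷ r) (suc k) = nth-+ p r k

  nth-smul : ∀ x (p : Poly (suc n)) k → nth (smul x p) k ≋ x *P nth p k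
  nth-smul x []      k       = ≋-sym (*P-zeroʳ x)
  nth-smul x (y ∷ p) zero    = ≋-refl
  nth-smul x (y ∷ p) (suc k) = nth-smul x p k

  record Top (p : Poly (suc n)) (k : ℕ) (a : Poly n) : Set where
    constructor top
    field
      top-coeff : nth p k ≋ a
      above     : ∀ j → k ℕ.< j → nth p j ≋ 0P
  open Top

  nth-* : ∀ {p r : Poly (suc n)} {k l a b} → Top p k a → Top r l b → nth (p *P r) (k ℕ.+ l) ≋ a *P b
  nth-* {[]} {b = b} t s = ≋-sym (≋-trans (*P-cong (≋-sym (top-coeff t)) ≋-refl) (*P-zeroˡ b))
  nth-* {x ∷ p} {r} {zero} {l} {a} {b} t s = begin
    nth (smul x r +P shift (p *P r)) l           ≈⟨ nth-+ (smul x r) (shift (p *P r)) l ⟩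
    nth (smul x r) l +P nth (shift (p *P r)) l
      ≈⟨ +P-cong (≋-trans (nth-smul x r l) (*P-cong (top-coeff t) (top-coeff s))) (tail-vanishes l) ⟩
    (a *P b) +P 0P                               ≈⟨ +P-identityʳ (a *P b) ⟩
    a *P b                                       ∎
    where
    open SetoidReasoning (polySetoid n)
    pr≈0 : p *P r ≋ []
    pr≈0 = zero-mul r (nth-zero p λ k → above t (suc k) (ℕ.s≤s ℕ.z≤n))
    tail-vanishes : ∀ l → nth (shift (p *P r)) l ≋ 0P
    tail-vanishes zero    = ≋-refl
    tail-vanishes (suc l) = nth-cong pr≈0 l
  nth-* {x ∷ p} {r} {suc k} {l} {a} {b} t s = begin
    nth (smul x r +P shift (p *P r)) (suc k ℕ.+ l)
      ≈⟨ nth-+ (smul x r) (shift (p *P r)) (suc k ℕ.+ l) ⟩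
    nth (smul x r) (suc k ℕ.+ l) +P nth (p *P r) (k ℕ.+ l)
      ≈⟨ +P-cong (≋-trans (nth-smul x r (suc k ℕ.+ l)) (≋-trans (*P-cong (≋-refl {p = x}) (above s (suc k ℕ.+ l) (ℕ.s≤s (ℕₚ.m≤n+m l k)))) (*P-zeroʳ x)))
           (nth-* {p} {r} {k} {l} (top (top-coeff t) λ j k<j → above t (suc j) (ℕ.s≤s k<j)) s) ⟩
    0P +P (a *P b)   ≈⟨ +P-identityˡ (a *P b) ⟩
    a *P b           ∎
    where open SetoidReasoning (polySetoid n)

  degree : (p : Poly (suc n)) → p ≋ [] ⊎ Σ ℕ λ k → Σ (Poly n) λ a → ¬ a ≋ 0P × Top p k a
  degree [] = inj₁ ≋-refl
  degree (x ∷ p) = case degree p of λ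
    { (inj₂ (k , a , a≉0 , t)) → inj₂ (suc k , a , a≉0 ,
        top (top-coeff t) λ { (suc j) (ℕ.s≤s k<j) → above t j k<j })
    ; (inj₁ p≈0) → case zero? x of λ
      { (yes x≈0) → inj₁ (∷-zero x≈0 p≈0)
      ; (no x≉0)  → inj₂ (0 , x , x≉0 , top ≋-refl λ { (suc j) _ → nth-cong p≈0 j }) } }

  -- Leading coefficients multiply to a nonzero element, so degrees add, and a factor of a nonzero
  -- constant has degree 0.
  constant-divisor : ∀ {p r : Poly (suc n)} {v} → ¬ v ≋ 0P → p *P r ≋ v ∷ [] → Σ (Poly n) λ x → p ≋ x ∷ []
  constant-divisor {p} {r} {v} v≉0 e = cases (degree p) (degree r)
    where
    cases : p ≋ [] ⊎ (Σ ℕ λ k → Σ (Poly n) λ a → ¬ a ≋ 0P × Top p k a) →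
            r ≋ [] ⊎ (Σ ℕ λ k → Σ (Poly n) λ a → ¬ a ≋ 0P × Top r k a) → Σ (Poly n) λ x → p ≋ x ∷ []
    cases (inj₁ p≈0) _ = ⊥-elim (v≉0 (head-zero (≋-trans (≋-sym e) (zero-mul r p≈0))))
    cases _ (inj₁ r≈0) = ⊥-elim (v≉0 (head-zero (≋-trans (≋-sym e) (≋-trans (mul-comm p r) (zero-mul p r≈0)))))
    cases (inj₂ (suc k , a , a≉0 , t)) (inj₂ (l , b , b≉0 , s)) =
      ⊥-elim (*-nonzero a≉0 b≉0 (≋-trans (≋-sym (nth-* {p} {r} {suc k} {l} t s)) (nth-cong e (suc k ℕ.+ l))))
    cases (inj₂ (zero , a , a≉0 , t)) (inj₂ _) = a , first p t
      where
      first : ∀ p → Top p 0 a → p ≋ a ∷ []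
      first []      t = ≋-sym (∷-zero (≋-sym (top-coeff t)) ≋-refl)
      first (x ∷ p) t = ∷-cong (top-coeff t) (nth-zero p λ k → above t (suc k) (ℕ.s≤s ℕ.z≤n))

-- Polynomials that do not involve the variable i: replacing that variable by a new one gives a constant.
module Freeness {n : ℕ} (D : IsGCDDomain (polyRing n)) where
  open Evaluation
  open Degree D using (constant-divisor)
  open Divisibility (polyRing n)
  open MulLaws (mulLaws (suc n)) using () renaming (*P-cong to *P-cong′)

  -- The new variable is made the outermost one, so that independence of it shows as a coefficient
  -- list with a single entry.
  generic : Fin n → Fin n → Poly (suc n)
  generic i j = if does (i Fin.≟ j) then varP zero else varP (suc j)

  Free : Fin n → Poly n → Set
  Free i v = Σ (Poly n) λ x → eval (polyRing (suc n)) (generic i) v ≋ x ∷ []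

  free-1 : ∀ i → Free i 1P
  free-1 i = 1P , eval-1 (polyRing (suc n)) {n} (generic i)

  free-var : ∀ i j → ¬ i ≡ j → Free i (varP j)
  free-var i j i≢j = varP j , ≋-trans (eval-var (polyRing (suc n)) (generic i) j) (go (i Fin.≟ j))
    where
    go : (d : Dec (i ≡ j)) → (if does d then varP zero else varP (suc j)) ≋ varP j ∷ []
    go (yes e) = ⊥-elim (i≢j e)
    go (no _)  = ≋-refl

  free-+ : ∀ i u v → Free i u → Free i v → Free i (u +P v)
  free-+ i u v (x , e) (y , f) = x +P y , ≋-trans (eval-+ (polyRing (suc n)) (generic i) u v) (+P-cong e f)

  free-minus : ∀ i u v → Free i u → Free i v → Free i (u -P v)
  free-minus i u v (x , e) (y , f) = x -P y ,
    ≋-trans (EvaluationLemmas.eval-minus (polyRing (suc n)) (generic i) u v) (+P-cong e (-P-cong f))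

  free-* : ∀ i u v → Free i u → Free i v → Free i (u *P v)
  free-* i u v (x , e) (y , f) = (x *P y) +P 0P ,
    ≋-trans (eval-* (polyRing (suc n)) (generic i) u v) (*P-cong′ e f)

  open Exp (CommutativeRing.semiring (polyRing n)) using (_^_)

  free-^ : ∀ i u k → Free i u → Free i (u ^ k)
  free-^ i u zero    F = free-1 i
  free-^ i u (suc k) F = free-* i u (u ^ k) F (free-^ i u k F)

  module _ {c ℓ} (E : CommutativeRing c ℓ) where
    open CommutativeRing E using (Carrier; _≈_; _+_; _*_; 0#; refl; sym; trans; +-congˡ; +-identityʳ; zeroʳ; setoid)
    open SetoidReasoning setoid

    -- Specialising the new variable to σ i turns the generic substitution back into σ, while the
    -- constant `proj₁ F` does not see the value σ i.
    free-witness : ∀ i v (F : Free i v) (ρ σ : Fin n → Carrier) → (∀ j → ¬ i ≡ j → ρ j ≈ σ j) →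
      eval E σ v ≈ eval E ρ (proj₁ F)
    free-witness i v (x , e) ρ σ agree = begin
      eval E σ v                                       ≈⟨ eval-congᵉ E (λ j → back j (i Fin.≟ j)) v ⟨
      eval E (λ j → eval E τ (generic i j)) v          ≈⟨ EvaluationLemmas.eval-eval E τ (generic i) v ⟨
      eval E τ (eval (polyRing (suc n)) (generic i) v) ≈⟨ eval-cong E τ e ⟩
      eval E ρ x + σ i * 0#                            ≈⟨ trans (+-congˡ (zeroʳ (σ i))) (+-identityʳ _) ⟩
      eval E ρ x                                       ∎
      where
      τ : Fin (suc n) → Carrier
      τ zero    = σ i
      τ (suc j) = ρ j
      back : ∀ j (d : Dec (i ≡ j)) → eval E τ (if does d then varP zero else varP (suc j)) ≈ σ j
      back j (yes ≡.refl) = eval-var E τ zero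
      back j (no i≢j)     = trans (eval-var E τ (suc j)) (agree j i≢j)

    free-eval : ∀ i v → Free i v → (ρ σ : Fin n → Carrier) → (∀ j → ¬ i ≡ j → ρ j ≈ σ j) → eval E σ v ≈ eval E ρ v
    free-eval i v F ρ σ agree = trans (free-witness i v F ρ σ agree) (sym (free-witness i v F ρ ρ λ _ _ → refl))

  -- After the generic substitution t divides a constant in the new variable. This constant is
  -- nonzero, since evaluating it at the variables gives back v; so its divisors are constants as
  -- well.
  free-divisor : ∀ i t v → ¬ v ≋ 0P → Free i v → t ∣ v → Free i t
  free-divisor i t v v≉0 (x , e) (w , f) = constant-divisor x≉0
    (≋-trans (≋-sym (eval-* (polyRing (suc n)) (generic i) t w))
      (≋-trans (≋-sym (eval-cong (polyRing (suc n)) (generic i) f)) e))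
    where
    x≉0 : ¬ x ≋ 0P
    x≉0 z = v≉0 (≋-trans (≋-sym (eval-varP v)) (≋-trans
      (free-witness (polyRing n) i v (x , e) varP varP (λ _ _ → ≋-refl)) (≋-trans (eval-varP x) z)))

  _[_≔_] : (Fin n → Poly n) → Fin n → Poly n → Fin n → Poly n
  (ρ [ i ≔ u ]) j = if does (i Fin.≟ j) then u else ρ j

  free-update : ∀ i v → Free i v → ∀ ρ u → eval (polyRing n) (ρ [ i ≔ u ]) v ≋ eval (polyRing n) ρ v
  free-update i v F ρ u = free-eval (polyRing n) i v F ρ (ρ [ i ≔ u ]) λ j i≢j → ≋-sym (off j i≢j (i Fin.≟ j))
    where
    off : ∀ j → ¬ i ≡ j → (d : Dec (i ≡ j)) → (if does d then u else ρ j) ≋ ρ j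
    off j i≢j (yes e) = ⊥-elim (i≢j e)
    off j i≢j (no _)  = ≋-refl

  -- The source of all coprimality statements: t is a common divisor that avoids the substituted
  -- variables, and ρ is chosen to send v to 1.
  unit-by-substitution : ∀ {t v} (ρ : Fin n → Poly n) → eval (polyRing n) ρ t ≋ t →
    eval (polyRing n) ρ v ≋ 1P → t ∣ v → t ∣ 1P
  unit-by-substitution ρ e f d = ∣-respˡ e (∣-respʳ f (EvaluationLemmas.eval-∣ (polyRing n) ρ d))

-- The quadratic summation

module BigOperators {c ℓ} (R : CommutativeRing c ℓ) where
  open CommutativeRing R hiding (zero)
  open Solver R
  open SetoidReasoning setoid

  ∏ ∑ : ℕ → (ℕ → Carrier) → Carrier
  ∏ zero    f = 1#
  ∏ (suc k) f = ∏ k f * f k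
  ∑ zero    f = 0#
  ∑ (suc k) f = ∑ k f + f k

  ∏-cong : ∀ k {f g : ℕ → Carrier} → (∀ j → j ℕ.< k → f j ≈ g j) → ∏ k f ≈ ∏ k g
  ∏-cong zero    e = refl
  ∏-cong (suc k) e = *-cong (∏-cong k λ j j<k → e j (ℕₚ.m<n⇒m<1+n j<k)) (e k ℕₚ.≤-refl)

  ∑-cong : ∀ k {f g : ℕ → Carrier} → (∀ j → j ℕ.< k → f j ≈ g j) → ∑ k f ≈ ∑ k g
  ∑-cong zero    e = refl
  ∑-cong (suc k) e = +-cong (∑-cong k λ j j<k → e j (ℕₚ.m<n⇒m<1+n j<k)) (e k ℕₚ.≤-refl)

  ∏-head : ∀ k (f : ℕ → Carrier) → ∏ (suc k) f ≈ f 0 * ∏ k (λ j → f (suc j))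
  ∏-head zero    f = trans (*-identityˡ _) (sym (*-identityʳ _))
  ∏-head (suc k) f = trans (*-congʳ (∏-head k f)) (*-assoc _ _ _)

  ∏-0 : ∀ {k} (f : ℕ → Carrier) j → j ℕ.< k → f j ≈ 0# → ∏ k f ≈ 0#
  ∏-0 {suc k} f j (s≤s j≤k) e with ℕₚ.m≤n⇒m<n∨m≡n j≤k
  ... | inj₁ j<k    = trans (*-congʳ (∏-0 f j j<k e)) (zeroˡ _)
  ... | inj₂ ≡.refl = trans (*-congˡ e) (zeroʳ _)

  ∑-0 : ∀ k {f : ℕ → Carrier} → (∀ j → j ℕ.< k → f j ≈ 0#) → ∑ k f ≈ 0#
  ∑-0 zero    e = refl
  ∑-0 (suc k) e = trans (+-cong (∑-0 k λ j j<k → e j (ℕₚ.m<n⇒m<1+n j<k)) (e k ℕₚ.≤-refl)) (+-identityʳ 0#)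

  ∑-*ˡ : ∀ k a (f : ℕ → Carrier) → ∑ k (λ j → a * f j) ≈ a * ∑ k f
  ∑-*ˡ zero    a f = sym (zeroʳ a)
  ∑-*ˡ (suc k) a f = trans (+-congʳ (∑-*ˡ k a f)) (sym (distribˡ a _ _))

  ∑-++ : ∀ k l (f : ℕ → Carrier) → ∑ (k ℕ.+ l) f ≈ ∑ k f + ∑ l (λ j → f (k ℕ.+ j))
  ∑-++ k zero    f = trans (reflexive (≡.cong (λ i → ∑ i f) (ℕₚ.+-identityʳ k))) (sym (+-identityʳ _))
  ∑-++ k (suc l) f = begin
    ∑ (k ℕ.+ suc l) f                       ≡⟨ ≡.cong (λ i → ∑ i f) (ℕₚ.+-suc k l) ⟩
    ∑ (k ℕ.+ l) f + f (k ℕ.+ l)             ≈⟨ +-congʳ (∑-++ k l f) ⟩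
    ∑ k f + ∑ l (λ j → f (k ℕ.+ j)) + f (k ℕ.+ l)  ≈⟨ +-assoc _ _ _ ⟩
    ∑ k f + ∑ (suc l) (λ j → f (k ℕ.+ j))   ∎

-- Writing A = bcg, e = qg, B = q²cg, C = q²bg, E = qbc and dd′ = qA, the terms below are
--   (A,d,d′;q²)ₖ (b,c,e;q)ₖ / ((q,d′,d;q)ₖ (B,C,E;q²)ₖ) · (1 - Aq³ᵏ) qᵏ,
-- with the inverses of the factors of the denominator supplied as data.
module QuadraticSum {a ℓ} (R : CommutativeRing a ℓ) (q : CommutativeRing.Carrier R) where
  open CommutativeRing R hiding (zero)
  open Exp semiring using (_^_)
  open Solver R
  open BigOperators R
  open SetoidReasoning setoid

  module Summands (q b c g d x : Carrier) where
    private
      A e C E : Carrier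
      A = b * c * g
      e = q * g
      C = q * q * (b * g)
      E = q * (b * c)

    -- With x = q^k, the numerators of Γ · `term`, Λ · shifted `term`, H (k + 1) and H k, once
    -- `weight k` and the inverses collected in `scaled` have been taken out.
    I₁ I₂ I₃ I₄ : Carrier
    I₁ = (1# - b) * (d - c * g) * ((1# - A * (x * x * x)) * x)
       * ((1# - d * x) * (1# - d * (q * x)) * (1# - C * (x * x)) * (1# - E * (x * x)))
    I₂ = (1# - A * (x * x)) * (1# - d * (x * x)) * (1# - b * x) * (1# - b * (q * x)) * (d * q - c) * (d - g)
       * ((1# - b * (q * q) * c * g * (x * x * x)) * x)
    I₃ = (1# - A * (x * x)) * (1# - d * (x * x)) * (d - q * A * (x * x)) * (1# - b * x) * (1# - c * x) * (1# - e * x)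
       * (1# - b * d * ((q * x) * (q * x)))
    I₄ = (1# - c * g * (x * x)) * (d - A * x) * (1# - x) * (1# - b * d * (x * x))
       * ((1# - d * (q * x)) * (1# - C * (x * x)) * (1# - E * (x * x)))

  -- In the usual notation e = qA/bc, B = q²A/b, C = q²A/c and E = q²A/e. Taking the factor g = A/bc
  -- as a parameter makes all of them polynomial, so that the identities below hold in any
  -- commutative ring.
  record System : Set a where
    field
      b c g d d′ : Carrier
      iq id id′ iB iC iE : ℕ → Carrier
    A e B C E : Carrier
    A = b * c * g
    e = q * g
    B = q * q * (c * g)
    C = q * q * (b * g)
    E = q * (b * c)

    ratio : ℕ → Carrier
    ratio j = (1# - A * (x * x)) * (1# - d * (x * x)) * (1# - d′ * (x * x))
            * (1# - b * x) * (1# - c * x) * (1# - e * x)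
            * (iq j * id j * id′ j * iB j * iC j * iE j)
      where x = q ^ j

    weight : ℕ → Carrier
    weight k = ∏ k ratio

    term : ℕ → Carrier
    term k = weight k * ((1# - A * (x * x * x)) * x)
      where x = q ^ k

  open System

  record Valid (D : System) (m : ℕ) : Set ℓ where
    field
      dd′      : d D * d′ D ≈ q * A D
      iq-inv   : ∀ j → j ℕ.< m → (1# - q * q ^ j) * iq D j ≈ 1#
      -- The range is doubled because `shift` advances `id` by two places, but the other inverses by
      -- at most one.
      id-inv   : ∀ j → j ℕ.< m ℕ.+ m → (1# - d D * q ^ j) * id D j ≈ 1#
      id′-inv  : ∀ j → j ℕ.< m → (1# - d′ D * q ^ j) * id′ D j ≈ 1#
      iB-inv   : ∀ j → j ℕ.< m → (1# - B D * (q ^ j * q ^ j)) * iB D j ≈ 1#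
      iC-inv   : ∀ j → j ℕ.< m → (1# - C D * (q ^ j * q ^ j)) * iC D j ≈ 1#
      iE-inv   : ∀ j → j ℕ.< m → (1# - E D * (q ^ j * q ^ j)) * iE D j ≈ 1#

  open Valid

  -- A, d and b are multiplied by q², and so are C and E, whereas B and d′ stay. In base q² this
  -- advances the inverses for C and E by one place, in base q those for d by two.
  shift : System → System
  shift D = record
    { b = b D * (q * q) ; c = c D ; g = g D ; d = d D * (q * q) ; d′ = d′ D
    ; iq = iq D ; id = λ j → id D (suc (suc j)) ; id′ = id′ D
    ; iB = iB D ; iC = λ j → iC D (suc j) ; iE = λ j → iE D (suc j)
    }

  factor₁ : ∀ y x → 1# - y * (q * q) * x ≈ 1# - y * (q * (q * x))
  factor₁ y x = solve 3 (λ q y x → :1 :- y :* (q :* q) :* x := :1 :- y :* (q :* (q :* x))) q y x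

  factor₂ : ∀ y x → 1# - y * (q * q) * (x * x) ≈ 1# - y * ((q * x) * (q * x))
  factor₂ y x = solve 3 (λ q y x → :1 :- y :* (q :* q) :* (x :* x) := :1 :- y :* ((q :* x) :* (q :* x))) q y x

  factorA : ∀ b c g x → 1# - b * (q * q) * c * g * (x * x) ≈ 1# - b * c * g * ((q * x) * (q * x))
  factorA b c g x = solve 5 (λ q b c g x →
    :1 :- b :* (q :* q) :* c :* g :* (x :* x) := :1 :- b :* c :* g :* ((q :* x) :* (q :* x))) q b c g x

  factorC : ∀ b g x → 1# - q * q * (b * (q * q) * g) * (x * x) ≈ 1# - q * q * (b * g) * ((q * x) * (q * x))
  factorC b g x = solve 4 (λ q b g x →
    :1 :- q :* q :* (b :* (q :* q) :* g) :* (x :* x) := :1 :- q :* q :* (b :* g) :* ((q :* x) :* (q :* x))) q b g x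

  factorE : ∀ b c x → 1# - q * (b * (q * q) * c) * (x * x) ≈ 1# - q * (b * c) * ((q * x) * (q * x))
  factorE b c x = solve 4 (λ q b c x →
    :1 :- q :* (b :* (q :* q) :* c) :* (x :* x) := :1 :- q :* (b :* c) :* ((q :* x) :* (q :* x))) q b c x

  shift-valid : ∀ {D m} → Valid D (suc m) → Valid (shift D) m
  shift-valid {D} {m} V = record
    { dd′ = begin
        d D * (q * q) * d′ D                ≈⟨ solve 3 (λ d q e → d :* (q :* q) :* e := q :* q :* (d :* e)) (d D) q (d′ D) ⟩
        q * q * (d D * d′ D)                ≈⟨ *-congˡ (dd′ V) ⟩
        q * q * (q * A D)                   ≈⟨ solve 4 (λ q b c g → q :* q :* (q :* (b :* c :* g)) := q :* (b :* (q :* q) :* c :* g)) q (b D) (c D) (g D) ⟩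
        q * (b D * (q * q) * c D * g D)     ∎
    ; iq-inv = λ j j<m → iq-inv V j (ℕₚ.m<n⇒m<1+n j<m)
    ; id-inv = λ j j<2m → trans (*-congʳ (factor₁ (d D) (q ^ j)))
        (id-inv V (suc (suc j)) (s≤s (≡.subst (suc j ℕ.<_) (≡.sym (ℕₚ.+-suc m m)) (s≤s j<2m))))
    ; id′-inv = λ j j<m → id′-inv V j (ℕₚ.m<n⇒m<1+n j<m)
    ; iB-inv = λ j j<m → iB-inv V j (ℕₚ.m<n⇒m<1+n j<m)
    ; iC-inv = λ j j<m → trans (*-congʳ (factorC (b D) (g D) (q ^ j))) (iC-inv V (suc j) (s≤s j<m))
    ; iE-inv = λ j j<m → trans (*-congʳ (factorE (b D) (c D) (q ^ j))) (iE-inv V (suc j) (s≤s j<m))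
    }

  open Summands

  -- The whole content of the relation between a sum and its shift, as a polynomial identity in
  -- independent variables, x standing for q^k.
  telescoping-identity : ∀ q b c g d x → I₁ q b c g d x + I₂ q b c g d x ≈ I₃ q b c g d x - I₄ q b c g d x
  telescoping-identity = solve 6 λ q b c g d x →
    let A = b :* c :* g ; e = q :* g ; C = q :* q :* (b :* g) ; E = q :* (b :* c) in
    (:1 :- b) :* (d :- c :* g) :* ((:1 :- A :* (x :* x :* x)) :* x)
      :* ((:1 :- d :* x) :* (:1 :- d :* (q :* x)) :* (:1 :- C :* (x :* x)) :* (:1 :- E :* (x :* x)))
    :+ (:1 :- A :* (x :* x)) :* (:1 :- d :* (x :* x)) :* (:1 :- b :* x) :* (:1 :- b :* (q :* x)) :* (d :* q :- c) :* (d :- g)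
      :* ((:1 :- b :* (q :* q) :* c :* g :* (x :* x :* x)) :* x)
    := (:1 :- A :* (x :* x)) :* (:1 :- d :* (x :* x)) :* (d :- q :* A :* (x :* x)) :* (:1 :- b :* x) :* (:1 :- c :* x) :* (:1 :- e :* x)
      :* (:1 :- b :* d :* ((q :* x) :* (q :* x)))
    :- (:1 :- c :* g :* (x :* x)) :* (d :- A :* x) :* (:1 :- x) :* (:1 :- b :* d :* (x :* x))
      :* ((:1 :- d :* (q :* x)) :* (:1 :- C :* (x :* x)) :* (:1 :- E :* (x :* x)))

  last-identity : ∀ b c g d x → let A = b * c * g in
    (1# - b) * (d - c * g) * ((1# - A * (x * x * x)) * x) * (1# - d * x)
    + (1# - c * g * (x * x)) * (d - A * x) * (1# - x) * (1# - b * d * (x * x))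
    ≈ (1# - A * (x * x)) * (1# - d * (x * x)) * ((d - c * g * x) * (1# - b * x))
  last-identity = solve 5 λ b c g d x → let A = b :* c :* g in
    (:1 :- b) :* (d :- c :* g) :* ((:1 :- A :* (x :* x :* x)) :* x) :* (:1 :- d :* x)
    :+ (:1 :- c :* g :* (x :* x)) :* (d :- A :* x) :* (:1 :- x) :* (:1 :- b :* d :* (x :* x))
    := (:1 :- A :* (x :* x)) :* (:1 :- d :* (x :* x)) :* ((d :- c :* g :* x) :* (:1 :- b :* x))

  module Telescope (D : System) where
    private
      x : ℕ → Carrier
      x k = q ^ k
      module D = System D
      module D′ = System (shift D)

    Γ Λ : Carrier
    Γ = (1# - b D) * (d D - c D * g D)
    Λ = (1# - A D) * (1# - b D) * (1# - b D * q) * (d D * q - c D) * (d D - g D) * (id D 1 * iC D 0 * iE D 0)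

    -- The antidifference of Γ · `term` + Λ · shifted `term`; its factor 1 - q^k makes it vanish at
    -- k = 0.
    H : ℕ → Carrier
    H k = D.weight k * ((1# - c D * g D * (x k * x k)) * (d D - A D * x k) * (1# - x k)
            * (1# - b D * d D * (x k * x k)) * id D k)

    boundary : ℕ → Carrier
    boundary k = (1# - A D * (x k * x k)) * (1# - d D * (x k * x k)) * (1# - b D * x k) * (1# - b D * x (suc k))
               * (id D k * id D (suc k) * iC D k * iE D k)

    -- Multiplying a parameter by q² moves its product by one factor in base q² and by two in base
    -- q. The factors at the two ends, which do not cancel, are collected in `boundary 0` and
    -- `boundary k`.
    weight-shift : ∀ k → D′.weight k * boundary 0 ≈ D.weight k * boundary k
    weight-shift zero    = refl
    weight-shift (suc k) = begin
      D′.weight k * D′.ratio k * boundary 0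
        ≈⟨ solve 3 (λ w r b → w :* r :* b := w :* b :* r) (D′.weight k) (D′.ratio k) (boundary 0) ⟩
      D′.weight k * boundary 0 * D′.ratio k
        ≈⟨ *-cong (weight-shift k) ratio≈ ⟩
      D.weight k * boundary k * ratio′
        ≈⟨ solve 21 (λ w α₀ δ₀ β₀ β₁ i₀ i₁ s₀ t₀ α₁ δ₁ d′ β₂ c e p i₂ i′ r s₁ t₁ →
             w :* (α₀ :* δ₀ :* β₀ :* β₁ :* (i₀ :* i₁ :* s₀ :* t₀))
               :* (α₁ :* δ₁ :* d′ :* β₂ :* c :* e :* (p :* i₂ :* i′ :* r :* s₁ :* t₁))
             := w :* (α₀ :* δ₀ :* d′ :* β₀ :* c :* e :* (p :* i₀ :* i′ :* r :* s₀ :* t₀))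
               :* (α₁ :* δ₁ :* β₁ :* β₂ :* (i₁ :* i₂ :* s₁ :* t₁)))
             (D.weight k) (1# - A D * (x k * x k)) (1# - d D * (x k * x k)) (1# - b D * x k) (1# - b D * x (suc k))
             (id D k) (id D (suc k)) (iC D k) (iE D k)
             (1# - A D * (x (suc k) * x (suc k))) (1# - d D * (x (suc k) * x (suc k))) (1# - d′ D * (x k * x k))
             (1# - b D * x (suc (suc k))) (1# - c D * x k) (1# - e D * x k)
             (iq D k) (id D (suc (suc k))) (id′ D k) (iB D k) (iC D (suc k)) (iE D (suc k)) ⟩
      D.weight (suc k) * boundary (suc k) ∎
      where
      ratio′ : Carrier
      ratio′ = (1# - A D * (x (suc k) * x (suc k))) * (1# - d D * (x (suc k) * x (suc k))) * (1# - d′ D * (x k * x k))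
             * (1# - b D * x (suc (suc k))) * (1# - c D * x k) * (1# - e D * x k)
             * (iq D k * id D (suc (suc k)) * id′ D k * iB D k * iC D (suc k) * iE D (suc k))
      ratio≈ : D′.ratio k ≈ ratio′
      ratio≈ = *-congʳ (*-congʳ (*-congʳ (*-cong (*-congʳ (*-cong
        (factorA (b D) (c D) (g D) (x k)) (factor₂ (d D) (x k)))) (factor₁ (b D) (x k)))))

    module _ {m : ℕ} (V : Valid D (suc m)) where

      private
        1≤2m : ∀ {k} → k ℕ.≤ m → k ℕ.< suc m ℕ.+ suc m
        1≤2m k≤m = ℕₚ.≤-trans (s≤s k≤m) (ℕₚ.m≤m+n (suc m) (suc m))

      scaled : ℕ → Carrier → Carrier
      scaled k y = D.weight k * (id D k * id D (suc k) * iC D k * iE D k) * y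

      Λ-weight : ∀ k → Λ * D′.weight k ≈ D.weight k * boundary k * ((d D * q - c D) * (d D - g D))
      Λ-weight k = begin
        Λ * D′.weight k
          ≈⟨ *-identityʳ _ ⟨
        Λ * D′.weight k * 1#
          -- `boundary 0` contains 1 - d and its inverse, which cancel and are absent from Λ; they
          -- are put back here.
          ≈⟨ *-congˡ (id-inv V 0 (s≤s z≤n)) ⟨
        Λ * D′.weight k * ((1# - d D * 1#) * id D 0)
          ≈⟨ solve 11 (λ q A b c d g i₀ i₁ s t w →
               (:1 :- A) :* (:1 :- b) :* (:1 :- b :* q) :* (d :* q :- c) :* (d :- g) :* (i₁ :* s :* t) :* w
                 :* ((:1 :- d :* :1) :* i₀)
               := w :* ((:1 :- A :* (:1 :* :1)) :* (:1 :- d :* (:1 :* :1)) :* (:1 :- b :* :1) :* (:1 :- b :* (q :* :1))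
                    :* (i₀ :* i₁ :* s :* t)) :* ((d :* q :- c) :* (d :- g)))
               q (A D) (b D) (c D) (d D) (g D) (id D 0) (id D 1) (iC D 0) (iE D 0) (D′.weight k) ⟩
        D′.weight k * boundary 0 * ((d D * q - c D) * (d D - g D))
          ≈⟨ *-congʳ (weight-shift k) ⟩
        D.weight k * boundary k * ((d D * q - c D) * (d D - g D)) ∎

      -- Products of a factor with its inverse are inserted or removed until all four terms share
      -- the inverses in `scaled`; what remains is `telescoping-identity`.
      step : ∀ k → k ℕ.≤ m → Γ * D.term k + Λ * D′.term k + H k ≈ H (suc k)
      step k k≤m = begin
        Γ * D.term k + Λ * D′.term k + H k
          ≈⟨ +-cong (+-cong Γ-term Λ-term) H-term ⟩
        scaled k J₁ + scaled k J₂ + scaled k J₄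
          ≈⟨ solve 4 (λ s a b c → s :* a :+ s :* b :+ s :* c := s :* ((a :+ b) :+ c)) (scaled′) J₁ J₂ J₄ ⟩
        scaled k ((J₁ + J₂) + J₄)
          ≈⟨ *-congˡ (+-congʳ (telescoping-identity q (b D) (c D) (g D) (d D) y)) ⟩
        scaled k ((J₃ - J₄) + J₄)
          ≈⟨ *-congˡ (solve 2 (λ a b → a :- b :+ b := a) J₃ J₄) ⟩
        scaled k J₃
          ≈⟨ H-suc ⟨
        H (suc k) ∎
        where
        y scaled′ J₁ J₂ J₃ J₄ : Carrier
        y = q ^ k
        scaled′ = D.weight k * (id D k * id D (suc k) * iC D k * iE D k)
        J₁ = I₁ q (b D) (c D) (g D) (d D) y
        J₂ = I₂ q (b D) (c D) (g D) (d D) y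
        J₃ = I₃ q (b D) (c D) (g D) (d D) y
        J₄ = I₄ q (b D) (c D) (g D) (d D) y
        hu : (1# - d D * y) * id D k ≈ 1#
        hu = id-inv V k (1≤2m k≤m)
        hv : (1# - d D * (q * y)) * id D (suc k) ≈ 1#
        hv = id-inv V (suc k) (s≤s (≡.subst (suc k ℕ.≤_) (≡.sym (ℕₚ.+-suc m m)) (s≤s (ℕₚ.≤-trans k≤m (ℕₚ.m≤m+n m m)))))
        hs : (1# - C D * (y * y)) * iC D k ≈ 1#
        hs = iC-inv V k (s≤s k≤m)
        ht : (1# - E D * (y * y)) * iE D k ≈ 1#
        ht = iE-inv V k (s≤s k≤m)
        Γ-term : Γ * D.term k ≈ scaled k J₁
        Γ-term = begin
          Γ * D.term k
            ≈⟨ solve 1 (λ x → x := x :* (:1 :* :1 :* :1 :* :1)) (Γ * D.term k) ⟩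
          Γ * D.term k * (1# * 1# * 1# * 1#)
            ≈⟨ *-congˡ (*-cong (*-cong (*-cong hu hv) hs) ht) ⟨
          Γ * D.term k * ((1# - d D * y) * id D k * ((1# - d D * (q * y)) * id D (suc k))
            * ((1# - C D * (y * y)) * iC D k) * ((1# - E D * (y * y)) * iE D k))
            ≈⟨ solve 11 (λ γ w t fu u fv v fs s ft r →
                 γ :* (w :* t) :* (fu :* u :* (fv :* v) :* (fs :* s) :* (ft :* r))
                 := w :* (u :* v :* s :* r) :* (γ :* t :* (fu :* fv :* fs :* ft)))
                 Γ (D.weight k) ((1# - A D * (y * y * y)) * y)
                 (1# - d D * y) (id D k) (1# - d D * (q * y)) (id D (suc k))
                 (1# - C D * (y * y)) (iC D k) (1# - E D * (y * y)) (iE D k) ⟩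
          scaled k J₁ ∎
        Λ-term : Λ * D′.term k ≈ scaled k J₂
        Λ-term = begin
          Λ * D′.term k
            ≈⟨ *-assoc _ _ _ ⟨
          Λ * D′.weight k * ((1# - A (shift D) * (y * y * y)) * y)
            ≈⟨ *-congʳ (Λ-weight k) ⟩
          D.weight k * boundary k * ((d D * q - c D) * (d D - g D)) * ((1# - A (shift D) * (y * y * y)) * y)
            ≈⟨ solve 9 (λ w α β γ δ i e f t →
                 w :* (α :* β :* γ :* δ :* i) :* (e :* f) :* t := w :* i :* (α :* β :* γ :* δ :* e :* f :* t))
                 (D.weight k) (1# - A D * (y * y)) (1# - d D * (y * y)) (1# - b D * y) (1# - b D * (q * y))
                 (id D k * id D (suc k) * iC D k * iE D k) (d D * q - c D) (d D - g D)
                 ((1# - A (shift D) * (y * y * y)) * y) ⟩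
          scaled k J₂ ∎
        H-term : H k ≈ scaled k J₄
        H-term = begin
          H k
            ≈⟨ solve 1 (λ x → x := x :* (:1 :* :1 :* :1)) (H k) ⟩
          H k * (1# * 1# * 1#)
            ≈⟨ *-congˡ (*-cong (*-cong hv hs) ht) ⟨
          H k * ((1# - d D * (q * y)) * id D (suc k) * ((1# - C D * (y * y)) * iC D k) * ((1# - E D * (y * y)) * iE D k))
            ≈⟨ solve 9 (λ w h u fv v fs s ft r →
                 w :* (h :* u) :* (fv :* v :* (fs :* s) :* (ft :* r)) := w :* (u :* v :* s :* r) :* (h :* (fv :* fs :* ft)))
                 (D.weight k) ((1# - c D * g D * (y * y)) * (d D - A D * y) * (1# - y) * (1# - b D * d D * (y * y)))
                 (id D k) (1# - d D * (q * y)) (id D (suc k))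
                 (1# - C D * (y * y)) (iC D k) (1# - E D * (y * y)) (iE D k) ⟩
          scaled k J₄ ∎
        -- By dd′ = qA, the factor d - Aqy of H (k + 1) is d (1 - d′y), which cancels the inverse
        -- `id′` and eliminates d′.
        d-factor : (1# - d′ D * (y * y)) * ((d D - A D * (q * y)) * id′ D k) ≈ d D - q * A D * (y * y)
        d-factor = begin
          (1# - d′ D * (y * y)) * ((d D - A D * (q * y)) * id′ D k)
            ≈⟨ *-congˡ (*-congʳ (solve 4 (λ d A q y → d :- A :* (q :* y) := d :- q :* A :* y) (d D) (A D) q y)) ⟩
          (1# - d′ D * (y * y)) * ((d D - q * A D * y) * id′ D k)
            ≈⟨ *-congˡ (*-congʳ (+-congˡ (-‿cong (*-congʳ (dd′ V))))) ⟨
          (1# - d′ D * (y * y)) * ((d D - d D * d′ D * y) * id′ D k)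
            ≈⟨ solve 4 (λ d d′ y i → (:1 :- d′ :* (y :* y)) :* ((d :- d :* d′ :* y) :* i)
                 := (d :- d :* d′ :* (y :* y)) :* ((:1 :- d′ :* y) :* i)) (d D) (d′ D) y (id′ D k) ⟩
          (d D - d D * d′ D * (y * y)) * ((1# - d′ D * y) * id′ D k)
            ≈⟨ *-cong (+-congˡ (-‿cong (*-congʳ (dd′ V)))) (id′-inv V k (s≤s k≤m)) ⟩
          (d D - q * A D * (y * y)) * 1#
            ≈⟨ *-identityʳ _ ⟩
          d D - q * A D * (y * y) ∎
        B-factor : (1# - c D * g D * ((q * y) * (q * y))) * iB D k ≈ 1#
        B-factor = trans (*-congʳ (solve 4 (λ q c g y →
            :1 :- c :* g :* ((q :* y) :* (q :* y)) := :1 :- q :* q :* (c :* g) :* (y :* y)) q (c D) (g D) y))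
          (iB-inv V k (s≤s k≤m))
        H-suc : H (suc k) ≈ scaled k J₃
        H-suc = begin
          D.weight k * D.ratio k * ((1# - c D * g D * ((q * y) * (q * y))) * (d D - A D * (q * y)) * (1# - q * y)
            * (1# - b D * d D * ((q * y) * (q * y))) * id D (suc k))
            ≈⟨ solve 18 (λ w α δ δ′ β γ ε p u i r s t B d₁ q₁ b₁ v →
                 w :* (α :* δ :* δ′ :* β :* γ :* ε :* (p :* u :* i :* r :* s :* t)) :* (B :* d₁ :* q₁ :* b₁ :* v)
                 := w :* (u :* v :* s :* t) :* (α :* δ :* (δ′ :* (d₁ :* i)) :* β :* γ :* ε :* b₁) :* ((B :* r) :* (q₁ :* p)))
                 (D.weight k) (1# - A D * (y * y)) (1# - d D * (y * y)) (1# - d′ D * (y * y)) (1# - b D * y)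
                 (1# - c D * y) (1# - e D * y) (iq D k) (id D k) (id′ D k) (iB D k) (iC D k) (iE D k)
                 (1# - c D * g D * ((q * y) * (q * y))) (d D - A D * (q * y)) (1# - q * y)
                 (1# - b D * d D * ((q * y) * (q * y))) (id D (suc k)) ⟩
          scaled k ((1# - A D * (y * y)) * (1# - d D * (y * y)) * ((1# - d′ D * (y * y)) * ((d D - A D * (q * y)) * id′ D k))
            * (1# - b D * y) * (1# - c D * y) * (1# - e D * y) * (1# - b D * d D * ((q * y) * (q * y))))
            * ((1# - c D * g D * ((q * y) * (q * y))) * iB D k * ((1# - q * y) * iq D k))
            ≈⟨ *-cong (*-congˡ (*-congʳ (*-congʳ (*-congʳ (*-congʳ (*-congˡ d-factor))))))
                 (*-cong B-factor (iq-inv V k (s≤s k≤m))) ⟩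
          scaled k J₃ * (1# * 1#)
            ≈⟨ solve 1 (λ x → x :* (:1 :* :1) := x) (scaled k J₃) ⟩
          scaled k J₃ ∎

      partial-sums : ∀ k → k ℕ.≤ suc m → Γ * ∑ k D.term + Λ * ∑ k D′.term ≈ H k
      partial-sums zero _ = solve 8 (λ γ l b c d g A i → γ :* :0 :+ l :* :0 :=
          :1 :* ((:1 :- c :* g :* (:1 :* :1)) :* (d :- A :* :1) :* (:1 :- :1) :* (:1 :- b :* d :* (:1 :* :1)) :* i))
        Γ Λ (b D) (c D) (d D) (g D) (A D) (id D 0)
      partial-sums (suc k) (s≤s k≤m) = begin
        Γ * (∑ k D.term + D.term k) + Λ * (∑ k D′.term + D′.term k)
          ≈⟨ solve 6 (λ γ l s t s′ t′ → γ :* (s :+ t) :+ l :* (s′ :+ t′) := γ :* t :+ l :* t′ :+ (γ :* s :+ l :* s′))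
               Γ Λ (∑ k D.term) (D.term k) (∑ k D′.term) (D′.term k) ⟩
        Γ * D.term k + Λ * D′.term k + (Γ * ∑ k D.term + Λ * ∑ k D′.term)
          ≈⟨ +-congˡ (partial-sums k (ℕₚ.m≤n⇒m≤1+n k≤m)) ⟩
        Γ * D.term k + Λ * D′.term k + H k
          ≈⟨ step k k≤m ⟩
        H (suc k) ∎

      -- The hypothesis covers both ways of terminating, A = q⁻²⁽ᵐ⁺¹⁾ and d = q⁻²⁽ᵐ⁺¹⁾; either one
      -- kills the boundary value together with the extra last term.
      contiguous : let y = q ^ suc m in
                   (1# - A D * (y * y)) * (1# - d D * (y * y)) ≈ 0# →
                   Γ * ∑ (suc (suc m)) D.term + Λ * ∑ (suc m) D′.term ≈ 0#
      contiguous vanish = begin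
        Γ * (∑ (suc m) D.term + D.term (suc m)) + Λ * ∑ (suc m) D′.term
          ≈⟨ solve 5 (λ γ l s t s′ → γ :* (s :+ t) :+ l :* s′ := (γ :* s :+ l :* s′) :+ γ :* t)
               Γ Λ (∑ (suc m) D.term) (D.term (suc m)) (∑ (suc m) D′.term) ⟩
        Γ * ∑ (suc m) D.term + Λ * ∑ (suc m) D′.term + Γ * D.term (suc m)
          ≈⟨ +-congʳ (partial-sums (suc m) ℕₚ.≤-refl) ⟩
        H (suc m) + Γ * D.term (suc m)
          ≈⟨ +-congˡ (trans (sym (*-identityʳ _)) (*-congˡ (sym (id-inv V (suc m) (s≤s (ℕₚ.m≤n+m (suc m) m)))))) ⟩
        H (suc m) + Γ * D.term (suc m) * ((1# - d D * y) * id D (suc m))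
          ≈⟨ solve 6 (λ w h i γ t f → w :* (h :* i) :+ γ :* (w :* t) :* (f :* i) := w :* i :* (γ :* t :* f :+ h))
               (D.weight (suc m)) ((1# - c D * g D * (y * y)) * (d D - A D * y) * (1# - y) * (1# - b D * d D * (y * y)))
               (id D (suc m)) Γ ((1# - A D * (y * y * y)) * y) (1# - d D * y) ⟩
        D.weight (suc m) * id D (suc m) * (Γ * ((1# - A D * (y * y * y)) * y) * (1# - d D * y)
          + (1# - c D * g D * (y * y)) * (d D - A D * y) * (1# - y) * (1# - b D * d D * (y * y)))
          ≈⟨ *-congˡ (trans (last-identity (b D) (c D) (g D) (d D) y) (trans (*-congʳ vanish) (zeroˡ _))) ⟩
        D.weight (suc m) * id D (suc m) * 0#
          ≈⟨ zeroʳ _ ⟩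
        0# ∎
        where
        y : Carrier
        y = q ^ suc m

  open Telescope using (contiguous; Γ; Λ)

  -- The case A = q⁻²ᵐ: all boundary terms vanish, down to the final factor 1 - A = 0.
  sum-zero : ∀ m D → Valid D m → A D * (q ^ m * q ^ m) ≈ 1# →
    (∀ i → i ℕ.< m → ∀ z → (1# - b D * (q ^ i * q ^ i)) * (d D * (q ^ i * q ^ i) - c D * g D) * z ≈ 0# → z ≈ 0#) →
    ∑ (suc m) (term D) ≈ 0#
  sum-zero zero D V A≈1 cancel = begin
    0# + 1# * ((1# - A D * (1# * 1# * 1#)) * 1#)
      ≈⟨ solve 1 (λ A → :0 :+ :1 :* ((:1 :- A :* (:1 :* :1 :* :1)) :* :1) := :1 :- A :* (:1 :* :1)) (A D) ⟩
    1# - A D * (1# * 1#)  ≈⟨ +-congˡ (-‿cong A≈1) ⟩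
    1# - 1#               ≈⟨ -‿inverseʳ 1# ⟩
    0#                    ∎
  sum-zero (suc m) D V A≈1 cancel = cancel 0 (s≤s z≤n) _ (begin
    (1# - b D * (1# * 1#)) * (d D * (1# * 1#) - c D * g D) * ∑ (suc (suc m)) (term D)
      ≈⟨ solve 5 (λ b d c g s → (:1 :- b :* (:1 :* :1)) :* (d :* (:1 :* :1) :- c :* g) :* s
           := (:1 :- b) :* (d :- c :* g) :* s :+ :0) (b D) (d D) (c D) (g D) (∑ (suc (suc m)) (term D)) ⟩
    Γ D * ∑ (suc (suc m)) (term D) + 0#
      ≈⟨ +-congˡ (trans (*-congˡ IH) (zeroʳ _)) ⟨
    Γ D * ∑ (suc (suc m)) (term D) + Λ D * ∑ (suc m) (term (shift D))
      ≈⟨ contiguous D V (trans (*-congʳ (trans (+-congˡ (-‿cong A≈1)) (-‿inverseʳ 1#))) (zeroˡ _)) ⟩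
    0# ∎)
    where
    IH : ∑ (suc m) (term (shift D)) ≈ 0#
    IH = sum-zero m (shift D) (shift-valid V)
      (trans (solve 5 (λ q b c g x → b :* (q :* q) :* c :* g :* (x :* x) := b :* c :* g :* ((q :* x) :* (q :* x)))
                q (b D) (c D) (g D) (q ^ m)) A≈1)
      λ i i<m z h → cancel (suc i) (s≤s i<m) z (trans (*-congʳ (solve 6 (λ q b d c g x →
          (:1 :- b :* ((q :* x) :* (q :* x))) :* (d :* ((q :* x) :* (q :* x)) :- c :* g)
          := (:1 :- b :* (q :* q) :* (x :* x)) :* (d :* (q :* q) :* (x :* x) :- c :* g))
        q (b D) (d D) (c D) (g D) (q ^ i))) h)

  ⟨_⟩_ : Carrier → ℕ → Carrier
  ⟨ y ⟩ m = ∏ m λ j → 1# - y * (q ^ j * q ^ j)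

  ⟨⟩-head : ∀ y k → ⟨ y ⟩ suc k ≈ (1# - y * (1# * 1#)) * ⟨ y * (q * q) ⟩ k
  ⟨⟩-head y k = trans (∏-head k _) (*-congˡ (∏-cong k λ j _ → sym (factor₂ y (q ^ j))))

  ⟨⟩-cong : ∀ {y z} k → y ≈ z → ⟨ y ⟩ k ≈ ⟨ z ⟩ k
  ⟨⟩-cong k e = ∏-cong k λ j _ → +-congˡ (-‿cong (*-congʳ e))

  -- The terminating case d = q⁻²ᵐ of Rahman's summation. Each use of `contiguous` passes to a sum
  -- with one term less, whose d is again of this form, and contributes one factor to each product;
  -- the last sum is the single term 1 - A.
  sum-product : ∀ m D → Valid D m → d D * (q ^ m * q ^ m) ≈ 1# →
    (∀ i → i ℕ.< m → ∀ z → (1# - b D * (q ^ i * q ^ i)) * z ≈ 0# → z ≈ 0#) →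
    ∑ (suc m) (term D) * (⟨ q ⟩ m * ⟨ B D ⟩ m * ⟨ C D ⟩ m * ⟨ E D ⟩ m)
      ≈ ⟨ A D ⟩ suc m * (⟨ b D * q ⟩ m * ⟨ c D * q ⟩ m * ⟨ e D * q ⟩ m)
  sum-product zero D V d≈1 cancel =
    solve 1 (λ A → (:0 :+ :1 :* ((:1 :- A :* (:1 :* :1 :* :1)) :* :1)) :* (:1 :* :1 :* :1 :* :1)
      := :1 :* (:1 :- A :* (:1 :* :1)) :* (:1 :* :1 :* :1)) (A D)
  sum-product (suc m) D V d≈1 cancel = begin
    S * (⟨ q ⟩ m * (1# - w) * (⟨ B D ⟩ m * (1# - B D * (x * x))) * ⟨ C D ⟩ suc m * ⟨ E D ⟩ suc m)
      ≈⟨ *-congˡ (*-cong (*-congˡ C-split) E-split) ⟩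
    S * (⟨ q ⟩ m * (1# - w) * (⟨ B D ⟩ m * (1# - B D * (x * x))) * (c₀ * ⟨ C D′ ⟩ m) * (e₀ * ⟨ E D′ ⟩ m))
      ≈⟨ solve 9 (λ s q₁ w₁ b₁ b₂ c₀ c₁ e₀ e₁ → s :* (q₁ :* w₁ :* (b₁ :* b₂) :* (c₀ :* c₁) :* (e₀ :* e₁))
           := w₁ :* b₂ :* c₀ :* e₀ :* s :* (q₁ :* b₁ :* c₁ :* e₁))
           S (⟨ q ⟩ m) (1# - w) (⟨ B D ⟩ m) (1# - B D * (x * x)) c₀ (⟨ C D′ ⟩ m) e₀ (⟨ E D′ ⟩ m) ⟩
    (1# - w) * (1# - B D * (x * x)) * c₀ * e₀ * S * (⟨ q ⟩ m * ⟨ B D ⟩ m * ⟨ C D′ ⟩ m * ⟨ E D′ ⟩ m)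
      ≈⟨ *-congʳ one-step ⟩
    (1# - A D * (1# * 1#)) * (1# - b D * q * (1# * 1#)) * (1# - c D * q * (x * x)) * (1# - e D * q * (x * x)) * S′
      * (⟨ q ⟩ m * ⟨ B D ⟩ m * ⟨ C D′ ⟩ m * ⟨ E D′ ⟩ m)
      ≈⟨ *-assoc _ _ _ ⟩
    (1# - A D * (1# * 1#)) * (1# - b D * q * (1# * 1#)) * (1# - c D * q * (x * x)) * (1# - e D * q * (x * x))
      * (S′ * (⟨ q ⟩ m * ⟨ B D ⟩ m * ⟨ C D′ ⟩ m * ⟨ E D′ ⟩ m))
      ≈⟨ *-congˡ IH ⟩
    (1# - A D * (1# * 1#)) * (1# - b D * q * (1# * 1#)) * (1# - c D * q * (x * x)) * (1# - e D * q * (x * x))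
      * (⟨ A D′ ⟩ suc m * (⟨ b D′ * q ⟩ m * ⟨ c D * q ⟩ m * ⟨ e D * q ⟩ m))
      ≈⟨ solve 8 (λ a b c e a₁ b₁ c₁ e₁ → a :* b :* c :* e :* (a₁ :* (b₁ :* c₁ :* e₁))
           := a :* a₁ :* ((b :* b₁) :* (c₁ :* c) :* (e₁ :* e)))
           (1# - A D * (1# * 1#)) (1# - b D * q * (1# * 1#)) (1# - c D * q * (x * x)) (1# - e D * q * (x * x))
           (⟨ A D′ ⟩ suc m) (⟨ b D′ * q ⟩ m) (⟨ c D * q ⟩ m) (⟨ e D * q ⟩ m) ⟩
    (1# - A D * (1# * 1#)) * ⟨ A D′ ⟩ suc m
      * ((1# - b D * q * (1# * 1#)) * ⟨ b D′ * q ⟩ m * (⟨ c D * q ⟩ suc m) * (⟨ e D * q ⟩ suc m))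
      ≈⟨ *-cong A-split (*-congʳ (*-congʳ b-split)) ⟨
    ⟨ A D ⟩ suc (suc m) * (⟨ b D * q ⟩ suc m * ⟨ c D * q ⟩ suc m * ⟨ e D * q ⟩ suc m) ∎
    where
    D′ : System
    D′ = shift D
    S S′ x y w c₀ e₀ K : Carrier
    S = ∑ (suc (suc m)) (term D)
    S′ = ∑ (suc m) (term D′)
    x = q ^ m
    y = q * x
    w = q * (x * x)
    c₀ = 1# - C D * (1# * 1#)
    e₀ = 1# - E D * (1# * 1#)
    K = (1# - A D) * (1# - b D * q)
    IH : S′ * (⟨ q ⟩ m * ⟨ B D ⟩ m * ⟨ C D′ ⟩ m * ⟨ E D′ ⟩ m)
           ≈ ⟨ A D′ ⟩ suc m * (⟨ b D′ * q ⟩ m * ⟨ c D * q ⟩ m * ⟨ e D * q ⟩ m)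
    IH = sum-product m D′ (shift-valid V)
      (trans (solve 3 (λ q d x → d :* (q :* q) :* (x :* x) := d :* ((q :* x) :* (q :* x))) q (d D) x) d≈1)
      λ i i<m z h → cancel (suc i) (s≤s i<m) z (trans (*-congʳ (sym (factor₂ (b D) (q ^ i)))) h)
    C-split : ⟨ C D ⟩ suc m ≈ c₀ * ⟨ C D′ ⟩ m
    C-split = trans (⟨⟩-head (C D) m) (*-congˡ (⟨⟩-cong m (solve 3 (λ q b g →
      q :* q :* (b :* g) :* (q :* q) := q :* q :* (b :* (q :* q) :* g)) q (b D) (g D))))
    E-split : ⟨ E D ⟩ suc m ≈ e₀ * ⟨ E D′ ⟩ m
    E-split = trans (⟨⟩-head (E D) m) (*-congˡ (⟨⟩-cong m (solve 3 (λ q b c →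
      q :* (b :* c) :* (q :* q) := q :* (b :* (q :* q) :* c)) q (b D) (c D))))
    A-split : ⟨ A D ⟩ suc (suc m) ≈ (1# - A D * (1# * 1#)) * ⟨ A D′ ⟩ suc m
    A-split = trans (⟨⟩-head (A D) (suc m)) (*-congˡ (⟨⟩-cong (suc m) (solve 4 (λ q b c g →
      b :* c :* g :* (q :* q) := b :* (q :* q) :* c :* g) q (b D) (c D) (g D))))
    b-split : ⟨ b D * q ⟩ suc m ≈ (1# - b D * q * (1# * 1#)) * ⟨ b D′ * q ⟩ m
    b-split = trans (⟨⟩-head (b D * q) m) (*-congˡ (⟨⟩-cong m (solve 2 (λ q b →
      b :* q :* (q :* q) := b :* (q :* q) :* q) q (b D))))
    relation : (d D - c D * g D) * S ≈ - (K * (d D * q - c D) * (d D - g D) * (id D 1 * iC D 0 * iE D 0) * S′)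
    relation = GroupProperties.x∙y⁻¹≈ε⇒x≈y +-group _ _ (cancel 0 (s≤s z≤n) _ (begin
      (1# - b D * (1# * 1#)) * ((d D - c D * g D) * S - - (K * (d D * q - c D) * (d D - g D) * (id D 1 * iC D 0 * iE D 0) * S′))
        ≈⟨ solve 12 (λ b A q d c g i s t S S′ z →
             (:1 :- b :* (:1 :* :1)) :* ((d :- c :* g) :* S :- :- ((:1 :- A) :* (:1 :- b :* q) :* (d :* q :- c) :* (d :- g) :* (i :* s :* t) :* S′))
             := (:1 :- b) :* (d :- c :* g) :* S :+ (:1 :- A) :* (:1 :- b) :* (:1 :- b :* q) :* (d :* q :- c) :* (d :- g) :* (i :* s :* t) :* S′)
             (b D) (A D) q (d D) (c D) (g D) (id D 1) (iC D 0) (iE D 0) S S′ 0# ⟩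
      Γ D * S + Λ D * S′
        ≈⟨ contiguous D V (trans (*-congˡ (trans (+-congˡ (-‿cong d≈1)) (-‿inverseʳ 1#))) (zeroʳ _)) ⟩
      0# ∎))
    -- Since dy² = 1 and y² = qw, the element inverted by `id D 1` is 1 - dq, that is 1 - 1/w.
    inverse-w : (1# - w) * id D 1 ≈ - w
    inverse-w = begin
      (1# - w) * id D 1                             ≈⟨ *-congʳ (+-congʳ d≈1) ⟨
      (d D * (y * y) - w) * id D 1
        ≈⟨ solve 4 (λ q d x i → (d :* ((q :* x) :* (q :* x)) :- q :* (x :* x)) :* i
             := :- (q :* (x :* x)) :* ((:1 :- d :* (q :* :1)) :* i)) q (d D) x (id D 1) ⟩
      - w * ((1# - d D * (q * 1#)) * id D 1)        ≈⟨ *-congˡ (id-inv V 1 (s≤s (ℕₚ.≤-trans (s≤s z≤n) (ℕₚ.m≤n+m (suc m) m)))) ⟩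
      - w * 1#                                      ≈⟨ *-identityʳ _ ⟩
      - w                                           ∎
    one-step : (1# - w) * (1# - B D * (x * x)) * c₀ * e₀ * S
      ≈ (1# - A D * (1# * 1#)) * (1# - b D * q * (1# * 1#)) * (1# - c D * q * (x * x)) * (1# - e D * q * (x * x)) * S′
    one-step = begin
      (1# - w) * (1# - B D * (x * x)) * c₀ * e₀ * S
        -- Replacing 1 by dy² makes 1 - Bx² equal to y²(d - cg), the coefficient in `relation`. The
        -- same replacement, backwards, later turns w(dq - c) and y²(d - g) into 1 - cqx² and 1 -
        -- eqx².
        ≈⟨ *-congʳ (*-congʳ (*-congʳ (*-congˡ (+-congʳ d≈1)))) ⟨
      (1# - w) * (d D * (y * y) - B D * (x * x)) * c₀ * e₀ * S
        ≈⟨ solve 9 (λ w q x d c g c₀ e₀ s →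
             w :* (d :* ((q :* x) :* (q :* x)) :- q :* q :* (c :* g) :* (x :* x)) :* c₀ :* e₀ :* s
             := (q :* x) :* (q :* x) :* w :* c₀ :* e₀ :* ((d :- c :* g) :* s))
             (1# - w) q x (d D) (c D) (g D) c₀ e₀ S ⟩
      y * y * (1# - w) * c₀ * e₀ * ((d D - c D * g D) * S)
        ≈⟨ *-congˡ relation ⟩
      y * y * (1# - w) * c₀ * e₀ * - (K * (d D * q - c D) * (d D - g D) * (id D 1 * iC D 0 * iE D 0) * S′)
        ≈⟨ solve 11 (λ y w c₀ e₀ k u v i s t S → y :* y :* w :* c₀ :* e₀ :* :- (k :* u :* v :* (i :* s :* t) :* S)
             := :- (y :* y :* k :* u :* v :* S) :* ((w :* i) :* (c₀ :* s) :* (e₀ :* t)))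
             y (1# - w) c₀ e₀ K (d D * q - c D) (d D - g D) (id D 1) (iC D 0) (iE D 0) S′ ⟩
      - (y * y * K * (d D * q - c D) * (d D - g D) * S′) * ((1# - w) * id D 1 * (c₀ * iC D 0) * (e₀ * iE D 0))
        ≈⟨ *-congˡ (*-cong (*-cong inverse-w (iC-inv V 0 (s≤s z≤n))) (iE-inv V 0 (s≤s z≤n))) ⟩
      - (y * y * K * (d D * q - c D) * (d D - g D) * S′) * (- w * 1# * 1#)
        ≈⟨ solve 7 (λ q x d c g k S →
             :- ((q :* x) :* (q :* x) :* k :* (d :* q :- c) :* (d :- g) :* S) :* (:- (q :* (x :* x)) :* :1 :* :1)
             := k :* (d :* ((q :* x) :* (q :* x)) :- c :* q :* (x :* x)) :* (d :* ((q :* x) :* (q :* x)) :- q :* g :* q :* (x :* x)) :* S)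
             q x (d D) (c D) (g D) K S′ ⟩
      K * (d D * (y * y) - c D * q * (x * x)) * (d D * (y * y) - e D * q * (x * x)) * S′
        ≈⟨ *-congʳ (*-cong (*-congˡ (+-congʳ d≈1)) (+-congʳ d≈1)) ⟩
      K * (1# - c D * q * (x * x)) * (1# - e D * q * (x * x)) * S′
        ≈⟨ *-congʳ (*-congʳ (*-congʳ (solve 3 (λ A b q → (:1 :- A) :* (:1 :- b :* q)
             := (:1 :- A :* (:1 :* :1)) :* (:1 :- b :* q :* (:1 :* :1))) (A D) (b D) q))) ⟩
      _ ∎

-- Central Gaussian binomial coefficients

module GaussianBinomials {c ℓ} (R : CommutativeRing c ℓ) (q : CommutativeRing.Carrier R) where
  open CommutativeRing R hiding (zero)
  open Exp semiring using (_^_; ^-homo-*)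
  open Solver R
  open BigOperators R
  open SetoidReasoning setoid

  ⟨q⟩ : ℕ → Carrier
  ⟨q⟩ k = ∏ k λ j → 1# - q * q ^ j

  -- gauss i j is the Gaussian binomial coefficient (i + j choose i).
  gauss : ℕ → ℕ → Carrier
  gauss zero    j       = 1#
  gauss (suc i) zero    = 1#
  gauss (suc i) (suc j) = gauss i (suc j) + q ^ suc i * gauss (suc i) j

  gauss-product : ∀ i j → ⟨q⟩ i * ⟨q⟩ j * gauss i j ≈ ⟨q⟩ (i ℕ.+ j)
  gauss-product zero    j    = solve 1 (λ x → :1 :* x :* :1 := x) (⟨q⟩ j)
  gauss-product (suc i) zero = trans (solve 1 (λ x → x :* :1 :* :1 := x) (⟨q⟩ (suc i)))
    (reflexive (≡.cong ⟨q⟩ (≡.sym (ℕₚ.+-identityʳ (suc i)))))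
  gauss-product (suc i) (suc j) = begin
    ⟨q⟩ i * (1# - q * x) * (⟨q⟩ j * (1# - q * y)) * (gauss i (suc j) + q * x * gauss (suc i) j)
      ≈⟨ solve 7 (λ p q x r y g h → p :* (:1 :- q :* x) :* (r :* (:1 :- q :* y)) :* (g :+ q :* x :* h)
           := (:1 :- q :* x) :* (p :* (r :* (:1 :- q :* y)) :* g) :+ q :* x :* (:1 :- q :* y) :* (p :* (:1 :- q :* x) :* r :* h))
           (⟨q⟩ i) q x (⟨q⟩ j) y (gauss i (suc j)) (gauss (suc i) j) ⟩
    (1# - q * x) * (⟨q⟩ i * ⟨q⟩ (suc j) * gauss i (suc j))
      + q * x * (1# - q * y) * (⟨q⟩ (suc i) * ⟨q⟩ j * gauss (suc i) j)
      ≈⟨ +-cong (*-congˡ (trans (gauss-product i (suc j)) (reflexive (≡.cong ⟨q⟩ (ℕₚ.+-suc i j)))))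
           (*-congˡ (gauss-product (suc i) j)) ⟩
    (1# - q * x) * ⟨q⟩ (suc (i ℕ.+ j)) + q * x * (1# - q * y) * ⟨q⟩ (suc (i ℕ.+ j))
      ≈⟨ solve 4 (λ q x y p → (:1 :- q :* x) :* p :+ q :* x :* (:1 :- q :* y) :* p := p :* (:1 :- q :* (q :* (x :* y))))
           q x y (⟨q⟩ (suc (i ℕ.+ j))) ⟩
    ⟨q⟩ (suc (i ℕ.+ j)) * (1# - q * (q * (x * y)))
      ≈⟨ *-congˡ (+-congˡ (-‿cong (*-congˡ (*-congˡ (^-homo-* q i j))))) ⟨
    ⟨q⟩ (suc (suc (i ℕ.+ j)))
      ≡⟨ ≡.cong (λ k → ⟨q⟩ (suc k)) (ℕₚ.+-suc i j) ⟨
    ⟨q⟩ (suc i ℕ.+ suc j) ∎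
    where
    x y : Carrier
    x = q ^ i
    y = q ^ j

  central : ℕ → Carrier
  central k = gauss k k

  module _ (cancel : ∀ j {x y} → (1# - q * q ^ j) * x ≈ (1# - q * q ^ j) * y → x ≈ y) where

    ⟨q⟩-cancel : ∀ k {x y} → ⟨q⟩ k * x ≈ ⟨q⟩ k * y → x ≈ y
    ⟨q⟩-cancel zero    e = trans (sym (*-identityˡ _)) (trans e (*-identityˡ _))
    ⟨q⟩-cancel (suc k) e = cancel k (⟨q⟩-cancel k (trans (sym (*-assoc _ _ _)) (trans e (*-assoc _ _ _))))

    -- Both sides agree after multiplication by (q;q)ₖ (q;q)ₖ₊₁. The cancellation is available for
    -- polynomials but not modulo a divisor of [n], so the recurrence is proved there and then
    -- carried to the localisations.
    central-suc : ∀ k → (1# - q * q ^ k) * central (suc k)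
                        ≈ (1# - q * (q ^ k * q ^ k)) * (1# + q * q ^ k) * central k
    central-suc k = cancel k (⟨q⟩-cancel k (⟨q⟩-cancel k (begin
      ⟨q⟩ k * (⟨q⟩ k * ((1# - q * x) * ((1# - q * x) * central (suc k))))
        ≈⟨ solve 3 (λ p f g → p :* (p :* (f :* (f :* g))) := p :* f :* (p :* f) :* g) (⟨q⟩ k) (1# - q * x) (central (suc k)) ⟩
      ⟨q⟩ (suc k) * ⟨q⟩ (suc k) * central (suc k)
        ≈⟨ gauss-product (suc k) (suc k) ⟩
      ⟨q⟩ (suc k ℕ.+ suc k)
        ≡⟨ ≡.cong (λ i → ⟨q⟩ (suc i)) (ℕₚ.+-suc k k) ⟩
      ⟨q⟩ (k ℕ.+ k) * (1# - q * q ^ (k ℕ.+ k)) * (1# - q * (q * q ^ (k ℕ.+ k)))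
        ≈⟨ *-cong (*-cong (sym (gauss-product k k)) (+-congˡ (-‿cong (*-congˡ (^-homo-* q k k)))))
             (+-congˡ (-‿cong (*-congˡ (*-congˡ (^-homo-* q k k))))) ⟩
      ⟨q⟩ k * ⟨q⟩ k * central k * (1# - q * (x * x)) * (1# - q * (q * (x * x)))
        ≈⟨ solve 4 (λ p g q x → p :* p :* g :* (:1 :- q :* (x :* x)) :* (:1 :- q :* (q :* (x :* x)))
             := p :* (p :* ((:1 :- q :* x) :* ((:1 :- q :* (x :* x)) :* (:1 :+ q :* x) :* g))))
             (⟨q⟩ k) (central k) q x ⟩
      ⟨q⟩ k * (⟨q⟩ k * ((1# - q * x) * ((1# - q * (x * x)) * (1# + q * x) * central k))) ∎)))
      where
      x : Carrier
      x = q ^ k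

    -- The identity (q;q²)ₖ (-q;q)ₖ = central k · (q;q)ₖ exchanges the denominator (q;q)ₖ for
    -- (-q;q)ₖ, which stays regular at roots of unity of odd order.
    central-ratio : ∀ k → ∏ k (λ j → 1# - q * (q ^ j * q ^ j)) * ∏ k (λ j → 1# + q * q ^ j) ≈ central k * ⟨q⟩ k
    central-ratio zero    = refl
    central-ratio (suc k) = begin
      ∏ k _ * (1# - q * (x * x)) * (∏ k _ * (1# + q * x))
        ≈⟨ solve 4 (λ a b c d → a :* b :* (c :* d) := b :* d :* (a :* c)) _ _ _ _ ⟩
      (1# - q * (x * x)) * (1# + q * x) * (∏ k _ * ∏ k _)
        ≈⟨ *-congˡ (central-ratio k) ⟩
      (1# - q * (x * x)) * (1# + q * x) * (central k * ⟨q⟩ k)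
        ≈⟨ *-assoc _ (central k) (⟨q⟩ k) ⟨
      (1# - q * (x * x)) * (1# + q * x) * central k * ⟨q⟩ k
        ≈⟨ *-congʳ (central-suc k) ⟨
      (1# - q * x) * central (suc k) * ⟨q⟩ k
        ≈⟨ solve 3 (λ f g p → f :* g :* p := g :* (p :* f)) (1# - q * x) (central (suc k)) (⟨q⟩ k) ⟩
      central (suc k) * ⟨q⟩ (suc k) ∎
      where
      x : Carrier
      x = q ^ k

-- Identities between cross-multiplied fractions n/d = u/v and m/e = s/t.
module CrossMultiplication {c ℓ} (R : CommutativeRing c ℓ) where
  open CommutativeRing R
  open Solver R
  open SetoidReasoning setoid

  module _ {n d u v m e s t : Carrier} (h : n * v ≈ u * d) (k : m * t ≈ s * e) where

    cross-+ : (n * e + m * d) * (v * t) ≈ (u * t + s * v) * (d * e)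
    cross-+ = begin
      (n * e + m * d) * (v * t)
        ≈⟨ solve 6 (λ n d v m e t → (n :* e :+ m :* d) :* (v :* t) := n :* v :* (e :* t) :+ m :* t :* (d :* v)) n d v m e t ⟩
      n * v * (e * t) + m * t * (d * v)
        ≈⟨ +-cong (*-congʳ h) (*-congʳ k) ⟩
      u * d * (e * t) + s * e * (d * v)
        ≈⟨ solve 6 (λ u d e t s v → u :* d :* (e :* t) :+ s :* e :* (d :* v) := (u :* t :+ s :* v) :* (d :* e)) u d e t s v ⟩
      (u * t + s * v) * (d * e) ∎

    cross-* : n * m * (v * t) ≈ u * s * (d * e)
    cross-* = begin
      n * m * (v * t)      ≈⟨ solve 4 (λ n m v t → n :* m :* (v :* t) := n :* v :* (m :* t)) n m v t ⟩
      n * v * (m * t)      ≈⟨ *-cong h k ⟩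
      u * d * (s * e)      ≈⟨ solve 4 (λ u d s e → u :* d :* (s :* e) := u :* s :* (d :* e)) u d s e ⟩
      u * s * (d * e)      ∎

    cross-/ : n * e * (v * s) ≈ u * t * (d * m)
    cross-/ = begin
      n * e * (v * s)      ≈⟨ solve 4 (λ n e v s → n :* e :* (v :* s) := n :* v :* (s :* e)) n e v s ⟩
      n * v * (s * e)      ≈⟨ *-cong h (sym k) ⟩
      u * d * (m * t)      ≈⟨ solve 4 (λ u d m t → u :* d :* (m :* t) := u :* t :* (d :* m)) u d m t ⟩
      u * t * (d * m)      ∎

  cross-neg : ∀ {m e s t} → m * t ≈ s * e → - m * t ≈ - s * e
  cross-neg {m} {e} {s} {t} k = begin
    - m * t    ≈⟨ solve 2 (λ m t → :- m :* t := :- (m :* t)) m t ⟩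
    - (m * t)  ≈⟨ -‿cong k ⟩
    - (s * e)  ≈⟨ solve 2 (λ s e → :- (s :* e) := :- s :* e) s e ⟩
    - s * e    ∎

  cross-minus : ∀ {n d u v m e s t} → n * v ≈ u * d → m * t ≈ s * e →
    (n * e - m * d) * (v * t) ≈ (u * t + - s * v) * (d * e)
  cross-minus {n} {d} {m = m} {e} h k = trans
    (*-congʳ (+-congˡ (solve 2 (λ m d → :- (m :* d) := :- m :* d) m d)))
    (cross-+ h (cross-neg k))

  -- The shape of a summand as a raw fraction: replacing the quotient of its factors
  -- n/d and m/e (equal to the ring elements u₂, u₁) by w/v.
  cross-replace : ∀ {n d m e u₂ u₁ w v} → n ≈ u₂ * d → m ≈ u₁ * e → u₂ * v ≈ w * u₁ →
    ∀ Q x₁ x₂ x₃ x₄ y₁ y₂ y₃ y₄ X₁ X₂ X₃ X₄ Y₁ Y₂ Y₃ Y₄ z Z →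
    Q * (x₁ * n * x₂ * x₃ * x₄ * (Y₁ * e * Y₂ * Y₃ * Y₄)) * z
      * (1# * (X₁ * 1# * X₂ * X₃ * X₄ * (y₁ * v * y₂ * y₃ * y₄)) * Z)
    ≈ Q * (x₁ * w * x₂ * x₃ * x₄ * (Y₁ * 1# * Y₂ * Y₃ * Y₄)) * z
      * (1# * (X₁ * d * X₂ * X₃ * X₄ * (y₁ * m * y₂ * y₃ * y₄)) * Z)
  cross-replace {n} {d} {m} {e} {u₂} {u₁} {w} {v} h k l Q x₁ x₂ x₃ x₄ y₁ y₂ y₃ y₄ X₁ X₂ X₃ X₄ Y₁ Y₂ Y₃ Y₄ z Z = begin
    Q * (x₁ * n * x₂ * x₃ * x₄ * (Y₁ * e * Y₂ * Y₃ * Y₄)) * z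
      * (1# * (X₁ * 1# * X₂ * X₃ * X₄ * (y₁ * v * y₂ * y₃ * y₄)) * Z)
      ≈⟨ solve 22 (λ n e v Q x₁ x₂ x₃ x₄ y₁ y₂ y₃ y₄ X₁ X₂ X₃ X₄ Y₁ Y₂ Y₃ Y₄ z Z →
           Q :* (x₁ :* n :* x₂ :* x₃ :* x₄ :* (Y₁ :* e :* Y₂ :* Y₃ :* Y₄)) :* z
           :* (:1 :* (X₁ :* :1 :* X₂ :* X₃ :* X₄ :* (y₁ :* v :* y₂ :* y₃ :* y₄)) :* Z)
           := n :* v :* e :* (Q :* (x₁ :* x₂ :* x₃ :* x₄ :* (Y₁ :* Y₂ :* Y₃ :* Y₄)) :* z
           :* (X₁ :* X₂ :* X₃ :* X₄ :* (y₁ :* y₂ :* y₃ :* y₄) :* Z)))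
           n e v Q x₁ x₂ x₃ x₄ y₁ y₂ y₃ y₄ X₁ X₂ X₃ X₄ Y₁ Y₂ Y₃ Y₄ z Z ⟩
    n * v * e * rest
      ≈⟨ *-congʳ (begin
           n * v * e            ≈⟨ *-congʳ (*-congʳ h) ⟩
           u₂ * d * v * e       ≈⟨ solve 4 (λ u d v e → u :* d :* v :* e := u :* v :* (d :* e)) u₂ d v e ⟩
           u₂ * v * (d * e)     ≈⟨ *-congʳ l ⟩
           w * u₁ * (d * e)     ≈⟨ solve 4 (λ w u d e → w :* u :* (d :* e) := w :* d :* (u :* e)) w u₁ d e ⟩
           w * d * (u₁ * e)     ≈⟨ *-congˡ k ⟨
           w * d * m            ∎) ⟩
    w * d * m * rest
      ≈⟨ solve 22 (λ w d m Q x₁ x₂ x₃ x₄ y₁ y₂ y₃ y₄ X₁ X₂ X₃ X₄ Y₁ Y₂ Y₃ Y₄ z Z →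
           w :* d :* m :* (Q :* (x₁ :* x₂ :* x₃ :* x₄ :* (Y₁ :* Y₂ :* Y₃ :* Y₄)) :* z
           :* (X₁ :* X₂ :* X₃ :* X₄ :* (y₁ :* y₂ :* y₃ :* y₄) :* Z))
           := Q :* (x₁ :* w :* x₂ :* x₃ :* x₄ :* (Y₁ :* :1 :* Y₂ :* Y₃ :* Y₄)) :* z
           :* (:1 :* (X₁ :* d :* X₂ :* X₃ :* X₄ :* (y₁ :* m :* y₂ :* y₃ :* y₄)) :* Z))
           w d m Q x₁ x₂ x₃ x₄ y₁ y₂ y₃ y₄ X₁ X₂ X₃ X₄ Y₁ Y₂ Y₃ Y₄ z Z ⟩
    Q * (x₁ * w * x₂ * x₃ * x₄ * (Y₁ * 1# * Y₂ * Y₃ * Y₄)) * z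
      * (1# * (X₁ * d * X₂ * X₃ * X₄ * (y₁ * m * y₂ * y₃ * y₄)) * Z) ∎
    where
    rest : Carrier
    rest = Q * (x₁ * x₂ * x₃ * x₄ * (Y₁ * Y₂ * Y₃ * Y₄)) * z
      * (X₁ * X₂ * X₃ * X₄ * (y₁ * y₂ * y₃ * y₄) * Z)

-- Localisation modulo a polynomial

-- Fractions with denominators regular modulo f, compared modulo f.
module Localisation {c ℓ} (R : CommutativeRing c ℓ) (f : CommutativeRing.Carrier R) where
  open CommutativeRing R
  open Solver R
  open Divisibility R

  Regular : Carrier → Set (c ⊔ ℓ)
  Regular v = ∀ x → f ∣ v * x → f ∣ x

  regular-1 : Regular 1#
  regular-1 x = ∣-respʳ (*-identityˡ x)

  regular-* : ∀ {u v} → Regular u → Regular v → Regular (u * v)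
  regular-* ru rv x d = rv x (ru _ (∣-respʳ (*-assoc _ _ x) d))

  regular-*⁻ : ∀ {u v} → Regular (u * v) → Regular u
  regular-*⁻ {u} {v} ruv x d = ruv x (∣-respʳ (solve 3 (λ u v x → v :* (u :* x) := u :* v :* x) u v x) (∣-*ˡ v d))

  regular-mod : ∀ {u v} → f ∣ u - v → Regular u → Regular v
  regular-mod {u} {v} d ru x e = ru x
    (∣-respʳ (solve 3 (λ u v x → (u :- v) :* x :+ v :* x := u :* x) u v x) (∣-+ (∣-*ʳ x d) e))

  infix 5 _/_⟨_⟩
  record Fraction : Set (c ⊔ ℓ) where
    constructor _/_⟨_⟩
    field
      numer   : Carrier
      denom   : Carrier
      regular : Regular denom
  open Fraction public

  infix 4 _∼_
  record _∼_ (x y : Fraction) : Set (c ⊔ ℓ) where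
    constructor congruent
    field difference : f ∣ numer x * denom y - numer y * denom x
  open _∼_ public

  exact : ∀ {x y} → numer x * denom y ≈ numer y * denom x → x ∼ y
  exact {x} {y} e = congruent (∣-respʳ (sym (trans (+-congʳ e) (-‿inverseʳ _))) ∣-0)

  infixl 6 _⊕_
  infixl 7 _⊗_
  opaque
    _⊕_ _⊗_ : Fraction → Fraction → Fraction
    x ⊕ y = (numer x * denom y + numer y * denom x) / denom x * denom y ⟨ regular-* (regular x) (regular y) ⟩
    x ⊗ y = numer x * numer y / denom x * denom y ⟨ regular-* (regular x) (regular y) ⟩

    ⊖_ : Fraction → Fraction
    ⊖ x = (- numer x) / denom x ⟨ regular x ⟩

  ι : Carrier → Fraction
  ι x = x / 1# ⟨ regular-1 ⟩

  opaque
    unfolding _⊕_ _⊗_ ⊖_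

    ∼-isCommutativeRing : IsCommutativeRing _∼_ _⊕_ _⊗_ ⊖_ (ι 0#) (ι 1#)
    ∼-isCommutativeRing = record
      { isRing = record
        { +-isAbelianGroup = record
          { isGroup = record
            { isMonoid = record
              { isSemigroup = record
                { isMagma = record
                  { isEquivalence = record { refl = exact refl ; sym = ∼-sym ; trans = ∼-trans }
                  ; ∙-cong = ⊕-cong }
                ; assoc = λ x y z → exact (solve 6 (λ n d m e k g →
                    ((n :* e :+ m :* d) :* g :+ k :* (d :* e)) :* (d :* (e :* g))
                    := (n :* (e :* g) :+ (m :* g :+ k :* e) :* d) :* (d :* e :* g))
                    (numer x) (denom x) (numer y) (denom y) (numer z) (denom z)) }
              ; identity =
                (λ x → exact (solve 2 (λ n d → (:0 :* d :+ n :* :1) :* d := n :* (:1 :* d)) (numer x) (denom x))) ,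
                (λ x → exact (solve 2 (λ n d → (n :* :1 :+ :0 :* d) :* d := n :* (d :* :1)) (numer x) (denom x))) }
            ; inverse =
              (λ x → exact (solve 2 (λ n d → ((:- n) :* d :+ n :* d) :* :1 := :0 :* (d :* d)) (numer x) (denom x))) ,
              (λ x → exact (solve 2 (λ n d → (n :* d :+ (:- n) :* d) :* :1 := :0 :* (d :* d)) (numer x) (denom x)))
            ; ⁻¹-cong = λ {x} {y} e → congruent (∣-respʳ (solve 4 (λ n d m e →
                :- (n :* e :- m :* d) := (:- n) :* e :- (:- m) :* d)
                (numer x) (denom x) (numer y) (denom y)) (∣-neg (difference e))) }
          ; comm = λ x y → exact (solve 4 (λ n d m e →
              (n :* e :+ m :* d) :* (e :* d) := (m :* d :+ n :* e) :* (d :* e))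
              (numer x) (denom x) (numer y) (denom y)) }
        ; *-cong = ⊗-cong
        ; *-assoc = λ x y z → exact (solve 6 (λ n d m e k g →
            n :* m :* k :* (d :* (e :* g)) := n :* (m :* k) :* (d :* e :* g))
            (numer x) (denom x) (numer y) (denom y) (numer z) (denom z))
        ; *-identity =
          (λ x → exact (solve 2 (λ n d → :1 :* n :* d := n :* (:1 :* d)) (numer x) (denom x))) ,
          (λ x → exact (solve 2 (λ n d → n :* :1 :* d := n :* (d :* :1)) (numer x) (denom x)))
        ; distrib =
          (λ x y z → exact (solve 6 (λ n d m e k g →
            n :* (m :* g :+ k :* e) :* (d :* e :* (d :* g))
            := (n :* m :* (d :* g) :+ n :* k :* (d :* e)) :* (d :* (e :* g)))
            (numer x) (denom x) (numer y) (denom y) (numer z) (denom z))) ,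
          (λ x y z → exact (solve 6 (λ n d m e k g →
            (m :* g :+ k :* e) :* n :* (e :* d :* (g :* d))
            := (m :* n :* (g :* d) :+ k :* n :* (e :* d)) :* (e :* g :* d))
            (numer x) (denom x) (numer y) (denom y) (numer z) (denom z))) }
      ; *-comm = λ x y → exact (solve 4 (λ n d m e → n :* m :* (e :* d) := m :* n :* (d :* e))
          (numer x) (denom x) (numer y) (denom y)) }
      where
      ∼-sym : ∀ {x y} → x ∼ y → y ∼ x
      ∼-sym {x} {y} e = congruent (∣-respʳ (solve 2 (λ s t → :- (s :- t) := t :- s) _ _) (∣-neg (difference e)))
      ∼-trans : ∀ {x y z} → x ∼ y → y ∼ z → x ∼ z
      -- The combination of the two differences is the wanted one multiplied by the middle
      -- denominator, which is cancelled because it is regular.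
      ∼-trans {x} {y} {z} e e′ = congruent (regular y _ (∣-respʳ (solve 6 (λ n d m e k g →
          g :* (n :* e :- m :* d) :+ d :* (m :* g :- k :* e) := e :* (n :* g :- k :* d))
          (numer x) (denom x) (numer y) (denom y) (numer z) (denom z))
        (∣-+ (∣-*ˡ (denom z) (difference e)) (∣-*ˡ (denom x) (difference e′)))))
      ⊕-cong : ∀ {x x′ y y′} → x ∼ x′ → y ∼ y′ → x ⊕ y ∼ x′ ⊕ y′
      ⊕-cong {x} {x′} {y} {y′} e e′ = congruent (∣-respʳ (solve 8 (λ n d n′ d′ m e m′ e′ →
          e :* e′ :* (n :* d′ :- n′ :* d) :+ d :* d′ :* (m :* e′ :- m′ :* e)
          := (n :* e :+ m :* d) :* (d′ :* e′) :- (n′ :* e′ :+ m′ :* d′) :* (d :* e))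
          (numer x) (denom x) (numer x′) (denom x′) (numer y) (denom y) (numer y′) (denom y′))
        (∣-+ (∣-*ˡ _ (difference e)) (∣-*ˡ _ (difference e′))))
      ⊗-cong : ∀ {x x′ y y′} → x ∼ x′ → y ∼ y′ → x ⊗ y ∼ x′ ⊗ y′
      ⊗-cong {x} {x′} {y} {y′} e e′ = congruent (∣-respʳ (solve 8 (λ n d n′ d′ m e m′ e′ →
          m :* e′ :* (n :* d′ :- n′ :* d) :+ n′ :* d :* (m :* e′ :- m′ :* e)
          := n :* m :* (d′ :* e′) :- n′ :* m′ :* (d :* e))
          (numer x) (denom x) (numer x′) (denom x′) (numer y) (denom y) (numer y′) (denom y′))
        (∣-+ (∣-*ˡ _ (difference e)) (∣-*ˡ _ (difference e′))))

  localRing : CommutativeRing (c ⊔ ℓ) (c ⊔ ℓ)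
  localRing = record { isCommutativeRing = ∼-isCommutativeRing }

  ι-cong : ∀ {x y} → x ≈ y → ι x ∼ ι y
  ι-cong e = exact (*-congʳ e)

  ι-mod : ∀ {x y} → f ∣ x - y → ι x ∼ ι y
  ι-mod {x} {y} d = congruent (∣-respʳ (solve 2 (λ x y → x :- y := x :* :1 :- y :* :1) x y) d)

  opaque
    unfolding _⊕_ _⊗_ ⊖_

    ι-+ : ∀ x y → ι (x + y) ∼ ι x ⊕ ι y
    ι-+ x y = exact (solve 2 (λ x y → (x :+ y) :* (:1 :* :1) := (x :* :1 :+ y :* :1) :* :1) x y)

    ι-* : ∀ x y → ι (x * y) ∼ ι x ⊗ ι y
    ι-* x y = exact (solve 2 (λ x y → x :* y :* (:1 :* :1) := x :* y :* :1) x y)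

    ι-neg : ∀ x → ι (- x) ∼ ⊖ ι x
    ι-neg x = exact refl

  ∼0⇒∣ : ∀ {x} → x ∼ ι 0# → f ∣ numer x
  ∼0⇒∣ {x} e = ∣-respʳ (solve 2 (λ n d → n :* :1 :- :0 :* d := n) (numer x) (denom x)) (difference e)

module Units {c ℓ} (R : CommutativeRing c ℓ) where
  open CommutativeRing R hiding (zero)
  open Solver R
  open SetoidReasoning setoid

  Unit : Carrier → Set (c ⊔ ℓ)
  Unit x = Σ Carrier λ i → x * i ≈ 1#

  unit-cong : ∀ {x y} → x ≈ y → Unit x → Unit y
  unit-cong e (i , h) = i , trans (*-congʳ (sym e)) h

  unit-* : ∀ {x y} → Unit x → Unit y → Unit (x * y)
  unit-* {x} {y} (i , h) (j , k) = i * j , (begin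
    x * y * (i * j)    ≈⟨ solve 4 (λ x y i j → x :* y :* (i :* j) := x :* i :* (y :* j)) x y i j ⟩
    x * i * (y * j)    ≈⟨ *-cong h k ⟩
    1# * 1#            ≈⟨ *-identityʳ 1# ⟩
    1#                 ∎)

  unit-1 : Unit 1#
  unit-1 = 1# , *-identityʳ 1#

  unit-cancel : ∀ {x} y z → Unit x → x * y ≈ x * z → y ≈ z
  unit-cancel {x} y z (i , h) e = begin
    y            ≈⟨ *-identityˡ y ⟨
    1# * y       ≈⟨ *-congʳ h ⟨
    x * i * y    ≈⟨ solve 3 (λ x i y → x :* i :* y := i :* (x :* y)) x i y ⟩
    i * (x * y)  ≈⟨ *-congˡ e ⟩
    i * (x * z)  ≈⟨ solve 3 (λ x i y → i :* (x :* y) := x :* i :* y) x i z ⟩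
    x * i * z    ≈⟨ *-congʳ h ⟩
    1# * z       ≈⟨ *-identityˡ z ⟩
    z            ∎

  unit-zero : ∀ {x} z → Unit x → x * z ≈ 0# → z ≈ 0#
  unit-zero z u e = unit-cancel z 0# u (trans e (sym (zeroʳ _)))

  -- Inverses of the members of a family that satisfy V, and 0 elsewhere.
  inverses : (x : ℕ → Carrier) {V : ℕ → Set} → (∀ j → Dec (V j)) → (∀ j → V j → Unit (x j)) →
             Σ (ℕ → Carrier) λ i → ∀ j → V j → x j * i j ≈ 1#
  inverses x {V} V? u = (λ j → inv j (V? j)) , λ j v → correct j (V? j) v
    where
    inv : ∀ j → Dec (V j) → Carrier
    inv j (yes v) = proj₁ (u j v)
    inv j (no _)  = 0#
    correct : ∀ j (d : Dec (V j)) → V j → x j * inv j d ≈ 1#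
    correct j (yes v) _ = proj₂ (u j v)
    correct j (no ¬v) v = ⊥-elim (¬v v)

  unit-factor : ∀ {x y} → Unit (x * y) → Unit y
  unit-factor {x} {y} (i , h) = x * i , trans (solve 3 (λ x y i → y :* (x :* i) := x :* y :* i) x y i) h

  open BigOperators R

  ∏-inverse : ∀ k {f g : ℕ → Carrier} → (∀ j → j ℕ.< k → f j * g j ≈ 1#) → ∏ k f * ∏ k g ≈ 1#
  ∏-inverse zero    h = *-identityʳ 1#
  ∏-inverse (suc k) h = trans (solve 4 (λ a b c d → a :* b :* (c :* d) := a :* c :* (b :* d)) _ _ _ _)
    (trans (*-cong (∏-inverse k λ j j<k → h j (ℕₚ.m<n⇒m<1+n j<k)) (h k ℕₚ.≤-refl)) (*-identityʳ 1#))

  unit-∏ : ∀ k (f : ℕ → Carrier) → (∀ j → j ℕ.< k → Unit (f j)) → Unit (∏ k f)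
  unit-∏ zero    f u = unit-1
  unit-∏ (suc k) f u = unit-* (unit-∏ k f λ j j<k → u j (ℕₚ.m<n⇒m<1+n j<k)) (u k ℕₚ.≤-refl)

module LocalUnits {c ℓ} (R : CommutativeRing c ℓ) (f : CommutativeRing.Carrier R) where
  open CommutativeRing R
  open Solver R
  open Divisibility R
  open Localisation R f
  open Units localRing

  opaque
    unfolding _⊗_

    regular-inverse : ∀ x (r : Regular (numer x)) → x ⊗ (denom x / numer x ⟨ r ⟩) ∼ ι 1#
    regular-inverse x r = exact (solve 2 (λ n d → n :* d :* :1 := :1 :* (d :* n)) (numer x) (denom x))

    -- An inverse m/e of n/d means that nm and de agree modulo f; as de is regular, so is nm, and
    -- hence its factor n.
    unit⇒regular : ∀ x → Unit x → Regular (numer x)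
    unit⇒regular x (i , h) = regular-*⁻ {v = numer i} (regular-mod (∣-respʳ
      (solve 4 (λ n d m e → :- (n :* m :* :1 :- :1 :* (d :* e)) := d :* e :- n :* m)
        (numer x) (denom x) (numer i) (denom i)) (∣-neg (difference h)))
      (regular-* (regular x) (regular i)))

  regular⇒unit : ∀ x → Regular (numer x) → Unit x
  regular⇒unit x r = (denom x / numer x ⟨ r ⟩) , regular-inverse x r

  private module L where
    open CommutativeRing localRing public
    open Exp (CommutativeRing.semiring localRing) public using (_^_)
  open Exp (CommutativeRing.semiring R) using (_^_)
  open BigOperators R using (∏)
  open BigOperators localRing using () renaming (∏ to ∏ᴸ)

  ι-^ : ∀ x k → ι (x ^ k) ∼ ι x L.^ k
  ι-^ x zero    = L.refl
  ι-^ x (suc k) = L.trans (ι-* x (x ^ k)) (L.*-congˡ {ι x} (ι-^ x k))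

  ι-∏ : ∀ k (g : ℕ → Carrier) → ι (∏ k g) ∼ ∏ᴸ k (λ j → ι (g j))
  ι-∏ zero    g = L.refl
  ι-∏ (suc k) g = L.trans (ι-* (∏ k g) (g k)) (L.*-congʳ {ι (g k)} (ι-∏ k g))

  ι-minus : ∀ x y → ι (x - y) ∼ ι x L.- ι y
  ι-minus x y = L.trans (ι-+ x (- y)) (L.+-congˡ {ι x} (ι-neg y))

  ι-minus-* : ∀ x y z → ι (x - y * z) ∼ ι x L.- ι y L.* ι z
  ι-minus-* x y z = L.trans (ι-minus x (y * z)) (L.+-congˡ {ι x} (L.-‿cong (ι-* y z)))

-- The fractions of the localisation that are represented by raw quotients n/d.
module Represent {c ℓ′} (R : CommutativeRing c ℓ′) (integral : NoZeroDivisors R) (1≉0 : Nontrivial R)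
  (f : CommutativeRing.Carrier R) where
  open CommutativeRing R
  open Integral R integral
  open CrossMultiplication R
  open Divisibility R
  open Localisation R f
  open LocalUnits R f
  open Units localRing
  private module L = CommutativeRing localRing

  -- The raw denominator d may have factors in common with f; it is only required that n/d equals,
  -- as a rational function, some fraction with a regular denominator.
  record Represents (n d : Carrier) (ℓ : Fraction) : Set (c ⊔ ℓ′) where
    constructor represents
    field
      fraction : Fraction
      den≉0    : d ≉ 0#
      value    : n * denom fraction ≈ numer fraction * d
      class    : fraction ∼ ℓ

  rep-cong : ∀ {n d ℓ s} → ℓ ∼ s → Represents n d ℓ → Represents n d s
  rep-cong e (represents r d h k) = represents r d h (L.trans k e)

  rep-ι : ∀ p → Represents p 1# (ι p)
  rep-ι p = represents (ι p) 1≉0 refl L.refl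

  opaque
    unfolding _⊕_ _⊗_ ⊖_

    rep-+ : ∀ {n d m e ℓ s} → Represents n d ℓ → Represents m e s → Represents (n * e + m * d) (d * e) (ℓ ⊕ s)
    rep-+ (represents r d h k) (represents r′ d′ h′ k′) =
      represents (r ⊕ r′) (*-nonzero d d′) (cross-+ h h′) (L.+-cong k k′)

    rep-minus : ∀ {n d m e ℓ s} → Represents n d ℓ → Represents m e s → Represents (n * e - m * d) (d * e) (ℓ ⊕ ⊖ s)
    rep-minus (represents r d h k) (represents r′ d′ h′ k′) =
      represents (r ⊕ ⊖ r′) (*-nonzero d d′) (cross-minus h h′) (L.+-cong k (L.-‿cong k′))

    rep-* : ∀ {n d m e ℓ s} → Represents n d ℓ → Represents m e s → Represents (n * m) (d * e) (ℓ ⊗ s)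
    rep-* (represents r d h k) (represents r′ d′ h′ k′) =
      represents (r ⊗ r′) (*-nonzero d d′) (cross-* h h′) (L.*-cong k k′)

    rep-/ : ∀ {n d m e ℓ s i} → Represents n d ℓ → Represents m e s → m ≉ 0# → s ⊗ i ∼ ι 1# →
            Represents (n * e) (d * m) (ℓ ⊗ i)
    rep-/ {s = s} {i} (represents r d h k) (represents r′ d′ h′ k′) n≉0 si≈1 =
      represents (r ⊗ r′⁻¹) (*-nonzero d n≉0) (cross-/ h h′) (L.*-cong k (unit-cancel {s} r′⁻¹ i (i , si≈1)
        (L.trans (L.*-congʳ {r′⁻¹} (L.sym k′)) (L.trans (regular-inverse r′ r′-regular) (L.sym si≈1)))))
      where
      r′-regular : Regular (numer r′)
      r′-regular = unit⇒regular r′ (i , L.trans (L.*-congʳ {i} k′) si≈1)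
      r′⁻¹ : Fraction
      r′⁻¹ = denom r′ / numer r′ ⟨ r′-regular ⟩

  rep-replace : ∀ {n d m e ℓ} → d ≉ 0# → n * e ≈ m * d → Represents m e ℓ → Represents n d ℓ
  rep-replace {n} {d} {m} {e} d≉0 h (represents r e≉0 k l) = represents r d≉0 (*-cancelˡ e≉0 (begin
    e * (n * denom r)      ≈⟨ solve 3 (λ e n v → e :* (n :* v) := n :* e :* v) e n (denom r) ⟩
    n * e * denom r        ≈⟨ *-congʳ h ⟩
    m * d * denom r        ≈⟨ solve 3 (λ m d v → m :* d :* v := m :* v :* d) m d (denom r) ⟩
    m * denom r * d        ≈⟨ *-congʳ k ⟩
    numer r * e * d        ≈⟨ solve 3 (λ u e d → u :* e :* d := e :* (u :* d)) (numer r) e d ⟩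
    e * (numer r * d)      ∎)) l
    where
    open Solver R
    open SetoidReasoning setoid

  -- If n were 0, the regular numerator of the representing fraction would be 0, and 0 is regular
  -- only if f divides 1.
  rep-nonzero : ∀ {n d ℓ} → ¬ f ∣ 1# → Represents n d ℓ → Unit ℓ → n ≉ 0#
  rep-nonzero {n} {d} f∤1 (represents r d≉0 h k) u n≈0 = regular-nonzero (integral _ _ (trans (sym h)
      (trans (*-congʳ n≈0) (zeroˡ _))))
    where
    regular-nonzero : numer r ≈ 0# ⊎ d ≈ 0# → ⊥
    regular-nonzero (inj₁ z) = f∤1 (unit⇒regular r (unit-cong (L.sym k) u) 1# (∣-respʳ (sym (trans (*-congʳ z) (zeroˡ 1#))) ∣-0))
    regular-nonzero (inj₂ z) = d≉0 z

  rep-zero : ∀ {n d} → Represents n d (ι 0#) →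
             Σ Carrier λ v → Σ Carrier λ t → Regular v × n * v ≈ f * t * d
  rep-zero (represents r d≉0 h k) = denom r , quotient f∣u , regular r , trans h (*-congʳ (equality f∣u))
    where
    open _∣_
    f∣u : f ∣ numer r
    f∣u = ∼0⇒∣ k

module ExactQuotients {c ℓ} (R : CommutativeRing c ℓ) (integral : NoZeroDivisors R) (1≉0 : Nontrivial R) where
  open CommutativeRing R
  open Integral R integral
  open Solver R

  record Exact (n d u : Carrier) : Set (c ⊔ ℓ) where
    constructor exactly
    field
      exact-den≉0 : d ≉ 0#
      exact-value : n ≈ u * d
  open Exact public

  exact-ι : ∀ p → Exact p 1# p
  exact-ι p = exactly 1≉0 (sym (*-identityʳ p))

  exact-* : ∀ {n d m e u v} → Exact n d u → Exact m e v → Exact (n * m) (d * e) (u * v)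
  exact-* {n} {d} {m} {e} {u} {v} (exactly d≉0 h) (exactly e≉0 k) = exactly (*-nonzero d≉0 e≉0)
    (trans (*-cong h k) (solve 4 (λ u d v e → u :* d :* (v :* e) := u :* v :* (d :* e)) u d v e))

  exact-minus : ∀ {n d m e u v} → Exact n d u → Exact m e v → Exact (n * e - m * d) (d * e) (u - v)
  exact-minus {n} {d} {m} {e} {u} {v} (exactly d≉0 h) (exactly e≉0 k) = exactly (*-nonzero d≉0 e≉0)
    (trans (+-cong (*-congʳ h) (-‿cong (*-congʳ k)))
      (solve 4 (λ u d v e → u :* d :* e :- v :* e :* d := (u :- v) :* (d :* e)) u d v e))

-- The sums modulo each factor of the modulus

module LocalSums {a′ ℓ} (R : CommutativeRing a′ ℓ) where
  open CommutativeRing R hiding (zero)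
  open Exp semiring using (_^_; ^-homo-*)
  open Solver R
  open BigOperators R
  open Units R
  open SetoidReasoning setoid

  -- The summands of the theorem, for specialised parameters: uₖ is (q;q²)ₖ/(q;q)ₖ and Qₖ is [3k+1].
  record Data (V : ℕ → Set) : Set (a′ ⊔ ℓ) where
    field
      q a a⁻¹ b b⁻¹ c c⁻¹ : Carrier
      a-inv : a * a⁻¹ ≈ 1#
      b-inv : b * b⁻¹ ≈ 1#
      c-inv : c * c⁻¹ ≈ 1#
      u Q : ℕ → Carrier
      u-zero : u 0 ≈ 1#
      u-suc  : ∀ k → (1# - q * q ^ k) * u (suc k) ≈ (1# - q * (q ^ k * q ^ k)) * u k
      Q-eq   : ∀ k → (1# - q) * Q k ≈ 1# - q * (q ^ k * q ^ k * q ^ k)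
      i₁ i₂ i₃ i₄ i₅ : ℕ → Carrier
      i₁-inv : ∀ j → V j → (1# - a * q * q ^ j) * i₁ j ≈ 1#
      i₂-inv : ∀ j → V j → (1# - q * a⁻¹ * q ^ j) * i₂ j ≈ 1#
      i₃-inv : ∀ j → V j → (1# - b * (q * q) * (q ^ j * q ^ j)) * i₃ j ≈ 1#
      i₄-inv : ∀ j → V j → (1# - c * (q * q) * (q ^ j * q ^ j)) * i₄ j ≈ 1#
      i₅-inv : ∀ j → V j → (1# - q * q * q * (b⁻¹ * c⁻¹) * (q ^ j * q ^ j)) * i₅ j ≈ 1#

    r : ℕ → Carrier
    r j = (1# - a * q * (x * x)) * (1# - q * a⁻¹ * (x * x)) * (1# - q * b⁻¹ * x) * (1# - q * c⁻¹ * x) * (1# - b * c * x)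
        * (i₁ j * i₂ j * i₃ j * i₄ j * i₅ j)
      where x = q ^ j

    t : ℕ → Carrier
    t k = Q k * (u k * ∏ k r) * q ^ k

    ∏r-split : ∀ k → ∏ k r ≈
      ∏ k (λ j → 1# - a * q * (q ^ j * q ^ j)) * ∏ k (λ j → 1# - q * a⁻¹ * (q ^ j * q ^ j))
        * ∏ k (λ j → 1# - q * b⁻¹ * q ^ j) * ∏ k (λ j → 1# - q * c⁻¹ * q ^ j) * ∏ k (λ j → 1# - b * c * q ^ j)
        * (∏ k i₁ * ∏ k i₂ * ∏ k i₃ * ∏ k i₄ * ∏ k i₅)
    ∏r-split zero    = solve 0 (:1 := :1 :* :1 :* :1 :* :1 :* :1 :* (:1 :* :1 :* :1 :* :1 :* :1))
    ∏r-split (suc k) = trans (*-congʳ (∏r-split k)) (solve 20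
      (λ a b c d e i₁ i₂ i₃ i₄ i₅ a′ b′ c′ d′ e′ j₁ j₂ j₃ j₄ j₅ →
        a :* b :* c :* d :* e :* (i₁ :* i₂ :* i₃ :* i₄ :* i₅) :* (a′ :* b′ :* c′ :* d′ :* e′ :* (j₁ :* j₂ :* j₃ :* j₄ :* j₅))
        := (a :* a′) :* (b :* b′) :* (c :* c′) :* (d :* d′) :* (e :* e′)
          :* ((i₁ :* j₁) :* (i₂ :* j₂) :* (i₃ :* j₃) :* (i₄ :* j₄) :* (i₅ :* j₅)))
      _ _ _ _ _ _ _ _ _ _ _ _ _ _ _ _ _ _ _ _)

  module _ {V : ℕ → Set} (D : Data V) where
    open Data D
    open QuadraticSum R q

    -- The two orientations d = aq, d′ = q/a and d = q/a, d′ = aq of the quadratic sum.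
    module Oriented (d d′ : Carrier) (id id′ : ℕ → Carrier) (dd′≈q² : d * d′ ≈ q * q)
      (r≈ : ∀ j → r j ≈ (1# - d * (q ^ j * q ^ j)) * (1# - d′ * (q ^ j * q ^ j)) * (1# - q * b⁻¹ * q ^ j)
                      * (1# - q * c⁻¹ * q ^ j) * (1# - b * c * q ^ j) * (id j * id′ j * i₃ j * i₄ j * i₅ j))
      (id-inv : ∀ j → V j → (1# - d * q ^ j) * id j ≈ 1#)
      (id′-inv : ∀ j → V j → (1# - d′ * q ^ j) * id′ j ≈ 1#)
      (m : ℕ) (V-2m : ∀ j → j ℕ.< m ℕ.+ m → V j) (q-units : ∀ j → j ℕ.< m → Unit (1# - q * q ^ j)) where

      private
        iq : ℕ → Carrier
        iq = proj₁ (inverses (λ j → 1# - q * q ^ j) (ℕₚ._<? m) q-units)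
        iq-inv : ∀ j → j ℕ.< m → (1# - q * q ^ j) * iq j ≈ 1#
        iq-inv = proj₂ (inverses (λ j → 1# - q * q ^ j) (ℕₚ._<? m) q-units)
        V-m : ∀ j → j ℕ.< m → V j
        V-m j j<m = V-2m j (ℕₚ.≤-trans j<m (ℕₚ.m≤m+n m m))

      -- The specialisation A = q: with these values e = q/c, B = bq², C = q³/bc and E = cq², which
      -- are the parameters of the theorem, and (A;q²)ₖ becomes (q;q²)ₖ.
      S : System
      S = record
        { b = q * b⁻¹ ; c = b * c ; g = c⁻¹ ; d = d ; d′ = d′
        ; iq = iq ; id = id ; id′ = id′ ; iB = i₃ ; iC = i₅ ; iE = i₄ }

      open System S using (A; B; C; E; e; ratio; weight; term)

      A≈q : A ≈ q
      A≈q = begin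
        q * b⁻¹ * (b * c) * c⁻¹
          ≈⟨ solve 5 (λ q b b′ c c′ → q :* b′ :* (b :* c) :* c′ := q :* ((b :* b′) :* (c :* c′))) q b b⁻¹ c c⁻¹ ⟩
        q * ((b * b⁻¹) * (c * c⁻¹))  ≈⟨ *-congˡ (*-cong b-inv c-inv) ⟩
        q * (1# * 1#)                ≈⟨ solve 1 (λ q → q :* (:1 :* :1) := q) q ⟩
        q                            ∎

      B≈ : B ≈ b * (q * q)
      B≈ = begin
        q * q * (b * c * c⁻¹)    ≈⟨ solve 4 (λ q b c c′ → q :* q :* (b :* c :* c′) := b :* (q :* q) :* (c :* c′)) q b c c⁻¹ ⟩
        b * (q * q) * (c * c⁻¹)  ≈⟨ *-congˡ c-inv ⟩
        b * (q * q) * 1#         ≈⟨ *-identityʳ _ ⟩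
        b * (q * q)              ∎

      C≈ : C ≈ q * q * q * (b⁻¹ * c⁻¹)
      C≈ = solve 3 (λ q b c → q :* q :* (q :* b :* c) := q :* q :* q :* (b :* c)) q b⁻¹ c⁻¹

      E≈ : E ≈ c * (q * q)
      E≈ = begin
        q * (q * b⁻¹ * (b * c))  ≈⟨ solve 4 (λ q b b′ c → q :* (q :* b′ :* (b :* c)) := c :* (q :* q) :* (b :* b′)) q b b⁻¹ c ⟩
        c * (q * q) * (b * b⁻¹)  ≈⟨ *-congˡ b-inv ⟩
        c * (q * q) * 1#         ≈⟨ *-identityʳ _ ⟩
        c * (q * q)              ∎

      factor-cong : ∀ {y z} x → y ≈ z → 1# - y * x ≈ 1# - z * x
      factor-cong x e = +-congˡ (-‿cong (*-congʳ e))

      valid : Valid S m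
      valid = record
        { dd′ = trans dd′≈q² (*-congˡ (sym A≈q))
        ; iq-inv = iq-inv
        ; id-inv = λ j j<2m → id-inv j (V-2m j j<2m)
        ; id′-inv = λ j j<m → id′-inv j (V-m j j<m)
        ; iB-inv = λ j j<m → trans (*-congʳ (factor-cong _ B≈)) (i₃-inv j (V-m j j<m))
        ; iC-inv = λ j j<m → trans (*-congʳ (factor-cong _ C≈)) (i₅-inv j (V-m j j<m))
        ; iE-inv = λ j j<m → trans (*-congʳ (factor-cong _ E≈)) (i₄-inv j (V-m j j<m)) }

      -- Restricted to k ≤ m, because the recurrence determines `u` only as long as 1 - q^(k+1) is
      -- invertible.
      u*∏r≈weight : ∀ k → k ℕ.≤ m → u k * ∏ k r ≈ weight k
      u*∏r≈weight zero    _   = trans (*-identityʳ _) u-zero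
      u*∏r≈weight (suc k) k<m = unit-cancel _ _ (q-units k k<m) (begin
        (1# - q * x) * (u (suc k) * (∏ k r * r k))
          ≈⟨ solve 4 (λ f u p r → f :* (u :* (p :* r)) := f :* u :* (p :* r)) (1# - q * x) (u (suc k)) (∏ k r) (r k) ⟩
        (1# - q * x) * u (suc k) * (∏ k r * r k)
          ≈⟨ *-cong (u-suc k) (*-congˡ (r≈ k)) ⟩
        (1# - q * (x * x)) * u k * (∏ k r * r′)
          ≈⟨ solve 4 (λ f u p r → f :* u :* (p :* r) := u :* p :* (f :* r)) (1# - q * (x * x)) (u k) (∏ k r) r′ ⟩
        u k * ∏ k r * ((1# - q * (x * x)) * r′)
          ≈⟨ *-cong (u*∏r≈weight k (ℕₚ.<⇒≤ k<m)) (*-congʳ (factor-cong (x * x) (sym A≈q))) ⟩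
        weight k * ((1# - A * (x * x)) * r′)
          ≈⟨ *-identityʳ _ ⟨
        weight k * ((1# - A * (x * x)) * r′) * 1#
          ≈⟨ *-congˡ (iq-inv k k<m) ⟨
        weight k * ((1# - A * (x * x)) * r′) * ((1# - q * x) * iq k)
          ≈⟨ solve 14 (λ w α δ δ′ β ε γ p₁ p₂ p₃ p₄ p₅ f i →
               w :* (α :* (δ :* δ′ :* β :* ε :* γ :* (p₁ :* p₂ :* p₃ :* p₄ :* p₅))) :* (f :* i)
               := f :* (w :* (α :* δ :* δ′ :* β :* γ :* ε :* (i :* p₁ :* p₂ :* p₃ :* p₅ :* p₄))))
               (weight k) (1# - A * (x * x)) (1# - d * (x * x)) (1# - d′ * (x * x)) (1# - q * b⁻¹ * x)
               (1# - q * c⁻¹ * x) (1# - b * c * x) (id k) (id′ k) (i₃ k) (i₄ k) (i₅ k) (1# - q * x) (iq k) ⟩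
        (1# - q * x) * (weight k * ratio k) ∎)
        where
        x r′ : Carrier
        x = q ^ k
        r′ = (1# - d * (x * x)) * (1# - d′ * (x * x)) * (1# - q * b⁻¹ * x)
           * (1# - q * c⁻¹ * x) * (1# - b * c * x) * (id k * id′ k * i₃ k * i₄ k * i₅ k)

      t≈term : ∀ k → k ℕ.≤ m → (1# - q) * t k ≈ term k
      t≈term k k≤m = begin
        (1# - q) * (Q k * (u k * ∏ k r) * q ^ k)
          ≈⟨ solve 4 (λ f Q w x → f :* (Q :* w :* x) := w :* ((f :* Q) :* x)) (1# - q) (Q k) (u k * ∏ k r) (q ^ k) ⟩
        u k * ∏ k r * ((1# - q) * Q k * q ^ k)
          ≈⟨ *-cong (u*∏r≈weight k k≤m) (*-congʳ (trans (Q-eq k) (factor-cong _ (sym A≈q)))) ⟩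
        term k ∎

      ∑t≈∑term : (1# - q) * ∑ (suc m) t ≈ ∑ (suc m) term
      ∑t≈∑term = trans (sym (∑-*ˡ (suc m) (1# - q) t)) (∑-cong (suc m) λ k k≤m → t≈term k (ℕ.s≤s⁻¹ k≤m))

      zero-sum : Unit (1# - q) → q * (q ^ m * q ^ m) ≈ 1# →
        (∀ i → i ℕ.< m → Unit (1# - q * b⁻¹ * (q ^ i * q ^ i))) →
        (∀ i → i ℕ.< m → Unit (d * (q ^ i * q ^ i) - b)) → ∑ (suc m) t ≈ 0#
      zero-sum q-unit q≈1 b-units d-units = unit-zero _ q-unit (trans ∑t≈∑term (sum-zero m S valid
        (trans (*-congʳ A≈q) q≈1) λ i i<m z h → unit-zero z (d-units i i<m) (unit-zero _ (b-units i i<m) (begin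
          (1# - q * b⁻¹ * (q ^ i * q ^ i)) * ((d * (q ^ i * q ^ i) - b) * z)
            ≈⟨ *-assoc _ _ z ⟨
          (1# - q * b⁻¹ * (q ^ i * q ^ i)) * (d * (q ^ i * q ^ i) - b) * z
            ≈⟨ *-congʳ (*-congˡ (+-congˡ (-‿cong bcg≈b))) ⟨
          (1# - q * b⁻¹ * (q ^ i * q ^ i)) * (d * (q ^ i * q ^ i) - b * c * c⁻¹) * z
            ≈⟨ h ⟩
          0# ∎))))
        where
        bcg≈b : b * c * c⁻¹ ≈ b
        bcg≈b = trans (*-assoc b c c⁻¹) (trans (*-congˡ c-inv) (*-identityʳ b))

      -- As A = q, the product ⟨ A ⟩ (m + 1) is (q;q²)ₘ (1 - q²ᵐ⁺¹). The first factor cancels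
      -- against the left side, and the second is (1 - q) times `Qn`, which will be [2m+1].
      product-sum : Unit (1# - q) → (∀ j → j ℕ.< m → Unit (1# - q * (q ^ j * q ^ j))) →
        d * (q ^ m * q ^ m) ≈ 1# → (∀ i → i ℕ.< m → Unit (1# - q * b⁻¹ * (q ^ i * q ^ i))) →
        ∀ {Qn} → (1# - q) * Qn ≈ 1# - q * (q ^ m * q ^ m) →
        ∑ (suc m) t * (⟨ q * q * q * (b⁻¹ * c⁻¹) ⟩ m * ⟨ b * (q * q) ⟩ m * ⟨ c * (q * q) ⟩ m)
          ≈ Qn * (⟨ b * c * q ⟩ m * ⟨ q * q * b⁻¹ ⟩ m * ⟨ q * q * c⁻¹ ⟩ m)
      product-sum q-unit qq-units d≈1 b-units {Qn} Qn-eq = unit-cancel _ _ (unit-* q-unit (unit-∏ m _ qq-units)) (begin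
        (1# - q) * ⟨ q ⟩ m * (∑ (suc m) t * (⟨ C′ ⟩ m * ⟨ B′ ⟩ m * ⟨ E′ ⟩ m))
          ≈⟨ solve 6 (λ f p s b c e → f :* p :* (s :* (c :* b :* e)) := f :* s :* (p :* b :* c :* e))
               (1# - q) (⟨ q ⟩ m) (∑ (suc m) t) (⟨ B′ ⟩ m) (⟨ C′ ⟩ m) (⟨ E′ ⟩ m) ⟩
        (1# - q) * ∑ (suc m) t * (⟨ q ⟩ m * ⟨ B′ ⟩ m * ⟨ C′ ⟩ m * ⟨ E′ ⟩ m)
          ≈⟨ *-cong ∑t≈∑term (*-cong (*-cong (*-congˡ (⟨⟩-cong m (sym B≈))) (⟨⟩-cong m (sym C≈))) (⟨⟩-cong m (sym E≈))) ⟩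
        ∑ (suc m) term * (⟨ q ⟩ m * ⟨ B ⟩ m * ⟨ C ⟩ m * ⟨ E ⟩ m)
          ≈⟨ sum-product m S valid d≈1 (λ i i<m z → unit-zero z (b-units i i<m)) ⟩
        ⟨ A ⟩ suc m * (⟨ q * b⁻¹ * q ⟩ m * ⟨ b * c * q ⟩ m * ⟨ q * c⁻¹ * q ⟩ m)
          ≈⟨ *-cong (⟨⟩-cong (suc m) A≈q) (*-cong (*-congʳ (⟨⟩-cong m (swap b⁻¹))) (⟨⟩-cong m (swap c⁻¹))) ⟩
        ⟨ q ⟩ m * (1# - q * (q ^ m * q ^ m)) * (⟨ q * q * b⁻¹ ⟩ m * ⟨ b * c * q ⟩ m * ⟨ q * q * c⁻¹ ⟩ m)
          ≈⟨ *-congʳ (*-congˡ Qn-eq) ⟨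
        ⟨ q ⟩ m * ((1# - q) * Qn) * (⟨ q * q * b⁻¹ ⟩ m * ⟨ b * c * q ⟩ m * ⟨ q * q * c⁻¹ ⟩ m)
          ≈⟨ solve 6 (λ p f Q b c e → p :* (f :* Q) :* (b :* c :* e) := f :* p :* (Q :* (c :* b :* e)))
               (⟨ q ⟩ m) (1# - q) Qn (⟨ q * q * b⁻¹ ⟩ m) (⟨ b * c * q ⟩ m) (⟨ q * q * c⁻¹ ⟩ m) ⟩
        (1# - q) * ⟨ q ⟩ m * (Qn * (⟨ b * c * q ⟩ m * ⟨ q * q * b⁻¹ ⟩ m * ⟨ q * q * c⁻¹ ⟩ m)) ∎)
        where
        B′ C′ E′ : Carrier
        B′ = b * (q * q)
        C′ = q * q * q * (b⁻¹ * c⁻¹)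
        E′ = c * (q * q)
        swap : ∀ y → q * y * q ≈ q * q * y
        swap y = solve 2 (λ q y → q :* y :* q := q :* q :* y) q y

      -- Every term of index greater than m contains the factor `r m`, and this contains 1 - dq²ᵐ.
      terms-vanish : 1# - d * (q ^ m * q ^ m) ≈ 0# → ∀ k → m ℕ.< k → t k ≈ 0#
      terms-vanish e k m<k = begin
        Q k * (u k * ∏ k r) * q ^ k  ≈⟨ *-congʳ (*-congˡ (*-congˡ (∏-0 r m m<k r-zero))) ⟩
        Q k * (u k * 0#) * q ^ k     ≈⟨ solve 3 (λ Q u x → Q :* (u :* :0) :* x := :0) (Q k) (u k) (q ^ k) ⟩
        0#                           ∎
        where
        r-zero : r m ≈ 0#
        r-zero = trans (r≈ m) (begin
          (1# - d * (q ^ m * q ^ m)) * (1# - d′ * (q ^ m * q ^ m)) * (1# - q * b⁻¹ * q ^ m)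
            * (1# - q * c⁻¹ * q ^ m) * (1# - b * c * q ^ m) * (id m * id′ m * i₃ m * i₄ m * i₅ m)
            ≈⟨ *-congʳ (*-congʳ (*-congʳ (*-congʳ (*-congʳ e)))) ⟩
          0# * (1# - d′ * (q ^ m * q ^ m)) * (1# - q * b⁻¹ * q ^ m)
            * (1# - q * c⁻¹ * q ^ m) * (1# - b * c * q ^ m) * (id m * id′ m * i₃ m * i₄ m * i₅ m)
            ≈⟨ solve 5 (λ a b c d e → :0 :* a :* b :* c :* d :* e := :0) _ _ _ _ _ ⟩
          0# ∎)

    aa⁻¹ : a * q * (q * a⁻¹) ≈ q * q
    aa⁻¹ = begin
      a * q * (q * a⁻¹)    ≈⟨ solve 3 (λ a q a′ → a :* q :* (q :* a′) := q :* q :* (a :* a′)) a q a⁻¹ ⟩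
      q * q * (a * a⁻¹)    ≈⟨ *-congˡ a-inv ⟩
      q * q * 1#           ≈⟨ *-identityʳ _ ⟩
      q * q                ∎

    module Direct = Oriented (a * q) (q * a⁻¹) i₁ i₂ aa⁻¹ (λ j → refl) i₁-inv i₂-inv
    module Inverted = Oriented (q * a⁻¹) (a * q) i₂ i₁ (trans (*-comm _ _) aa⁻¹)
      (λ j → solve 10 (λ α β γ δ ε j₁ j₂ j₃ j₄ j₅ →
          α :* β :* γ :* δ :* ε :* (j₁ :* j₂ :* j₃ :* j₄ :* j₅) := β :* α :* γ :* δ :* ε :* (j₂ :* j₁ :* j₃ :* j₄ :* j₅))
        _ _ _ _ _ _ _ _ _ _)
      i₂-inv i₁-inv

    module RootOfUnity (p : ℕ) (q^o≈1 : q ^ suc (p ℕ.+ p) ≈ 1#) (V-all : ∀ j → V j)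
      (q-units : ∀ j → j ℕ.< p ℕ.+ p → Unit (1# - q * q ^ j)) (q-unit : Unit (1# - q))
      (b-units : ∀ i → Unit (1# - q * b⁻¹ * (q ^ i * q ^ i)))
      (d-units : ∀ i → Unit (a * q * (q ^ i * q ^ i) - b)) where

      o : ℕ
      o = suc (p ℕ.+ p)

      half-period : ∑ (suc p) t ≈ 0#
      half-period = Direct.zero-sum p (λ j _ → V-all j) (λ j j<p → q-units j (ℕₚ.≤-trans j<p (ℕₚ.m≤m+n p p))) q-unit
        (trans (*-congˡ (sym (^-homo-* q p p))) q^o≈1) (λ i _ → b-units i) (λ i _ → d-units i)

      -- At index p the right side of the recurrence has the factor 1 - q²ᵖ⁺¹ = 0; the zero then
      -- propagates to the end of the period, where 1 - q^(j+1) ceases to be invertible.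
      u-zero-tail : ∀ k → p ℕ.+ k ℕ.< p ℕ.+ p → u (suc (p ℕ.+ k)) ≈ 0#
      u-zero-tail k k<p = unit-zero _ (q-units (p ℕ.+ k) k<p) (trans (u-suc (p ℕ.+ k)) (right k k<p))
        where
        right : ∀ k → p ℕ.+ k ℕ.< p ℕ.+ p → (1# - q * (q ^ (p ℕ.+ k) * q ^ (p ℕ.+ k))) * u (p ℕ.+ k) ≈ 0#
        right zero    _   = trans (*-congʳ (trans (+-congˡ (-‿cong (trans (*-congˡ (trans
            (sym (^-homo-* q (p ℕ.+ 0) (p ℕ.+ 0)))
            (reflexive (≡.cong₂ (λ i j → q ^ (i ℕ.+ j)) (ℕₚ.+-identityʳ p) (ℕₚ.+-identityʳ p))))) q^o≈1)))
          (-‿inverseʳ 1#))) (zeroˡ _)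
        right (suc k) k<p = trans (*-congˡ (trans (reflexive (≡.cong u (ℕₚ.+-suc p k)))
          (u-zero-tail k (ℕₚ.<-trans (ℕₚ.+-monoʳ-< p ℕₚ.≤-refl) k<p)))) (zeroʳ _)

      period : ∑ o t ≈ 0#
      period = begin
        ∑ (suc p ℕ.+ p) t                                  ≈⟨ ∑-++ (suc p) p t ⟩
        ∑ (suc p) t + ∑ p (λ j → t (suc (p ℕ.+ j)))
          ≈⟨ +-cong half-period (∑-0 p λ j j<p → trans
               (*-congʳ (*-congˡ (*-congʳ (u-zero-tail j (ℕₚ.+-monoʳ-< p j<p)))))
               (solve 3 (λ Q p x → Q :* (:0 :* p) :* x := :0) _ _ _)) ⟩
        0# + 0#                                            ≈⟨ +-identityʳ 0# ⟩
        0#                                                 ∎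

      module Shifted (s : ℕ) (q^s≈1 : q ^ s ≈ 1#) where
        ^-shift : ∀ j → q ^ (s ℕ.+ j) ≈ q ^ j
        ^-shift j = trans (^-homo-* q s j) (trans (*-congʳ q^s≈1) (*-identityˡ _))

        -- The inverses are given as arbitrary families; they are periodic because inverses are
        -- unique.
        inv-shift : ∀ (F : Carrier → Carrier) (i : ℕ → Carrier) → (∀ {x y} → x ≈ y → F x ≈ F y) →
          (∀ j → V j → F (q ^ j) * i j ≈ 1#) → ∀ j → i (s ℕ.+ j) ≈ i j
        inv-shift F i F-cong inv j = unit-cancel _ _ (i j , inv j (V-all j))
          (trans (*-congʳ (F-cong (sym (^-shift j)))) (trans (inv (s ℕ.+ j) (V-all _)) (sym (inv j (V-all j)))))

        r-shift : ∀ j → r (s ℕ.+ j) ≈ r j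
        r-shift j = *-cong
          (*-cong (*-cong (*-cong (*-cong (quad (a * q)) (quad (q * a⁻¹))) (lin (q * b⁻¹))) (lin (q * c⁻¹))) (lin (b * c)))
          (*-cong (*-cong (*-cong (*-cong
            (inv-shift (λ x → 1# - a * q * x) i₁ (λ e → +-congˡ (-‿cong (*-congˡ e))) i₁-inv j)
            (inv-shift (λ x → 1# - q * a⁻¹ * x) i₂ (λ e → +-congˡ (-‿cong (*-congˡ e))) i₂-inv j))
            (inv-shift (λ x → 1# - b * (q * q) * (x * x)) i₃ (λ e → +-congˡ (-‿cong (*-congˡ (*-cong e e)))) i₃-inv j))
            (inv-shift (λ x → 1# - c * (q * q) * (x * x)) i₄ (λ e → +-congˡ (-‿cong (*-congˡ (*-cong e e)))) i₄-inv j))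
            (inv-shift (λ x → 1# - q * q * q * (b⁻¹ * c⁻¹) * (x * x)) i₅ (λ e → +-congˡ (-‿cong (*-congˡ (*-cong e e)))) i₅-inv j))
          where
          lin : ∀ y → 1# - y * q ^ (s ℕ.+ j) ≈ 1# - y * q ^ j
          lin y = +-congˡ (-‿cong (*-congˡ (^-shift j)))
          quad : ∀ y → 1# - y * (q ^ (s ℕ.+ j) * q ^ (s ℕ.+ j)) ≈ 1# - y * (q ^ j * q ^ j)
          quad y = +-congˡ (-‿cong (*-congˡ (*-cong (^-shift j) (^-shift j))))

        ∏r-shift : ∀ k → ∏ (s ℕ.+ k) r ≈ ∏ s r * ∏ k r
        ∏r-shift zero    = trans (reflexive (≡.cong (λ i → ∏ i r) (ℕₚ.+-identityʳ s))) (sym (*-identityʳ _))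
        ∏r-shift (suc k) = begin
          ∏ (s ℕ.+ suc k) r              ≡⟨ ≡.cong (λ i → ∏ i r) (ℕₚ.+-suc s k) ⟩
          ∏ (s ℕ.+ k) r * r (s ℕ.+ k)    ≈⟨ *-cong (∏r-shift k) (r-shift k) ⟩
          ∏ s r * ∏ k r * r k            ≈⟨ *-assoc _ _ _ ⟩
          ∏ s r * ∏ (suc k) r            ∎

        -- `u` need not be periodic: at the end of a period its recurrence does not determine the
        -- next value. Within a period the recurrence is that of the first one, started at u s
        -- instead of 1.
        u-shift : ∀ k → k ℕ.< o → u (s ℕ.+ k) ≈ u s * u k
        u-shift zero    _   = trans (reflexive (≡.cong u (ℕₚ.+-identityʳ s)))
          (sym (trans (*-congˡ u-zero) (*-identityʳ _)))
        u-shift (suc k) k<o = unit-cancel _ _ (q-units k (ℕ.s≤s⁻¹ k<o)) (begin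
          (1# - q * q ^ k) * u (s ℕ.+ suc k)
            ≈⟨ *-cong (+-congˡ (-‿cong (*-congˡ (sym (^-shift k))))) (reflexive (≡.cong u (ℕₚ.+-suc s k))) ⟩
          (1# - q * q ^ (s ℕ.+ k)) * u (suc (s ℕ.+ k))
            ≈⟨ u-suc (s ℕ.+ k) ⟩
          (1# - q * (q ^ (s ℕ.+ k) * q ^ (s ℕ.+ k))) * u (s ℕ.+ k)
            ≈⟨ *-cong (+-congˡ (-‿cong (*-congˡ (*-cong (^-shift k) (^-shift k))))) (u-shift k (ℕₚ.<⇒≤ k<o)) ⟩
          (1# - q * (q ^ k * q ^ k)) * (u s * u k)
            ≈⟨ solve 3 (λ f s k → f :* (s :* k) := s :* (f :* k)) (1# - q * (q ^ k * q ^ k)) (u s) (u k) ⟩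
          u s * ((1# - q * (q ^ k * q ^ k)) * u k)
            ≈⟨ *-congˡ (u-suc k) ⟨
          u s * ((1# - q * q ^ k) * u (suc k))
            ≈⟨ solve 3 (λ f s k → s :* (f :* k) := f :* (s :* k)) (1# - q * q ^ k) (u s) (u (suc k)) ⟩
          (1# - q * q ^ k) * (u s * u (suc k)) ∎)

        Q-shift : ∀ k → Q (s ℕ.+ k) ≈ Q k
        Q-shift k = unit-cancel _ _ q-unit (trans (Q-eq (s ℕ.+ k)) (trans
          (+-congˡ (-‿cong (*-congˡ (*-cong (*-cong (^-shift k) (^-shift k)) (^-shift k))))) (sym (Q-eq k))))

        t-shift : ∀ k → k ℕ.< o → t (s ℕ.+ k) ≈ u s * ∏ s r * t k
        t-shift k k<o = begin
          Q (s ℕ.+ k) * (u (s ℕ.+ k) * ∏ (s ℕ.+ k) r) * q ^ (s ℕ.+ k)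
            ≈⟨ *-cong (*-cong (Q-shift k) (*-cong (u-shift k k<o) (∏r-shift k))) (^-shift k) ⟩
          Q k * (u s * u k * (∏ s r * ∏ k r)) * q ^ k
            ≈⟨ solve 6 (λ Q us uk ps pk x → Q :* (us :* uk :* (ps :* pk)) :* x := us :* ps :* (Q :* (uk :* pk) :* x))
                 (Q k) (u s) (u k) (∏ s r) (∏ k r) (q ^ k) ⟩
          u s * ∏ s r * t k ∎

        extend : ∀ l → l ℕ.≤ o → ∑ s t ≈ 0# → ∑ l t ≈ 0# → ∑ (s ℕ.+ l) t ≈ 0#
        extend l l≤o e₁ e₂ = begin
          ∑ (s ℕ.+ l) t                               ≈⟨ ∑-++ s l t ⟩
          ∑ s t + ∑ l (λ j → t (s ℕ.+ j))             ≈⟨ +-cong e₁ (∑-cong l λ j j<l → t-shift j (ℕₚ.≤-trans j<l l≤o)) ⟩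
          0# + ∑ l (λ j → u s * ∏ s r * t j)          ≈⟨ +-identityˡ _ ⟩
          ∑ l (λ j → u s * ∏ s r * t j)               ≈⟨ ∑-*ˡ l _ t ⟩
          u s * ∏ s r * ∑ l t                         ≈⟨ *-congˡ e₂ ⟩
          u s * ∏ s r * 0#                            ≈⟨ zeroʳ _ ⟩
          0#                                          ∎

      q^eo≈1 : ∀ e → q ^ (e ℕ.* o) ≈ 1#
      q^eo≈1 zero    = refl
      q^eo≈1 (suc e) = trans (^-homo-* q o (e ℕ.* o)) (trans (*-cong q^o≈1 (q^eo≈1 e)) (*-identityʳ 1#))

      periods : ∀ e → ∑ (e ℕ.* o) t ≈ 0#
      periods zero    = refl
      periods (suc e) = trans (reflexive (≡.cong (λ i → ∑ i t) (ℕₚ.+-comm o (e ℕ.* o))))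
        (Shifted.extend (e ℕ.* o) (q^eo≈1 e) o ℕₚ.≤-refl (periods e) period)

      half-periods : ∀ e → ∑ (e ℕ.* o ℕ.+ suc p) t ≈ 0#
      half-periods e = Shifted.extend (e ℕ.* o) (q^eo≈1 e) (suc p) (s≤s (ℕₚ.m≤m+n p p)) (periods e) half-period

-- Elementary identities in commutative rings

module PowerDivisibility {c ℓ} (R : CommutativeRing c ℓ) where
  open CommutativeRing R hiding (zero)
  open Exp semiring using (_^_; ^-homo-*; ^-assocʳ)
  open Solver R
  open Divisibility R
  open SetoidReasoning setoid

  1-x∣1-x^k : ∀ x k → 1# - x ∣ 1# - x ^ k
  1-x∣1-x^k x zero    = ∣-respʳ (sym (-‿inverseʳ 1#)) ∣-0
  1-x∣1-x^k x (suc k) = ∣-respʳ (solve 2 (λ x y → (:1 :- x) :+ x :* (:1 :- y) := :1 :- x :* y) x (x ^ k))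
    (∣-+ ∣-refl (∣-*ˡ x (1-x∣1-x^k x k)))

  1+x∣1+x^odd : ∀ x p → 1# + x ∣ 1# + x ^ suc (p ℕ.+ p)
  1+x∣1+x^odd x zero    = ∣-respʳ (+-congˡ (sym (*-identityʳ x))) ∣-refl
  1+x∣1+x^odd x (suc p) = ∣-respʳ (begin
      (1# + x) * (1# - x) + x * x * (1# + x ^ suc (p ℕ.+ p))
        ≈⟨ solve 2 (λ x y → (:1 :+ x) :* (:1 :- x) :+ x :* x :* (:1 :+ x :* y) := :1 :+ x :* (x :* (x :* y))) x (x ^ (p ℕ.+ p)) ⟩
      1# + x ^ suc (suc (suc (p ℕ.+ p)))
        ≡⟨ ≡.cong (λ k → 1# + x ^ suc (suc k)) (ℕₚ.+-suc p p) ⟨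
      1# + x ^ suc (suc p ℕ.+ suc p) ∎)
    (∣-+ (∣-*ʳ (1# - x) ∣-refl) (∣-*ˡ (x * x) (1+x∣1+x^odd x p)))

  -- Modulo t, the power (q^k)^o with o = 2p + 1 is -1, because q^k = -1 and o is odd, and also 1,
  -- because q^o = 1. This is where the oddness of n enters the treatment of (-q;q)ₖ.
  divides-two : ∀ {t} q k p → t ∣ 1# + q ^ k → t ∣ 1# - q ^ suc (p ℕ.+ p) → t ∣ 1# + 1#
  divides-two {t} q k p d e = ∣-respʳ (solve 1 (λ y → (:1 :+ y) :+ (:1 :- y) := :1 :+ :1) ((q ^ k) ^ suc (p ℕ.+ p)))
    (∣-+ (∣-trans d (1+x∣1+x^odd (q ^ k) p)) (∣-respʳ (+-congˡ (-‿cong powers)) (∣-trans e (1-x∣1-x^k (q ^ suc (p ℕ.+ p)) k))))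
    where
    o : ℕ
    o = suc (p ℕ.+ p)
    powers : (q ^ o) ^ k ≈ (q ^ k) ^ o
    powers = begin
      (q ^ o) ^ k      ≈⟨ ^-assocʳ q o k ⟩
      q ^ (o ℕ.* k)    ≡⟨ ≡.cong (q ^_) (ℕₚ.*-comm o k) ⟩
      q ^ (k ℕ.* o)    ≈⟨ ^-assocʳ q k o ⟨
      (q ^ k) ^ o      ∎

  -- This and the next two lemmas eliminate a between two linear factors, leaving a polynomial in q
  -- alone.
  eliminate₁ : ∀ {t} a q k l → t ∣ 1# - a * q ^ (k ℕ.+ l) → t ∣ 1# - a * q ^ l → t ∣ 1# - q ^ k
  eliminate₁ a q k l d e = ∣-respʳ (begin
    (1# - a * q ^ (k ℕ.+ l)) - q ^ k * (1# - a * q ^ l)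
      ≈⟨ +-congʳ (+-congˡ (-‿cong (*-congˡ (^-homo-* q k l)))) ⟩
    (1# - a * (q ^ k * q ^ l)) - q ^ k * (1# - a * q ^ l)
      ≈⟨ solve 3 (λ a x y → (:1 :- a :* (x :* y)) :- x :* (:1 :- a :* y) := :1 :- x) a (q ^ k) (q ^ l) ⟩
    1# - q ^ k ∎) (∣-minus d (∣-*ˡ (q ^ k) e))

  eliminate₂ : ∀ {t} a q k l → t ∣ 1# - a * q ^ k → t ∣ a - q ^ l → t ∣ 1# - q ^ (k ℕ.+ l)
  eliminate₂ a q k l d e = ∣-respʳ (begin
    (1# - a * q ^ k) + q ^ k * (a - q ^ l)
      ≈⟨ solve 3 (λ a x y → (:1 :- a :* x) :+ x :* (a :- y) := :1 :- x :* y) a (q ^ k) (q ^ l) ⟩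
    1# - q ^ k * q ^ l      ≈⟨ +-congˡ (-‿cong (^-homo-* q k l)) ⟨
    1# - q ^ (k ℕ.+ l)      ∎) (∣-+ d (∣-*ˡ (q ^ k) e))

  eliminate₃ : ∀ {t} a q k l → t ∣ a - q ^ (k ℕ.+ l) → t ∣ a - q ^ l → t ∣ q ^ l * (1# - q ^ k)
  eliminate₃ a q k l d e = ∣-respʳ (begin
    (a - q ^ (k ℕ.+ l)) - (a - q ^ l)
      ≈⟨ +-congʳ (+-congˡ (-‿cong (^-homo-* q k l))) ⟩
    (a - q ^ k * q ^ l) - (a - q ^ l)
      ≈⟨ solve 3 (λ a x y → (a :- x :* y) :- (a :- y) := y :* (:1 :- x)) a (q ^ k) (q ^ l) ⟩
    q ^ l * (1# - q ^ k) ∎) (∣-minus d e)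

  divides-1 : ∀ t x y → t ∣ 1# - x * y → t ∣ x → t ∣ 1#
  divides-1 t x y d e = ∣-respʳ (solve 2 (λ x y → (:1 :- x :* y) :+ x :* y := :1) x y) (∣-+ d (∣-*ʳ y e))

  divides-y : ∀ t x y → t ∣ x - y → t ∣ x → t ∣ y
  divides-y t x y d e = ∣-respʳ (solve 2 (λ x y → x :- (x :- y) := y) x y) (∣-minus e d)

module Rearrangements {c ℓ} (R : CommutativeRing c ℓ) where
  open CommutativeRing R hiding (zero)
  open Exp semiring using (_^_; ^-homo-*)
  open Solver R
  open SetoidReasoning setoid

  square-^ : ∀ q j → (q ^ 2) ^ j ≈ q ^ j * q ^ j
  square-^ q zero    = sym (*-identityʳ 1#)
  square-^ q (suc j) = trans (*-congˡ (square-^ q j))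
    (solve 2 (λ q x → q :* (q :* :1) :* (x :* x) := q :* x :* (q :* x)) q (q ^ j))

  1-a·qx : ∀ a q x → 1# - a * (q * x) ≈ 1# - a * q * x
  1-a·qx = solve 3 λ a q x → :1 :- a :* (q :* x) := :1 :- a :* q :* x

  a-qx : ∀ a a⁻¹ q x → a * a⁻¹ ≈ 1# → a - q * x ≈ a * (1# - q * a⁻¹ * x)
  a-qx a a⁻¹ q x h = begin
    a - q * x                  ≈⟨ +-congˡ (-‿cong (trans (*-congʳ h) (*-identityˡ _))) ⟨
    a - a * a⁻¹ * (q * x)      ≈⟨ solve 4 (λ a a′ q x → a :- a :* a′ :* (q :* x) := a :* (:1 :- q :* a′ :* x)) a a⁻¹ q x ⟩
    a * (1# - q * a⁻¹ * x)     ∎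

  1-b·qqxx : ∀ b q j → 1# - b * (q * (q * q ^ (j ℕ.+ j))) ≈ 1# - b * (q * q) * (q ^ j * q ^ j)
  1-b·qqxx b q j = trans (+-congˡ (-‿cong (*-congˡ (*-congˡ (*-congˡ (^-homo-* q j j))))))
    (solve 3 (λ b q x → :1 :- b :* (q :* (q :* (x :* x))) := :1 :- b :* (q :* q) :* (x :* x)) b q (q ^ j))

  bc-qqqxx : ∀ b b⁻¹ c c⁻¹ q j → b * b⁻¹ ≈ 1# → c * c⁻¹ ≈ 1# →
    b * c - q * (q * (q * q ^ (j ℕ.+ j))) ≈ b * c * (1# - q * q * q * (b⁻¹ * c⁻¹) * (q ^ j * q ^ j))
  bc-qqqxx b b⁻¹ c c⁻¹ q j h k = begin
    b * c - q * (q * (q * q ^ (j ℕ.+ j)))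
      ≈⟨ +-congˡ (-‿cong (*-congˡ (*-congˡ (*-congˡ (^-homo-* q j j))))) ⟩
    b * c - q * (q * (q * (x * x)))
      ≈⟨ +-congˡ (-‿cong (trans (*-congʳ (*-cong h k)) (solve 1 (λ y → :1 :* :1 :* y := y) _))) ⟨
    b * c - b * b⁻¹ * (c * c⁻¹) * (q * (q * (q * (x * x))))
      ≈⟨ solve 6 (λ b b′ c c′ q x → b :* c :- b :* b′ :* (c :* c′) :* (q :* (q :* (q :* (x :* x))))
           := b :* c :* (:1 :- q :* q :* q :* (b′ :* c′) :* (x :* x))) b b⁻¹ c c⁻¹ q x ⟩
    b * c * (1# - q * q * q * (b⁻¹ * c⁻¹) * (x * x)) ∎
    where
    x : Carrier
    x = q ^ j

  q²≈ : ∀ q → q ^ 2 ≈ q * q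
  q²≈ = solve 1 λ q → q :* (q :* :1) := q :* q

  q³≈ : ∀ q → q ^ 3 ≈ q * q * q
  q³≈ = solve 1 λ q → q :* (q :* (q :* :1)) := q :* q :* q

  q-triple : ∀ q k → 1# - q ^ (3 ℕ.* k ℕ.+ 1) ≈ 1# - q * (q ^ k * q ^ k * q ^ k)
  q-triple q k = +-congˡ (-‿cong (begin
    q ^ (k ℕ.+ (k ℕ.+ (k ℕ.+ 0)) ℕ.+ 1)
      ≈⟨ trans (^-homo-* q (k ℕ.+ (k ℕ.+ (k ℕ.+ 0))) 1) (*-congʳ (trans (^-homo-* q k _)
           (*-congˡ (trans (^-homo-* q k _) (*-congˡ (^-homo-* q k 0)))))) ⟩
    q ^ k * (q ^ k * (q ^ k * 1#)) * (q * 1#)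
      ≈⟨ solve 2 (λ q x → x :* (x :* (x :* :1)) :* (q :* :1) := q :* (x :* x :* x)) q (q ^ k) ⟩
    q * (q ^ k * q ^ k * q ^ k) ∎))

  geometric-step : ∀ q s x → (1# - q) * s ≈ 1# - x → (1# - q) * (s + x) ≈ 1# - q * x
  geometric-step q s x h = begin
    (1# - q) * (s + x)            ≈⟨ distribˡ _ s x ⟩
    (1# - q) * s + (1# - q) * x   ≈⟨ +-congʳ h ⟩
    1# - x + (1# - q) * x         ≈⟨ solve 2 (λ q x → :1 :- x :+ (:1 :- q) :* x := :1 :- q :* x) q x ⟩
    1# - q * x                    ∎

module ProductInverse {c ℓ} (R : CommutativeRing c ℓ) where
  open CommutativeRing R
  open Solver R

  product-inverse₆ : ∀ {x₁ x₂ x₃ x₄ x₅ x₆ i₁ i₂ i₃ i₄ i₅ i₆} →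
    x₁ * i₁ ≈ 1# → x₂ * i₂ ≈ 1# → x₃ * i₃ ≈ 1# → x₄ * i₄ ≈ 1# → x₅ * i₅ ≈ 1# → x₆ * i₆ ≈ 1# →
    x₁ * x₂ * x₃ * x₄ * x₅ * x₆ * (i₁ * i₂ * i₃ * i₄ * i₅ * i₆) ≈ 1#
  product-inverse₆ h₁ h₂ h₃ h₄ h₅ h₆ = trans
    (solve 12 (λ x₁ x₂ x₃ x₄ x₅ x₆ i₁ i₂ i₃ i₄ i₅ i₆ →
      x₁ :* x₂ :* x₃ :* x₄ :* x₅ :* x₆ :* (i₁ :* i₂ :* i₃ :* i₄ :* i₅ :* i₆)
      := (x₁ :* i₁) :* (x₂ :* i₂) :* (x₃ :* i₃) :* (x₄ :* i₄) :* (x₅ :* i₅) :* (x₆ :* i₆)) _ _ _ _ _ _ _ _ _ _ _ _)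
    (trans (*-cong (*-cong (*-cong (*-cong (*-cong h₁ h₂) h₃) h₄) h₅) h₆)
      (solve 0 (:1 :* :1 :* :1 :* :1 :* :1 :* :1 := :1)))

  product-inverse₃ : ∀ {x₁ x₂ x₃ i₁ i₂ i₃} → x₁ * i₁ ≈ 1# → x₂ * i₂ ≈ 1# → x₃ * i₃ ≈ 1# →
    x₁ * x₂ * x₃ * (i₁ * i₂ * i₃) ≈ 1#
  product-inverse₃ h₁ h₂ h₃ = trans
    (solve 6 (λ x₁ x₂ x₃ i₁ i₂ i₃ → x₁ :* x₂ :* x₃ :* (i₁ :* i₂ :* i₃) := (x₁ :* i₁) :* (x₂ :* i₂) :* (x₃ :* i₃)) _ _ _ _ _ _)
    (trans (*-cong (*-cong h₁ h₂) h₃) (solve 0 (:1 :* :1 :* :1 := :1)))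

  product-inverse₂ : ∀ {x₁ x₂ i₁ i₂} → x₁ * i₁ ≈ 1# → x₂ * i₂ ≈ 1# → x₁ * x₂ * (i₁ * i₂) ≈ 1#
  product-inverse₂ h₁ h₂ = trans
    (solve 4 (λ x₁ x₂ i₁ i₂ → x₁ :* x₂ :* (i₁ :* i₂) := (x₁ :* i₁) :* (x₂ :* i₂)) _ _ _ _)
    (trans (*-cong h₁ h₂) (*-identityʳ 1#))

  product-zero : ∀ {X Q i} → Q ≈ 0# → X * i * Q ≈ 0#
  product-zero {X} {Q} {i} h = trans (*-congˡ h) (zeroʳ (X * i))

  regroup-summand : ∀ Q n₁ n₂ w n₄ n₅ n₆ i₁ i₂ i₆ i₃ i₄ i₅ x →
    Q * (n₁ * n₂ * w * n₄ * n₅ * n₆ * (i₁ * i₂ * i₆ * i₃ * i₄ * i₅)) * x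
    ≈ Q * (w * i₆ * (n₁ * n₂ * n₄ * n₅ * n₆ * (i₁ * i₂ * i₃ * i₄ * i₅))) * x
  regroup-summand = solve 14 λ Q n₁ n₂ w n₄ n₅ n₆ i₁ i₂ i₆ i₃ i₄ i₅ x →
    Q :* (n₁ :* n₂ :* w :* n₄ :* n₅ :* n₆ :* (i₁ :* i₂ :* i₆ :* i₃ :* i₄ :* i₅)) :* x
    := Q :* (w :* i₆ :* (n₁ :* n₂ :* n₄ :* n₅ :* n₆ :* (i₁ :* i₂ :* i₃ :* i₄ :* i₅))) :* x

  u-step : ∀ {Q x i} w′ w I → Q * w′ ≈ x * (1# + i) * w → ∀ j → (1# + i) * j ≈ 1# →
    Q * (w′ * (I * j)) ≈ x * (w * I)
  u-step {Q} {x} {i} w′ w I h j k = trans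
    (solve 4 (λ Q w I j → Q :* (w :* (I :* j)) := Q :* w :* (I :* j)) Q w′ I j)
    (trans (*-congʳ h) (trans
      (solve 5 (λ x i w I j → x :* (:1 :+ i) :* w :* (I :* j) := x :* (w :* I) :* ((:1 :+ i) :* j)) x i w I j)
      (trans (*-congˡ k) (*-identityʳ _))))

  divide-product : ∀ {S Y X Q i} → S * Y ≈ Q * X → Y * i ≈ 1# → S ≈ X * i * Q
  divide-product {S} {Y} {X} {Q} {i} h k = trans (sym (*-identityʳ S)) (trans (*-congˡ (sym k)) (trans
    (solve 3 (λ S Y i → S :* (Y :* i) := S :* Y :* i) S Y i) (trans (*-congʳ h)
    (solve 3 (λ Q X i → Q :* X :* i := X :* i :* Q) Q X i))))

module FinalRearrangements {c ℓ} (R : CommutativeRing c ℓ) where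
  open CommutativeRing R
  open Solver R
  open Divisibility R
  open SetoidReasoning setoid

  difference-step : ∀ s y z → (s + y) - (1# + z) ≈ (s - z) - (1# - y)
  difference-step = solve 3 λ s y z → (s :+ y) :- (:1 :+ z) := (s :- z) :- (:1 :- y)

  ∣-difference : ∀ {t} s z → t ∣ s - z → t ∣ s → t ∣ z
  ∣-difference s z d e = ∣-respʳ (solve 2 (λ s z → s :- (s :- z) := z) s z) (∣-minus e d)

  module _ (cancel : ∀ {g x y} → g ≉ 0# → g * x ≈ g * y → x ≈ y) where

    -- If n/d = fz/y and x′/y′ is n/d with the factor g removed, then y x′ = f z y′; for y regular
    -- modulo f this gives f ∣ x′.
    reduced-∣ : ∀ {f n d y z g x′ y′} → g ≉ 0# → n * y ≈ f * z * d → n ≈ g * x′ → d ≈ g * y′ → f ∣ y * x′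
    reduced-∣ {f} {n} {d} {y} {z} {g} {x′} {y′} g≉0 h n≈ d≈ = z * y′ , cancel g≉0 (begin
      g * (y * x′)          ≈⟨ solve 3 (λ g y x → g :* (y :* x) := g :* x :* y) g y x′ ⟩
      g * x′ * y            ≈⟨ *-congʳ n≈ ⟨
      n * y                 ≈⟨ h ⟩
      f * z * d             ≈⟨ *-congˡ d≈ ⟩
      f * z * (g * y′)      ≈⟨ solve 4 (λ f z g y → f :* z :* (g :* y) := g :* (f :* (z :* y))) f z g y′ ⟩
      g * (f * (z * y′))    ∎)

  reduced-cross : ∀ {n d g x′ y′} p → n ≈ g * x′ → d ≈ g * y′ → x′ ≈ p → n * y′ ≈ p * d
  reduced-cross {n} {d} {g} {x′} {y′} p n≈ d≈ x′≈ = begin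
    n * y′            ≈⟨ *-congʳ n≈ ⟩
    g * x′ * y′       ≈⟨ solve 3 (λ g x y → g :* x :* y := x :* (g :* y)) g x′ y′ ⟩
    x′ * (g * y′)     ≈⟨ *-cong x′≈ (sym d≈) ⟩
    p * d             ∎

-- Derivatives, and the splitting of [n]

-- The derivative with respect to the outermost variable.
module Derivative (n : ℕ) where
  open ListMul n (mulLaws n)
  open SetoidReasoning (polySetoid (suc n))

  ∂ : Poly (suc n) → Poly (suc n)
  ∂ []      = []
  ∂ (x ∷ p) = p +P shift (∂ p)

  ∂-zero : ∀ p → p ≋ [] → ∂ p ≋ []
  ∂-zero []      e = ≋-refl
  ∂-zero (x ∷ p) e = +P-cong (tail-zero e) (∷-zero ≋-refl (∂-zero p (tail-zero e)))

  ∂-cong : ∀ p r → p ≋ r → ∂ p ≋ ∂ r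
  ∂-cong []      r       e = ≋-sym (∂-zero r (≋-sym e))
  ∂-cong (x ∷ p) []      e = ∂-zero (x ∷ p) e
  ∂-cong (x ∷ p) (y ∷ r) e = +P-cong (tail-≋ e) (shift-cong (∂-cong p r (tail-≋ e)))

  ∂-+ : ∀ p r → ∂ (p +P r) ≋ ∂ p +P ∂ r
  ∂-+ []      r       = ≋-refl
  ∂-+ (x ∷ p) []      = ≋-sym (+P-identityʳ (∂ (x ∷ p)))
  ∂-+ (x ∷ p) (y ∷ r) = begin
    (p +P r) +P shift (∂ (p +P r))              ≈⟨ +P-congˡ (p +P r) (≋-trans (shift-cong (∂-+ p r)) (shift-+ (∂ p) (∂ r))) ⟩
    (p +P r) +P (shift (∂ p) +P shift (∂ r))    ≈⟨ +P-interchange p r (shift (∂ p)) (shift (∂ r)) ⟩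
    ∂ (x ∷ p) +P ∂ (y ∷ r)                      ∎

  ∂-smul : ∀ x p → ∂ (smul x p) ≋ smul x (∂ p)
  ∂-smul x []      = ≋-refl
  ∂-smul x (y ∷ p) = begin
    smul x p +P shift (∂ (smul x p))    ≈⟨ +P-congˡ (smul x p) (≋-trans (shift-cong (∂-smul x p)) (≋-sym (smul-shift x (∂ p)))) ⟩
    smul x p +P smul x (shift (∂ p))    ≈⟨ smul-+ʳ x p (shift (∂ p)) ⟨
    smul x (∂ (y ∷ p))                  ∎

  ∂-* : ∀ p r → ∂ (p *P r) ≋ (∂ p *P r) +P (p *P ∂ r)
  ∂-* []      r = ≋-refl
  ∂-* (x ∷ p) r = begin
    ∂ (smul x r +P shift (p *P r))
      ≈⟨ ∂-+ (smul x r) (shift (p *P r)) ⟩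
    ∂ (smul x r) +P ((p *P r) +P shift (∂ (p *P r)))
      ≈⟨ +P-cong (∂-smul x r) (+P-congˡ (p *P r) (≋-trans (shift-cong (∂-* p r)) (shift-+ (∂ p *P r) (p *P ∂ r)))) ⟩
    smul x (∂ r) +P ((p *P r) +P (shift (∂ p *P r) +P shift (p *P ∂ r)))
      ≈⟨ +P-congˡ (smul x (∂ r)) (+P-assoc (p *P r) (shift (∂ p *P r)) (shift (p *P ∂ r))) ⟨
    smul x (∂ r) +P (((p *P r) +P shift (∂ p *P r)) +P shift (p *P ∂ r))
      ≈⟨ +P-comm (smul x (∂ r)) (((p *P r) +P shift (∂ p *P r)) +P shift (p *P ∂ r)) ⟩
    (((p *P r) +P shift (∂ p *P r)) +P shift (p *P ∂ r)) +P smul x (∂ r)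
      ≈⟨ +P-assoc ((p *P r) +P shift (∂ p *P r)) (shift (p *P ∂ r)) (smul x (∂ r)) ⟩
    ((p *P r) +P shift (∂ p *P r)) +P (shift (p *P ∂ r) +P smul x (∂ r))
      ≈⟨ +P-cong (≋-sym (≋-trans (mul-distribʳ r p (shift (∂ p))) (+P-congˡ (p *P r) (shift-mul (∂ p) r))))
           (+P-comm (shift (p *P ∂ r)) (smul x (∂ r))) ⟩
    (∂ (x ∷ p) *P r) +P ((x ∷ p) *P ∂ r) ∎

record IsDerivation {c ℓ} (R : CommutativeRing c ℓ)
  (∂ : CommutativeRing.Carrier R → CommutativeRing.Carrier R) : Set (c ⊔ ℓ) where
  open CommutativeRing R
  field
    ∂-cong : ∀ x y → x ≈ y → ∂ x ≈ ∂ y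
    ∂-+    : ∀ x y → ∂ (x + y) ≈ ∂ x + ∂ y
    ∂-*    : ∀ x y → ∂ (x * y) ≈ ∂ x * y + x * ∂ y
    ∂-1    : ∂ 1# ≈ 0#

module Derivation {c ℓ} (R : CommutativeRing c ℓ) (∂ : CommutativeRing.Carrier R → CommutativeRing.Carrier R)
  (isDerivation : IsDerivation R ∂) where
  open CommutativeRing R hiding (zero)
  open IsDerivation isDerivation
  open Solver R
  open Evaluation R using (fromℤ)
  open Divisibility R
  open Exp semiring using (_^_)
  open SetoidReasoning setoid

  ∂-square : ∀ t r → t ∣ ∂ (t * t * r)
  ∂-square t r = (∂ t * r + ∂ t * r + t * ∂ r) , (begin
    ∂ (t * t * r)                                      ≈⟨ ∂-* (t * t) r ⟩
    ∂ (t * t) * r + t * t * ∂ r                        ≈⟨ +-congʳ (*-congʳ (∂-* t t)) ⟩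
    (∂ t * t + t * ∂ t) * r + t * t * ∂ r
      ≈⟨ solve 4 (λ t t′ r r′ → (t′ :* t :+ t :* t′) :* r :+ t :* t :* r′ := t :* (t′ :* r :+ t′ :* r :+ t :* r′)) t (∂ t) r (∂ r) ⟩
    t * (∂ t * r + ∂ t * r + t * ∂ r)                  ∎)

  ∂-^ : ∀ q → ∂ q ≈ 1# → ∀ k → ∂ (q ^ k) * q ≈ fromℤ (+ k) * q ^ k
  ∂-^ q ∂q zero    = trans (*-congʳ ∂-1) (trans (zeroˡ q) (sym (zeroˡ 1#)))
  ∂-^ q ∂q (suc k) = begin
    ∂ (q * q ^ k) * q                        ≈⟨ *-congʳ (∂-* q (q ^ k)) ⟩
    (∂ q * q ^ k + q * ∂ (q ^ k)) * q        ≈⟨ *-congʳ (+-congʳ (*-congʳ ∂q)) ⟩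
    (1# * q ^ k + q * ∂ (q ^ k)) * q
      ≈⟨ solve 3 (λ q x y → (:1 :* x :+ q :* y) :* q := q :* x :+ q :* (y :* q)) q (q ^ k) (∂ (q ^ k)) ⟩
    q * q ^ k + q * (∂ (q ^ k) * q)          ≈⟨ +-congˡ (*-congˡ (∂-^ q ∂q k)) ⟩
    q * q ^ k + q * (fromℤ (+ k) * q ^ k)
      ≈⟨ solve 3 (λ q x k → q :* x :+ q :* (k :* x) := (:1 :+ k) :* (q :* x)) q (q ^ k) (fromℤ (+ k)) ⟩
    (1# + fromℤ (+ k)) * (q * q ^ k)         ∎

  -- t divides both 1 - q^k and its derivative, hence also q ∂(q^k) = k q^k, and therefore k = k q^k
  -- + k (1 - q^k).
  square-divisor : ∀ q → ∂ q ≈ 1# → ∀ k t → t * t ∣ 1# - q ^ k → t ∣ fromℤ (+ k)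
  square-divisor q ∂q k t (r , e) = ∣-respʳ
    (solve 2 (λ k x → k :* x :+ k :* (:1 :- x) := k) (fromℤ (+ k)) (q ^ k))
    (∣-+ (∣-respʳ (∂-^ q ∂q k) (∣-*ʳ q t∣∂)) (∣-*ˡ (fromℤ (+ k)) (t * r , trans e (*-assoc t t r))))
    where
    t∣∂ : t ∣ ∂ (q ^ k)
    t∣∂ = ∣-cancel-+ (∣-respʳ (begin
      0#                          ≈⟨ ∂-1 ⟨
      ∂ 1#                        ≈⟨ ∂-cong 1# (t * t * r + q ^ k) (trans (solve 1 (λ x → :1 := (:1 :- x) :+ x) (q ^ k)) (+-congʳ e)) ⟩
      ∂ (t * t * r + q ^ k)       ≈⟨ ∂-+ (t * t * r) (q ^ k) ⟩
      ∂ (t * t * r) + ∂ (q ^ k)   ∎) ∣-0) (∂-square t r)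

-- Divisibility by [n] follows from divisibility by the parts of [n] that divide 1 - q^d
-- and are prime to 1 - q^j for j < d; they are split off in increasing order of d.
module _ {c ℓ} (R : CommutativeRing c ℓ) (q : CommutativeRing.Carrier R) where
  open CommutativeRing R
  open Divisibility R
  open Exp semiring using (_^_)

  Squarefree : Set (c ⊔ ℓ)
  Squarefree = ∀ n t → t * t ∣ 1# - q ^ suc n → t ∣ 1#

module Splitting {c ℓ} {R : CommutativeRing c ℓ} (D : IsGCDDomain R) (q : CommutativeRing.Carrier R)
  (squarefree : Squarefree R q) where
  open CommutativeRing R hiding (zero)
  open Divisibility R
  open GCDDomain D
  open IsGCDDomain D using (gcd)
  open PowerDivisibility R using (1-x∣1-x^k)
  open Exp semiring using (_^_; ^-homo-*; ^-assocʳ)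
  open Solver R
  open SetoidReasoning setoid

  coprime-^ : ∀ {g x} k → Coprime g x → Coprime g (x ^ k)
  coprime-^ zero    cop h h∣g h∣1 = h∣1
  coprime-^ (suc k) cop = coprime-* cop (coprime-^ k cop)

  module _ {g : Carrier} (cop : Coprime g q) where

    subtract : ∀ i k → g ∣ 1# - q ^ (k ℕ.+ i) → g ∣ 1# - q ^ i → g ∣ 1# - q ^ k
    subtract i k d e = coprime-∣ (1# - q ^ k) (coprime-^ i cop) (∣-respʳ (begin
      (1# - q ^ (k ℕ.+ i)) - (1# - q ^ i)      ≈⟨ +-congʳ (+-congˡ (-‿cong (^-homo-* q k i))) ⟩
      (1# - q ^ k * q ^ i) - (1# - q ^ i)
        ≈⟨ solve 2 (λ x y → (:1 :- x :* y) :- (:1 :- y) := y :* (:1 :- x)) (q ^ k) (q ^ i) ⟩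
      q ^ i * (1# - q ^ k)                     ∎) (∣-minus d e))

    multiple : ∀ x m → g ∣ 1# - q ^ m → g ∣ 1# - q ^ (x ℕ.* m)
    multiple x m d = ∣-trans d (∣-respʳ (+-congˡ (-‿cong
      (trans (^-assocʳ q m x) (reflexive (≡.cong (q ^_) (ℕₚ.*-comm m x)))))) (1-x∣1-x^k (q ^ m) x))

    -- Bézout's identity in the exponents. In each of its two forms one multiple exceeds the other
    -- by the gcd, and the excess is isolated by cancelling a power of q, to which g is coprime.
    exponent-gcd : ∀ m n → g ∣ 1# - q ^ m → g ∣ 1# - q ^ n → g ∣ 1# - q ^ ℕ-GCD.gcd m n
    exponent-gcd m n d e = bezout (Bézout.identity (ℕ-GCD.gcd-GCD m n))
      where
      bezout : Bézout.Identity (ℕ-GCD.gcd m n) m n → g ∣ 1# - q ^ ℕ-GCD.gcd m n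
      bezout (Bézout.+- x y eq) = subtract (y ℕ.* n) (ℕ-GCD.gcd m n)
        (≡.subst (λ k → g ∣ 1# - q ^ k) (≡.sym eq) (multiple x m d)) (multiple y n e)
      bezout (Bézout.-+ x y eq) = subtract (x ℕ.* m) (ℕ-GCD.gcd m n)
        (≡.subst (λ k → g ∣ 1# - q ^ k) (≡.sym eq) (multiple y n e)) (multiple x m d)

  coprime-q : ∀ {g} d → g ∣ 1# - q ^ suc d → Coprime g q
  coprime-q d e h h∣g h∣q = ∣-respʳ (solve 2 (λ q x → (:1 :- q :* x) :+ q :* x := :1) q (q ^ d))
    (∣-+ (∣-trans h∣g e) (∣-*ʳ (q ^ d) h∣q))

  module _ (n : ℕ) {N U : Carrier} (N∣ : N ∣ 1# - q ^ suc n) (cop₁ : Coprime N (1# - q ^ 1))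
    (parts : ∀ d → suc (suc d) ℕ-Div.∣ suc n → ∀ h → h ∣ 1# - q ^ suc (suc d) →
             (∀ j → suc j ℕ.< suc (suc d) → Coprime h (1# - q ^ suc j)) → h ∣ U) where

    unit-∣ : ∀ {h} → h ∣ 1# → h ∣ U
    unit-∣ e = ∣-respʳ (*-identityˡ U) (∣-*ʳ U e)

    -- If d + 1 does not divide n + 1, then g divides 1 - q^e for the smaller exponent e = gcd (n +
    -- 1, d + 1), to which it is coprime, so g is a unit; for d = 0 it is a unit by `cop₁`.
    part : ∀ d g → g ∣ N → g ∣ 1# - q ^ suc d → (∀ j → suc j ℕ.< suc d → Coprime g (1# - q ^ suc j)) → g ∣ U
    part d g g∣N g∣ cop = cases (suc d ℕ-Div.∣? suc n)
      where
      divides : ∀ d → suc d ℕ-Div.∣ suc n → g ∣ 1# - q ^ suc d →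
        (∀ j → suc j ℕ.< suc d → Coprime g (1# - q ^ suc j)) → g ∣ U
      divides zero    _  g∣ _   = unit-∣ (cop₁ g g∣N g∣)
      divides (suc d) dv g∣ cop = parts d dv g g∣ cop
      small : ∀ e → e ℕ.≤ suc d → ¬ e ≡ 0 → ¬ e ≡ suc d → g ∣ 1# - q ^ e → g ∣ U
      small zero    _ e≢0 _ _ = ⊥-elim (e≢0 ≡.refl)
      small (suc j) e≤ _ e≢ g∣e = unit-∣ (cop j (ℕₚ.≤∧≢⇒< e≤ e≢) g ∣-refl g∣e)
      cases : Dec (suc d ℕ-Div.∣ suc n) → g ∣ U
      cases (yes dv) = divides d dv g∣ cop
      cases (no ¬dv) = small (ℕ-GCD.gcd (suc n) (suc d)) (ℕ-Div.∣⇒≤ (ℕ-GCD.gcd[m,n]∣n (suc n) (suc d)))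
        (λ z → case ℕ-GCD.gcd[m,n]≡0⇒n≡0 (suc n) {suc d} z of λ ())
        (λ z → ¬dv (≡.subst (ℕ-Div._∣ suc n) z (ℕ-GCD.gcd[m,n]∣m (suc n) (suc d))))
        (exponent-gcd (coprime-q d g∣) (suc n) (suc d) (∣-trans g∣N N∣) g∣)

    -- Write h = g h′ with g = gcd (h, 1 - q^(d+1)). By squarefreeness g and h′ are coprime, so it
    -- suffices that each divides U: g is a part, and h′ is coprime to 1 - q^(d+1), as a common
    -- divisor would divide g too. At d = n all of h divides 1 - q^(n+1).
    split : ∀ fuel d → fuel ℕ.+ d ≡ n → ∀ h → h ∣ N → (∀ j → suc j ℕ.< suc d → Coprime h (1# - q ^ suc j)) → h ∣ U
    split zero       d ≡.refl h h∣N cop = part d h h∣N (∣-trans h∣N N∣) cop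
    split (suc fuel) d eq     h h∣N cop = divide (gcd h (1# - q ^ suc d))
      where
      divide : (Σ Carrier λ g → g ∣ h × g ∣ 1# - q ^ suc d × (∀ t → t ∣ h → t ∣ 1# - q ^ suc d → t ∣ g)) → h ∣ U
      divide (g , (h′ , h≈) , g∣ , greatest) = ∣-respˡ (sym h≈) (coprime-product-∣ coprime
          (part d g (∣-trans g∣h h∣N) g∣ λ j j<d → coprime-∣ˡ g∣h (cop j j<d))
          (split fuel (suc d) (≡.trans (ℕₚ.+-suc fuel d) eq) h′ (∣-trans h′∣h h∣N) λ j j<d → lower j (ℕₚ.m≤n⇒m<n∨m≡n (ℕ.s≤s⁻¹ (ℕ.s≤s⁻¹ j<d)))))
        where
        g∣h : g ∣ h
        g∣h = h′ , h≈
        h′∣h : h′ ∣ h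
        h′∣h = g , trans h≈ (*-comm g h′)
        coprime : Coprime g h′
        coprime t t∣g t∣h′ = squarefree n t (∣-trans (∣-respʳ (sym h≈) (∣-* t∣g t∣h′)) (∣-trans h∣N N∣))
        lower : ∀ j → j ℕ.< d ⊎ j ≡ d → Coprime h′ (1# - q ^ suc j)
        lower j (inj₁ j<d)    = coprime-∣ˡ h′∣h (cop j (s≤s j<d))
        lower j (inj₂ ≡.refl) t t∣h′ t∣ = coprime t (greatest t (∣-trans t∣h′ h′∣h) t∣) t∣h′

    N-∣ : N ∣ U
    N-∣ = split n 0 (ℕₚ.+-identityʳ n) N ∣-refl λ { j (s≤s ()) }

-- Coprimality in the polynomial ring

P4R : CommutativeRing 0ℓ 0ℓ
P4R = polyRing 4

module R where
  open CommutativeRing P4R public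
  open Exp semiring public using (_^_; ^-homo-*)

open Divisibility P4R hiding (_,_)
open Freeness (polyGCDDomain 4)
open GCDDomain (polyGCDDomain 4) using
  (*-nonzero; *-cancelˡ; coprime-∣; coprime-sym; coprime-*; coprime-product-∣; reduce)
open PowerDivisibility P4R
open Evaluation (polyRing 4) using (eval; eval-var; eval-zero; eval-const; fromℤ)

pattern iq = zero
pattern ia = suc zero
pattern ib = suc (suc zero)
pattern ic = suc (suc (suc zero))

1≉0 : ¬ 1P {4} ≋ 0P
1≉0 = IsGCDDomain.nontrivial (polyGCDDomain 4)

nonzero-by-evaluation : ∀ (ρ : Fin 4 → P4) v → eval ρ v ≋ 1P → ¬ v ≋ 0P
nonzero-by-evaluation ρ v e z = 1≉0 (R.trans (R.sym e) (eval-zero ρ z))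

X : ℕ → P4
X k = qP R.^ k

free-X : ∀ i k → ¬ i ≡ iq → Free i (X k)
free-X i k i≢q = free-^ i qP k (free-var i iq i≢q)

free-1-X : ∀ i k → ¬ i ≡ iq → Free i (1P -P X k)
free-1-X i k i≢q = free-minus i 1P (X k) (free-1 i) (free-X i k i≢q)

module q↦0 = EvaluationLemmas (polyRing 4) (varP [ iq ≔ 0P ])

1-X≉0 : ∀ k → ¬ 1P -P X (suc k) ≋ 0P
1-X≉0 k = nonzero-by-evaluation (varP [ iq ≔ 0P ]) (1P -P X (suc k)) (q↦0.eval-1-x*y iq (X k) R.refl)

1+X≉0 : ∀ k → ¬ 1P +P X (suc k) ≋ 0P
1+X≉0 k = nonzero-by-evaluation (varP [ iq ≔ 0P ]) (1P +P X (suc k)) (q↦0.eval-1+x*y iq (X k) R.refl)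

var≉0 : ∀ i → ¬ varP {4} i ≋ 0P
var≉0 i = nonzero-by-evaluation (λ _ → 1P) (varP i) (eval-var (λ _ → 1P) i)

X≉0 : ∀ k → ¬ X k ≋ 0P
X≉0 zero    = 1≉0
X≉0 (suc k) = *-nonzero (var≉0 iq) (X≉0 k)

fixed : ∀ i t → Free i t → ∀ u → eval (varP [ i ≔ u ]) t ≋ t
fixed i t F u = R.trans (free-update i t F varP u) (eval-varP t)

fixed₂ : ∀ i j t → Free i t → Free j t → ∀ u w → eval ((varP [ i ≔ u ]) [ j ≔ w ]) t ≋ t
fixed₂ i j t F G u w = R.trans (free-update j t G (varP [ i ≔ u ]) w) (fixed i t F u)

module _ {f : P4} (f≉0 : ¬ f ≋ 0P) {i : Fin 4} (F : Free i f) where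

  coprime-var : Coprime f (varP i)
  coprime-var t t∣f d = unit-by-substitution (varP [ i ≔ 1P ]) (fixed i t (free-divisor i t f f≉0 F t∣f) 1P)
    (R.trans (eval-var (varP [ i ≔ 1P ]) i) (update i)) d
    where
    update : ∀ i → (varP [ i ≔ 1P ]) i ≋ 1P
    update iq = R.refl
    update ia = R.refl
    update ib = R.refl
    update ic = R.refl

module _ {f : P4} (f≉0 : ¬ f ≋ 0P) where

  private
    sub : ∀ i {t u} → Free i f → t ∣ f → eval (varP [ i ≔ u ]) t ≋ t
    sub i {t} {u} F t∣f = fixed i t (free-divisor i t f f≉0 F t∣f) u

    sub₂ : ∀ i j {t u w} → Free i f → Free j f → t ∣ f → eval ((varP [ i ≔ u ]) [ j ≔ w ]) t ≋ t
    sub₂ i j {t} {u} {w} F G t∣f = fixed₂ i j t (free-divisor i t f f≉0 F t∣f) (free-divisor j t f f≉0 G t∣f) u w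

  -- In this group f avoids the variables that are substituted, and therefore so does every common
  -- divisor.
  coprime-1-ay : Free ia f → ∀ y → Coprime f (1P -P (aP *P y))
  coprime-1-ay F y t t∣f = unit-by-substitution (varP [ ia ≔ 0P ]) (sub ia F t∣f)
    (EvaluationLemmas.eval-1-x*y (polyRing 4) (varP [ ia ≔ 0P ]) ia y R.refl)

  coprime-1-by : Free ib f → ∀ y → Coprime f (1P -P (bP *P y))
  coprime-1-by F y t t∣f = unit-by-substitution (varP [ ib ≔ 0P ]) (sub ib F t∣f)
    (EvaluationLemmas.eval-1-x*y (polyRing 4) (varP [ ib ≔ 0P ]) ib y R.refl)

  coprime-1-cy : Free ic f → ∀ y → Coprime f (1P -P (cP *P y))
  coprime-1-cy F y t t∣f = unit-by-substitution (varP [ ic ≔ 0P ]) (sub ic F t∣f)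
    (EvaluationLemmas.eval-1-x*y (polyRing 4) (varP [ ic ≔ 0P ]) ic y R.refl)

  coprime-a-y : Free ia f → ∀ y → Free ia y → Coprime f (aP -P y)
  coprime-a-y F y G t t∣f = unit-by-substitution (varP [ ia ≔ 1P +P y ]) (sub ia F t∣f)
    (EvaluationLemmas.eval-x-y (polyRing 4) (varP [ ia ≔ 1P +P y ]) ia y y (fixed ia y G (1P +P y)) R.refl)

  coprime-b-y : Free ib f → ∀ y → Free ib y → Coprime f (bP -P y)
  coprime-b-y F y G t t∣f = unit-by-substitution (varP [ ib ≔ 1P +P y ]) (sub ib F t∣f)
    (EvaluationLemmas.eval-x-y (polyRing 4) (varP [ ib ≔ 1P +P y ]) ib y y (fixed ib y G (1P +P y)) R.refl)

  coprime-bc-y : Free ib f → Free ic f → ∀ y → Free ib y → Free ic y → Coprime f ((bP *P cP) -P y)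
  coprime-bc-y F F′ y G G′ t t∣f = unit-by-substitution ((varP [ ib ≔ 1P +P y ]) [ ic ≔ 1P ]) (sub₂ ib ic F F′ t∣f)
    (EvaluationLemmas.eval-xx′-y (polyRing 4) ((varP [ ib ≔ 1P +P y ]) [ ic ≔ 1P ]) ib ic y y
      (fixed₂ ib ic y G G′ (1P +P y) 1P) R.refl R.refl)

  coprime-ay-b : Free ia f → Free ib f → ∀ y → Coprime f ((aP *P y) -P bP)
  -- With a = 0 and b = -1 the value of ay - b is 1, whatever variables y contains.
  coprime-ay-b F F′ y t t∣f = unit-by-substitution ((varP [ ia ≔ 0P ]) [ ib ≔ -P 1P ]) (sub₂ ia ib F F′ t∣f)
    (EvaluationLemmas.eval-xy-x′ (polyRing 4) ((varP [ ia ≔ 0P ]) [ ib ≔ -P 1P ]) ia ib y R.refl R.refl)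

-- V restricts the two families that contain a, since one of them meets the modulus itself: 1 -
-- aq^(j+1) or a - q^(j+1) is the modulus 1 - aqⁿ or a - qⁿ at j + 1 = n.
record Regularities (f : P4) (V : ℕ → Set) : Set where
  field
    cop-a : Coprime f aP
    cop-b : Coprime f bP
    cop-c : Coprime f cP
    cop₁  : ∀ j → V j → Coprime f (1P -P (aP *P X (suc j)))
    cop₂  : ∀ j → V j → Coprime f (aP -P X (suc j))
    cop₃  : ∀ y → Coprime f (1P -P (bP *P y))
    cop₄  : ∀ y → Coprime f (1P -P (cP *P y))
    cop₅  : ∀ k → Coprime f ((bP *P cP) -P X k)
    cop₆  : ∀ j → Coprime f (1P +P X (suc j))
    cop₇  : ∀ k → Coprime f (bP -P X k)

module _ {f : P4} {u : P4} (f≉0 : ¬ f ≋ 0P) (f↦1 : eval (varP [ ia ≔ u ]) f ≋ 1P) where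

  -- The roles are exchanged: here v avoids a, so common divisors do, and f is the polynomial that
  -- becomes 1 under a substitution for a.
  coprime-free : ∀ v → ¬ v ≋ 0P → Free ia v → Coprime f v
  coprime-free v v≉0 F t t∣f t∣v =
    unit-by-substitution (varP [ ia ≔ u ]) (fixed ia t (free-divisor ia t v v≉0 F t∣v) u) f↦1 t∣f

  coprime-1-X : ∀ k → Coprime f (1P -P X (suc k))
  coprime-1-X k = coprime-free (1P -P X (suc k)) (1-X≉0 k) (free-1-X ia (suc k) λ ())

  coprime-1+X : ∀ k → Coprime f (1P +P X (suc k))
  coprime-1+X k = coprime-free (1P +P X (suc k)) (1+X≉0 k) (free-+ ia 1P (X (suc k)) (free-1 ia) (free-X ia (suc k) λ ()))

  coprime-bc : ∀ {V} → Free ib f → Free ic f → Coprime f aP →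
    (∀ j → V j → Coprime f (1P -P (aP *P X (suc j)))) → (∀ j → V j → Coprime f (aP -P X (suc j))) → Regularities f V
  coprime-bc Fb Fc cop-a cop₁ cop₂ = record
    { cop-a = cop-a ; cop-b = coprime-var f≉0 {ib} Fb ; cop-c = coprime-var f≉0 {ic} Fc ; cop₁ = cop₁ ; cop₂ = cop₂
    ; cop₃ = coprime-1-by f≉0 Fb ; cop₄ = coprime-1-cy f≉0 Fc
    ; cop₅ = λ k → coprime-bc-y f≉0 Fb Fc (X k) (free-X ib k λ ()) (free-X ic k λ ())
    ; cop₆ = coprime-1+X
    ; cop₇ = λ k → coprime-b-y f≉0 Fb (X k) (free-X ib k λ ()) }

f₁ f₂ : ℕ → P4
f₁ n = 1P -P (aP *P X n)
f₂ n = aP -P X n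

f₁↦1 : ∀ n → eval (varP [ ia ≔ 0P ]) (f₁ n) ≋ 1P
f₁↦1 n = EvaluationLemmas.eval-1-x*y (polyRing 4) (varP [ ia ≔ 0P ]) ia (X n) R.refl

f₂↦1 : ∀ n → eval (varP [ ia ≔ 1P +P X n ]) (f₂ n) ≋ 1P
f₂↦1 n = EvaluationLemmas.eval-x-y (polyRing 4) (varP [ ia ≔ 1P +P X n ]) ia (X n) (X n)
  (fixed ia (X n) (free-X ia n λ ()) (1P +P X n)) R.refl

f₁≉0 : ∀ n → ¬ f₁ n ≋ 0P
f₁≉0 n = nonzero-by-evaluation (varP [ ia ≔ 0P ]) (f₁ n) (f₁↦1 n)

f₂≉0 : ∀ n → ¬ f₂ n ≋ 0P
f₂≉0 n = nonzero-by-evaluation (varP [ ia ≔ 1P +P X n ]) (f₂ n) (f₂↦1 n)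

free-f₁ : ∀ i n → ¬ i ≡ iq → ¬ i ≡ ia → Free i (f₁ n)
free-f₁ i n i≢q i≢a = free-minus i 1P (aP *P X n) (free-1 i) (free-* i aP (X n) (free-var i ia i≢a) (free-X i n i≢q))

free-f₂ : ∀ i n → ¬ i ≡ iq → ¬ i ≡ ia → Free i (f₂ n)
free-f₂ i n i≢q i≢a = free-minus i aP (X n) (free-var i ia i≢a) (free-X i n i≢q)

difference : ∀ {j n} → suc j ℕ.< n → Σ ℕ λ d → n ≡ suc d ℕ.+ suc j
difference {j} {n} j<n = n ℕ.∸ suc (suc j) ,
  ≡.trans (≡.sym (ℕₚ.m∸n+n≡m j<n)) (ℕₚ.+-suc (n ℕ.∸ suc (suc j)) (suc j))

-- Eliminating a from 1 - aq^(n+1) and 1 - aq^(j+1) leaves 1 - q^(n-j), which is nonzero for j < n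
-- and free of a, hence coprime to the modulus; with a - q^(j+1) it leaves 1 - q^(n+j+2).
f₁-regularities : ∀ n → Regularities (f₁ (suc n)) (ℕ._< n)
f₁-regularities n = coprime-bc f≉0 (f₁↦1 (suc n)) (free-f₁ ib (suc n) (λ ()) (λ ())) (free-f₁ ic (suc n) (λ ()) (λ ()))
  (λ t t∣f t∣a → divides-1 t aP (X (suc n)) t∣f t∣a)
  (λ j j<n t t∣f t∣v → go₁ j (difference (s≤s j<n)) t t∣f t∣v)
  (λ j _ t t∣f t∣v → coprime-1-X f≉0 (f₁↦1 (suc n)) (n ℕ.+ suc j) t t∣f (eliminate₂ aP qP (suc n) (suc j) t∣f t∣v))
  where
  f≉0 : ¬ f₁ (suc n) ≋ 0P
  f≉0 = f₁≉0 (suc n)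
  go₁ : ∀ j → (Σ ℕ λ d → suc n ≡ suc d ℕ.+ suc j) → Coprime (f₁ (suc n)) (1P -P (aP *P X (suc j)))
  go₁ j (d , e) t t∣f t∣v = coprime-1-X f≉0 (f₁↦1 (suc n)) d t t∣f
    (eliminate₁ aP qP (suc d) (suc j) (≡.subst (λ k → t ∣ f₁ k) e t∣f) t∣v)

-- As for `f₁`, with the two families exchanged; the elimination now leaves a power of q besides 1 -
-- q^(n-j), and this too is nonzero and free of a.
f₂-regularities : ∀ n → Regularities (f₂ (suc n)) (ℕ._< n)
f₂-regularities n = coprime-bc f≉0 (f₂↦1 (suc n)) (free-f₂ ib (suc n) (λ ()) (λ ())) (free-f₂ ic (suc n) (λ ()) (λ ()))
  (λ t t∣f t∣a → coprime-free f≉0 (f₂↦1 (suc n)) (X (suc n)) (X≉0 (suc n)) (free-X ia (suc n) λ ()) t t∣f (divides-y t aP (X (suc n)) t∣f t∣a))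
  (λ j _ t t∣f t∣v → coprime-1-X f≉0 (f₂↦1 (suc n)) (j ℕ.+ suc n) t t∣f (eliminate₂ aP qP (suc j) (suc n) t∣v t∣f))
  (λ j j<n t t∣f t∣v → go₂ j (difference (s≤s j<n)) t t∣f t∣v)
  where
  f≉0 : ¬ f₂ (suc n) ≋ 0P
  f≉0 = f₂≉0 (suc n)
  go₂ : ∀ j → (Σ ℕ λ d → suc n ≡ suc d ℕ.+ suc j) → Coprime (f₂ (suc n)) (aP -P X (suc j))
  go₂ j (d , e) t t∣f t∣v = coprime-free f≉0 (f₂↦1 (suc n)) (X (suc j) *P (1P -P X (suc d))) (*-nonzero (X≉0 (suc j)) (1-X≉0 d))
    (free-* ia (X (suc j)) (1P -P X (suc d)) (free-X ia (suc j) λ ()) (free-1-X ia (suc d) λ ())) t t∣f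
    (eliminate₃ aP qP (suc d) (suc j) (≡.subst (λ k → t ∣ f₂ k) e t∣f) t∣v)

f₁-f₂-coprime : ∀ n → Coprime (f₁ (suc n)) (f₂ (suc n))
f₁-f₂-coprime n t t∣f₁ t∣f₂ = coprime-1-X (f₁≉0 (suc n)) (f₁↦1 (suc n)) (n ℕ.+ suc n) t t∣f₁
  (eliminate₂ aP qP (suc n) (suc n) t∣f₁ t∣f₂)

-- A divisor of a nonzero integer is free of q, and q = 0 turns 1 - q^(o+1) into 1.
integer-coprime : ∀ {t} k o → t ∣ fromℤ (+ suc k) → t ∣ 1P -P X (suc o) → t ∣ 1P
integer-coprime {t} k o d e = unit-by-substitution (varP [ iq ≔ 0P ])
  (fixed iq t (free-divisor iq t (fromℤ (+ suc k)) k≉0 (free-fromℕ (suc k)) d) 0P) (q↦0.eval-1-x*y iq (X o) R.refl) e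
  where
  free-fromℕ : ∀ k → Free iq (fromℤ (+ k))
  free-fromℕ zero    = 0P , ≋-sym (∷-zero ≋-refl ≋-refl)
  free-fromℕ (suc k) = free-+ iq 1P (fromℤ (+ k)) (free-1 iq) (free-fromℕ k)
  coeff-const : ∀ n z → coeff (constP {n} z) (replicate n 0) ≡ z
  coeff-const zero    z = ≡.refl
  coeff-const (suc n) z = coeff-const n z
  k≉0 : ¬ fromℤ (+ suc k) ≋ 0P
  k≉0 z = absurd (≡.trans (≡.sym (coeff-const 4 (+ suc k)))
    (coeffwise (R.trans (R.sym (eval-varP (constP (+ suc k)))) (R.trans (eval-const {4} varP (+ suc k)) z)) (replicate 4 0)))
    where
    absurd : ¬ + suc k ≡ ℤ.0ℤ
    absurd ()

module _ (p : ℕ) {h : P4} (h∣ : h ∣ 1P -P X (suc (p ℕ.+ p))) where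

  private
    free-h : ∀ i → ¬ i ≡ iq → Free i h
    free-h i i≢q = free-divisor i h (1P -P X (suc (p ℕ.+ p))) (1-X≉0 (p ℕ.+ p)) (free-1-X i (suc (p ℕ.+ p)) i≢q) h∣
    h≉0 : ¬ h ≋ 0P
    h≉0 = GCDDomain.nonzero-∣ (polyGCDDomain 4) (1-X≉0 (p ℕ.+ p)) h∣

  coprime-ay-b′ : ∀ y → Coprime h ((aP *P y) -P bP)
  coprime-ay-b′ = coprime-ay-b h≉0 (free-h ia λ ()) (free-h ib λ ())

  cyclotomic-regularities : ∀ {V} → Regularities h V
  cyclotomic-regularities = record
    { cop-a = coprime-var h≉0 {ia} (free-h ia λ ()) ; cop-b = coprime-var h≉0 {ib} (free-h ib λ ())
    ; cop-c = coprime-var h≉0 {ic} (free-h ic λ ())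
    ; cop₁ = λ j _ → coprime-1-ay h≉0 (free-h ia λ ()) (X (suc j))
    ; cop₂ = λ j _ → coprime-a-y h≉0 (free-h ia λ ()) (X (suc j)) (free-X ia (suc j) λ ())
    ; cop₃ = coprime-1-by h≉0 (free-h ib λ ()) ; cop₄ = coprime-1-cy h≉0 (free-h ic λ ())
    ; cop₅ = λ k → coprime-bc-y h≉0 (free-h ib λ ()) (free-h ic λ ()) (X k) (free-X ib k λ ()) (free-X ic k λ ())
    -- The integer meant by the argument 1 is 2: a common divisor of 1 + q^(j+1) and 1 - q^o with o
    -- odd divides 2.
    ; cop₆ = λ j t t∣h d → integer-coprime 1 (p ℕ.+ p)
        (∣-respʳ (R.+-congˡ {1P} (R.sym (R.+-identityʳ 1P))) (divides-two qP (suc j) p d (∣-trans t∣h h∣))) (∣-trans t∣h h∣)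
    ; cop₇ = λ k → coprime-b-y h≉0 (free-h ib λ ()) (X k) (free-X ib k λ ()) }

-- The two sides of the congruence as elements of the localisations

open Rearrangements P4R using (geometric-step)
open CrossMultiplication P4R
open BigOperators P4R using () renaming (∏ to ∏ᴾ; ∏-cong to ∏-congᴾ)
open GaussianBinomials P4R qP

^P≡^ : ∀ j → qP ^P j ≡ qP R.^ j
^P≡^ zero    = ≡.refl
^P≡^ (suc j) = ≡.cong (qP *P_) (^P≡^ j)

qint-geometric : ∀ j → (1P -P qP) *P qint j ≋ 1P -P (qP R.^ j)
qint-geometric zero    = R.trans (R.zeroʳ (1P -P qP)) (R.sym (R.-‿inverseʳ 1P))
qint-geometric (suc j) = R.trans (R.*-congˡ {1P -P qP} (+P-congˡ (qint j) (R.reflexive (^P≡^ j))))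
  (geometric-step qP (qint j) (qP R.^ j) (qint-geometric j))

integral : ∀ x y → x *P y ≋ 0P → x ≋ 0P ⊎ y ≋ 0P
integral = IsGCDDomain.integral (polyGCDDomain 4)

open ExactQuotients P4R integral 1≉0

exact-^ : ∀ {x u} k → Exact (num x) (den x) u → Exact (num (x ^F k)) (den (x ^F k)) (u R.^ k)
exact-^ zero    e = exact-ι 1P
exact-^ (suc k) e = exact-* e (exact-^ k e)

exact-poch : ∀ {x p u v} k → Exact (num x) (den x) u → Exact (num p) (den p) v →
  Exact (num (poch x p k)) (den (poch x p k)) (∏ᴾ k λ j → 1P -P (u *P v R.^ j))
exact-poch zero    e e′ = exact-ι 1P
exact-poch (suc k) e e′ = exact-* (exact-poch k e e′) (exact-minus (exact-ι 1P) (exact-* e (exact-^ k e′)))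

P₁ P₂ P₃ P₄ P₅ P₆ N₁ N₂ N₃ N₄ N₅ N₆ : ℕ → Frac
N₁ k = poch (F.a *F F.q) q² k
N₂ k = poch (F.q /F F.a) q² k
N₃ k = poch F.q q² k
N₄ k = poch (F.q /F F.b) F.q k
N₅ k = poch (F.q /F F.c) F.q k
N₆ k = poch (F.b *F F.c) F.q k
P₁ k = poch (F.a *F F.q) F.q k
P₂ k = poch (F.q /F F.a) F.q k
P₃ k = poch F.q F.q k
P₄ k = poch (F.b *F q²) q² k
P₅ k = poch (F.c *F q²) q² k
P₆ k = poch (q³ /F (F.b *F F.c)) q² k

record Nonzero (k : ℕ) : Set where
  field
    nz₁ : ¬ num (P₁ k) ≋ 0P
    nz₂ : ¬ num (P₂ k) ≋ 0P
    nz₄ : ¬ num (P₄ k) ≋ 0P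
    nz₅ : ¬ num (P₅ k) ≋ 0P
    nz₆ : ¬ num (P₆ k) ≋ 0P


q-cancel : ∀ j {x y} → (1P -P X (suc j)) *P x ≋ (1P -P X (suc j)) *P y → x ≋ y
q-cancel j = *-cancelˡ {1P -P X (suc j)} (1-X≉0 j)

∏-nonzero : ∀ k (g : ℕ → P4) → (∀ j → ¬ g j ≋ 0P) → ¬ ∏ᴾ k g ≋ 0P
∏-nonzero zero    g h = 1≉0
∏-nonzero (suc k) g h = *-nonzero (∏-nonzero k g h) (h k)

-- The factors (q;q²)ₖ/(q;q)ₖ of the summands, with denominator (-q;q)ₖ instead.
w v : ℕ → P4
w k = central k
v k = ∏ᴾ k λ j → 1P +P X (suc j)

summand′ : ℕ → Frac
summand′ k = fromP (qint (3 ℕ.* k ℕ.+ 1))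
  *F ((N₁ k *F N₂ k *F fromP (w k) *F N₄ k *F N₅ k *F N₆ k)
      /F (P₁ k *F P₂ k *F fromP (v k) *F P₄ k *F P₅ k *F P₆ k))
  *F (F.q ^F k)

square-exact : ∀ k → Exact (num (N₃ k)) (den (N₃ k)) (∏ᴾ k λ j → 1P -P (qP *P (qP R.^ 2) R.^ j))
square-exact k = exact-poch k (exact-ι qP) (exact-^ 2 (exact-ι qP))

v≉0 : ∀ k → ¬ v k ≋ 0P
v≉0 k = ∏-nonzero k (λ j → 1P +P X (suc j)) λ j → 1+X≉0 j

P₃≉0 : ∀ k → ¬ num (P₃ k) ≋ 0P
P₃≉0 k e = *-nonzero (∏-nonzero k (λ j → 1P -P X (suc j)) λ j → 1-X≉0 j) (exact-den≉0 E)
  (R.trans (R.sym (exact-value E)) e)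
  where
  E : Exact (num (P₃ k)) (den (P₃ k)) (∏ᴾ k λ j → 1P -P X (suc j))
  E = exact-poch k (exact-ι qP) (exact-ι qP)

-- By `central-ratio` the two are equal as rational functions, but only the second has denominators
-- regular modulo divisors of [n].
summand-replace : ∀ k → num (summand k) *P den (summand′ k) ≋ num (summand′ k) *P den (summand k)
summand-replace k = cross-replace {num (N₃ k)} {den (N₃ k)} {num (P₃ k)} {den (P₃ k)}
  {u₂} {⟨q⟩ k} {w k} {v k}
  (exact-value (square-exact k)) (exact-value (exact-poch k (exact-ι qP) (exact-ι qP)))
  (R.trans (R.*-congʳ {v k} squares) (central-ratio q-cancel k))
  (qint (3 ℕ.* k ℕ.+ 1))
  (num (N₁ k *F N₂ k)) (num (N₄ k)) (num (N₅ k)) (num (N₆ k))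
  (num (P₁ k *F P₂ k)) (num (P₄ k)) (num (P₅ k)) (num (P₆ k))
  (den (N₁ k *F N₂ k)) (den (N₄ k)) (den (N₅ k)) (den (N₆ k))
  (den (P₁ k *F P₂ k)) (den (P₄ k)) (den (P₅ k)) (den (P₆ k))
  (num (F.q ^F k)) (den (F.q ^F k))
  where
  u₂ : P4
  u₂ = ∏ᴾ k λ j → 1P -P (qP *P (qP R.^ 2) R.^ j)
  squares : u₂ ≋ ∏ᴾ k λ j → 1P -P (qP *P (X j *P X j))
  squares = ∏-congᴾ k λ j _ → R.+-congˡ {1P} (R.-‿cong (R.*-congˡ {qP} (Rearrangements.square-^ P4R qP j)))

-- D equals f z / y as a rational function, with y regular modulo f. This form of divisibility by f
-- survives the passage to lowest terms.
HasFactor : P4 → Frac → Set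
HasFactor f D = Σ P4 λ y → Σ P4 λ z → (∀ x → f ∣ y *P x → f ∣ x) × num D *P y ≋ f *P z *P den D

module Bridge (f : P4) {V : ℕ → Set} (V? : ∀ j → Dec (V j)) (regs : Regularities f V) where
  open Regularities regs
  open Localisation P4R f
  open LocalUnits P4R f
  open Represent P4R integral 1≉0 f
  open Units localRing
  open BigOperators localRing
  open ProductInverse localRing
  open Rearrangements localRing
  open LocalSums localRing using (Data; module Data)
  module L where
    open CommutativeRing localRing public
    open Exp (CommutativeRing.semiring localRing) public using (_^_; ^-homo-*; ^-congˡ)

  Rep : Frac → Fraction → Set
  Rep x ℓ = Represents (num x) (den x) ℓ

  coprime⇒regular : ∀ {y} → Coprime f y → Regular y
  coprime⇒regular cop x = coprime-∣ x cop

  coprime⇒unit : ∀ y → Coprime f y → Unit (ι y)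
  coprime⇒unit y cop = regular⇒unit (ι y) (coprime⇒regular cop)

  q a b c a⁻¹ b⁻¹ c⁻¹ : Fraction
  q = ι qP
  a = ι aP
  b = ι bP
  c = ι cP
  a⁻¹ = proj₁ (coprime⇒unit aP cop-a)
  b⁻¹ = proj₁ (coprime⇒unit bP cop-b)
  c⁻¹ = proj₁ (coprime⇒unit cP cop-c)

  a-inv : a L.* a⁻¹ ∼ L.1#
  a-inv = proj₂ (coprime⇒unit aP cop-a)
  b-inv : b L.* b⁻¹ ∼ L.1#
  b-inv = proj₂ (coprime⇒unit bP cop-b)
  c-inv : c L.* c⁻¹ ∼ L.1#
  c-inv = proj₂ (coprime⇒unit cP cop-c)

  ι-X : ∀ j → ι (X j) ∼ q L.^ j
  ι-X j = ι-^ qP j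

  ι-1-X : ∀ j → ι (1P -P X j) ∼ L.1# L.- q L.^ j
  ι-1-X j = L.trans (ι-minus 1P (X j)) (L.+-congˡ {L.1#} (L.-‿cong (ι-X j)))

  ι-1-yX : ∀ y j → ι (1P -P (y *P X j)) ∼ L.1# L.- ι y L.* q L.^ j
  ι-1-yX y j = L.trans (ι-minus-* 1P y (X j)) (L.+-congˡ {L.1#} (L.-‿cong (L.*-congˡ {ι y} (ι-X j))))

  ι-y-X : ∀ y j → ι (y -P X j) ∼ ι y L.- q L.^ j
  ι-y-X y j = L.trans (ι-minus y (X j)) (L.+-congˡ {ι y} (L.-‿cong (ι-X j)))

  unit₁ : ∀ j → V j → Unit (L.1# L.- a L.* q L.* q L.^ j)
  unit₁ j Vj = unit-cong (L.trans (ι-1-yX aP (suc j)) (1-a·qx a q (q L.^ j)))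
    (coprime⇒unit (1P -P (aP *P X (suc j))) (cop₁ j Vj))

  unit₂ : ∀ j → V j → Unit (L.1# L.- q L.* a⁻¹ L.* q L.^ j)
  unit₂ j Vj = unit-factor {a} (unit-cong (L.trans (ι-y-X aP (suc j)) (a-qx a a⁻¹ q (q L.^ j) a-inv))
    (coprime⇒unit (aP -P X (suc j)) (cop₂ j Vj)))

  unit₃ : ∀ j → Unit (L.1# L.- b L.* (q L.* q) L.* (q L.^ j L.* q L.^ j))
  unit₃ j = unit-cong (L.trans (ι-1-yX bP (suc (suc (j ℕ.+ j)))) (1-b·qqxx b q j))
    (coprime⇒unit (1P -P (bP *P X (suc (suc (j ℕ.+ j))))) (cop₃ (X (suc (suc (j ℕ.+ j))))))

  unit₄ : ∀ j → Unit (L.1# L.- c L.* (q L.* q) L.* (q L.^ j L.* q L.^ j))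
  unit₄ j = unit-cong (L.trans (ι-1-yX cP (suc (suc (j ℕ.+ j)))) (1-b·qqxx c q j))
    (coprime⇒unit (1P -P (cP *P X (suc (suc (j ℕ.+ j))))) (cop₄ (X (suc (suc (j ℕ.+ j))))))

  unit₅ : ∀ j → Unit (L.1# L.- q L.* q L.* q L.* (b⁻¹ L.* c⁻¹) L.* (q L.^ j L.* q L.^ j))
  unit₅ j = unit-factor {b L.* c} (unit-cong
    (L.trans (L.trans (ι-y-X (bP *P cP) (suc (suc (suc (j ℕ.+ j))))) (L.+-congʳ (ι-* bP cP)))
      (bc-qqqxx b b⁻¹ c c⁻¹ q j b-inv c-inv))
    (coprime⇒unit ((bP *P cP) -P X (suc (suc (suc (j ℕ.+ j))))) (cop₅ (suc (suc (suc (j ℕ.+ j)))))))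

  ι-1+X : ∀ j → ι (1P +P X (suc j)) ∼ L.1# L.+ q L.* q L.^ j
  ι-1+X j = L.trans (ι-+ 1P (X (suc j))) (L.+-congˡ {L.1#} (ι-X (suc j)))

  unit₆ : ∀ j → Unit (L.1# L.+ q L.* q L.^ j)
  unit₆ j = unit-cong (ι-1+X j) (coprime⇒unit (1P +P X (suc j)) (cop₆ j))

  unit₇ : ∀ i → Unit (L.1# L.- q L.* b⁻¹ L.* (q L.^ i L.* q L.^ i))
  unit₇ i = unit-factor {b} (unit-cong
    (L.trans (ι-y-X bP (suc (i ℕ.+ i))) (L.trans
      (L.+-congˡ {b} (L.-‿cong (L.*-congˡ {q} (L.^-homo-* q i i))))
      (a-qx b b⁻¹ q (q L.^ i L.* q L.^ i) b-inv)))
    (coprime⇒unit (bP -P X (suc (i ℕ.+ i))) (cop₇ (suc (i ℕ.+ i)))))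

  i₁ i₂ i₃ i₄ i₅ i₆ : ℕ → Fraction
  i₁ = proj₁ (inverses _ V? unit₁)
  i₂ = proj₁ (inverses _ V? unit₂)
  i₃ j = proj₁ (unit₃ j)
  i₄ j = proj₁ (unit₄ j)
  i₅ j = proj₁ (unit₅ j)
  i₆ j = proj₁ (unit₆ j)

  u : ℕ → Fraction
  u k = ι (w k) L.* ∏ k i₆

  u-suc : ∀ k → (L.1# L.- q L.* q L.^ k) L.* u (suc k) ∼ (L.1# L.- q L.* (q L.^ k L.* q L.^ k)) L.* u k
  u-suc k = u-step (ι (w (suc k))) (ι (w k)) (∏ k i₆) (begin
    (L.1# L.- q L.* x) L.* ι (w (suc k))
      ≈⟨ L.*-congʳ (ι-1-X (suc k)) ⟨
    ι (1P -P X (suc k)) L.* ι (w (suc k))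
      ≈⟨ ι-* (1P -P X (suc k)) (w (suc k)) ⟨
    ι ((1P -P X (suc k)) *P w (suc k))
      -- The recurrence is imported from the polynomial ring, because 1 - q^(k+1) may be a zero
      -- divisor here.
      ≈⟨ ι-cong (central-suc q-cancel k) ⟩
    ι ((1P -P (qP *P (X k *P X k))) *P (1P +P X (suc k)) *P w k)
      ≈⟨ L.trans (ι-* ((1P -P (qP *P (X k *P X k))) *P (1P +P X (suc k))) (w k))
           (L.*-congʳ (L.trans (ι-* (1P -P (qP *P (X k *P X k))) (1P +P X (suc k))) (L.*-cong squared (ι-1+X k)))) ⟩
    (L.1# L.- q L.* (x L.* x)) L.* (L.1# L.+ q L.* x) L.* ι (w k) ∎) (i₆ k) (proj₂ (unit₆ k))
    where
    open SetoidReasoning L.setoid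
    x : Fraction
    x = q L.^ k
    squared : ι (1P -P (qP *P (X k *P X k))) ∼ L.1# L.- q L.* (x L.* x)
    squared = L.trans (ι-minus-* 1P qP (X k *P X k)) (L.+-congˡ {L.1#} (L.-‿cong (L.*-congˡ {q}
      (L.trans (ι-* (X k) (X k)) (L.*-cong (ι-X k) (ι-X k))))))

  qint-eq : ∀ j → (L.1# L.- q) L.* ι (qint j) ∼ L.1# L.- q L.^ j
  qint-eq j = L.trans (L.*-congʳ (L.sym (ι-minus 1P qP))) (L.trans (L.sym (ι-* (1P -P qP) (qint j)))
    (L.trans (ι-cong (qint-geometric j)) (ι-1-X j)))

  data′ : Data V
  data′ = record
    { q = q ; a = a ; a⁻¹ = a⁻¹ ; b = b ; b⁻¹ = b⁻¹ ; c = c ; c⁻¹ = c⁻¹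
    ; a-inv = a-inv ; b-inv = b-inv ; c-inv = c-inv
    ; u = u ; Q = λ k → ι (qint (3 ℕ.* k ℕ.+ 1))
    ; u-zero = L.*-identityʳ L.1# ; u-suc = u-suc
    ; Q-eq = λ k → L.trans (qint-eq (3 ℕ.* k ℕ.+ 1)) (q-triple q k)
    ; i₁ = i₁ ; i₂ = i₂ ; i₃ = i₃ ; i₄ = i₄ ; i₅ = i₅
    ; i₁-inv = proj₂ (inverses _ V? unit₁) ; i₂-inv = proj₂ (inverses _ V? unit₂)
    ; i₃-inv = λ j _ → proj₂ (unit₃ j) ; i₄-inv = λ j _ → proj₂ (unit₄ j) ; i₅-inv = λ j _ → proj₂ (unit₅ j) }

  open Data data′ using (t; r; ∏r-split; i₁-inv; i₂-inv)

  rep-^ : ∀ {x ℓ} k → Rep x ℓ → Rep (x ^F k) (ℓ L.^ k)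
  rep-^ zero    ρ = rep-ι 1P
  rep-^ (suc k) ρ = rep-* ρ (rep-^ k ρ)

  rep-poch : ∀ {x p ℓ s} k → Rep x ℓ → Rep p s → Rep (poch x p k) (∏ k λ j → L.1# L.- ℓ L.* s L.^ j)
  rep-poch zero    ρ σ = rep-ι 1P
  rep-poch (suc k) ρ σ = rep-* (rep-poch k ρ σ) (rep-minus (rep-ι 1P) (rep-* ρ (rep-^ k σ)))

  rep-sum : ∀ k {g h} → (∀ j → j ℕ.< k → Rep (g j) (h j)) → Rep (sumF k g) (∑ k h)
  rep-sum zero    ρ = rep-ι 0P
  rep-sum (suc k) ρ = rep-+ (rep-sum k λ j j<k → ρ j (ℕₚ.m<n⇒m<1+n j<k)) (ρ k ℕₚ.≤-refl)

  rep-q² : Rep q² (q L.* q)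
  rep-q² = rep-cong (q²≈ q) (rep-^ 2 (rep-ι qP))

  ⟪_⟫ ⟪_⟫² : Fraction → ℕ → Fraction
  ⟪ y ⟫ k = ∏ k λ j → L.1# L.- y L.* q L.^ j
  ⟪ y ⟫² k = ∏ k λ j → L.1# L.- y L.* (q L.^ j L.* q L.^ j)

  rep-poch₁ : ∀ {x y} k → Rep x y → Rep (poch x F.q k) (⟪ y ⟫ k)
  rep-poch₁ k ρ = rep-poch k ρ (rep-ι qP)

  rep-poch₂ : ∀ {x y} k → Rep x y → Rep (poch x q² k) (⟪ y ⟫² k)
  rep-poch₂ {x} {y} k ρ = rep-cong (∏-cong k λ j _ → L.+-congˡ {L.1#} (L.-‿cong (L.*-congˡ {y} (square-^ q j))))
    (rep-poch k ρ (rep-^ 2 (rep-ι qP)))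


  rep-aq : Rep (F.a *F F.q) (a L.* q)
  rep-aq = rep-* (rep-ι aP) (rep-ι qP)

  rep-q/a : Rep (F.q /F F.a) (q L.* a⁻¹)
  rep-q/a = rep-/ (rep-ι qP) (rep-ι aP) (var≉0 ia) a-inv

  rep-q/b : Rep (F.q /F F.b) (q L.* b⁻¹)
  rep-q/b = rep-/ (rep-ι qP) (rep-ι bP) (var≉0 ib) b-inv

  rep-q/c : Rep (F.q /F F.c) (q L.* c⁻¹)
  rep-q/c = rep-/ (rep-ι qP) (rep-ι cP) (var≉0 ic) c-inv

  rep-bc : Rep (F.b *F F.c) (b L.* c)
  rep-bc = rep-* (rep-ι bP) (rep-ι cP)

  rep-bq² : Rep (F.b *F q²) (b L.* (q L.* q))
  rep-bq² = rep-* (rep-ι bP) rep-q²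

  rep-cq² : Rep (F.c *F q²) (c L.* (q L.* q))
  rep-cq² = rep-* (rep-ι cP) rep-q²

  rep-q³/bc : Rep (q³ /F (F.b *F F.c)) (q L.* q L.* q L.* (b⁻¹ L.* c⁻¹))
  rep-q³/bc = rep-/ (rep-cong (q³≈ q) (rep-^ 3 (rep-ι qP))) rep-bc
    (*-nonzero (var≉0 ib) (var≉0 ic)) (product-inverse₂ b-inv c-inv)

  module _ (k : ℕ) (V-k : ∀ j → j ℕ.< k → V j) where

    inv₁ : ⟪ a L.* q ⟫ k L.* ∏ k i₁ ∼ L.1#
    inv₁ = ∏-inverse k λ j j<k → i₁-inv j (V-k j j<k)

    inv₂ : ⟪ q L.* a⁻¹ ⟫ k L.* ∏ k i₂ ∼ L.1#
    inv₂ = ∏-inverse k λ j j<k → i₂-inv j (V-k j j<k)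

  inv₃ : ∀ k → ⟪ b L.* (q L.* q) ⟫² k L.* ∏ k i₃ ∼ L.1#
  inv₃ k = ∏-inverse k λ j _ → proj₂ (unit₃ j)

  inv₄ : ∀ k → ⟪ c L.* (q L.* q) ⟫² k L.* ∏ k i₄ ∼ L.1#
  inv₄ k = ∏-inverse k λ j _ → proj₂ (unit₄ j)

  inv₅ : ∀ k → ⟪ q L.* q L.* q L.* (b⁻¹ L.* c⁻¹) ⟫² k L.* ∏ k i₅ ∼ L.1#
  inv₅ k = ∏-inverse k λ j _ → proj₂ (unit₅ j)

  denominators-nonzero : ¬ f ∣ 1P → ∀ k → (∀ j → j ℕ.< k → V j) → Nonzero k
  denominators-nonzero f∤1 k V-k = record
    { nz₁ = rep-nonzero f∤1 (rep-poch₁ k rep-aq) (∏ k i₁ , inv₁ k V-k)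
    ; nz₂ = rep-nonzero f∤1 (rep-poch₁ k rep-q/a) (∏ k i₂ , inv₂ k V-k)
    ; nz₄ = rep-nonzero f∤1 (rep-poch₂ k rep-bq²) (∏ k i₃ , inv₃ k)
    ; nz₅ = rep-nonzero f∤1 (rep-poch₂ k rep-cq²) (∏ k i₄ , inv₄ k)
    ; nz₆ = rep-nonzero f∤1 (rep-poch₂ k rep-q³/bc) (∏ k i₅ , inv₅ k) }

  module _ (k : ℕ) (V-k : ∀ j → j ℕ.< k → V j) (nz : Nonzero k) where
    open Nonzero nz

    private
      rep-N₁₂ : Rep (N₁ k *F N₂ k) (⟪ a L.* q ⟫² k L.* ⟪ q L.* a⁻¹ ⟫² k)
      rep-N₁₂ = rep-* (rep-poch₂ k rep-aq) (rep-poch₂ k rep-q/a)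

      rep-numerator : ∀ {x ℓ} → Rep x ℓ → Rep (N₁ k *F N₂ k *F x *F N₄ k *F N₅ k *F N₆ k)
        (⟪ a L.* q ⟫² k L.* ⟪ q L.* a⁻¹ ⟫² k L.* ℓ L.* ⟪ q L.* b⁻¹ ⟫ k L.* ⟪ q L.* c⁻¹ ⟫ k L.* ⟪ b L.* c ⟫ k)
      rep-numerator ρ = rep-* (rep-* (rep-* (rep-* rep-N₁₂ ρ) (rep-poch₁ k rep-q/b)) (rep-poch₁ k rep-q/c)) (rep-poch₁ k rep-bc)

      rep-denominator : Rep (P₁ k *F P₂ k *F fromP (v k) *F P₄ k *F P₅ k *F P₆ k)
        (⟪ a L.* q ⟫ k L.* ⟪ q L.* a⁻¹ ⟫ k L.* ι (v k) L.* ⟪ b L.* (q L.* q) ⟫² k L.* ⟪ c L.* (q L.* q) ⟫² k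
          L.* ⟪ q L.* q L.* q L.* (b⁻¹ L.* c⁻¹) ⟫² k)
      rep-denominator = rep-* (rep-* (rep-* (rep-* (rep-* (rep-poch₁ k rep-aq) (rep-poch₁ k rep-q/a)) (rep-ι (v k)))
        (rep-poch₂ k rep-bq²)) (rep-poch₂ k rep-cq²)) (rep-poch₂ k rep-q³/bc)

      inv₆ : ι (v k) L.* ∏ k i₆ ∼ L.1#
      inv₆ = L.trans (L.*-congʳ {∏ k i₆} (ι-∏ k (λ j → 1P +P X (suc j))))
        (∏-inverse k λ j _ → L.trans (L.*-congʳ {i₆ j} (ι-1+X j)) (proj₂ (unit₆ j)))

      rep-summand′ : Rep (summand′ k) (t k)
      rep-summand′ = rep-cong
        (L.trans (regroup-summand (ι (qint (3 ℕ.* k ℕ.+ 1))) (⟪ a L.* q ⟫² k) (⟪ q L.* a⁻¹ ⟫² k) (ι (w k))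
            (⟪ q L.* b⁻¹ ⟫ k) (⟪ q L.* c⁻¹ ⟫ k) (⟪ b L.* c ⟫ k) (∏ k i₁) (∏ k i₂) (∏ k i₆) (∏ k i₃) (∏ k i₄) (∏ k i₅) (q L.^ k))
          (L.*-congʳ {q L.^ k} (L.*-congˡ {ι (qint (3 ℕ.* k ℕ.+ 1))} (L.*-congˡ {u k} (L.sym (∏r-split k))))))
        (rep-* (rep-* (rep-ι (qint (3 ℕ.* k ℕ.+ 1))) (rep-/ (rep-numerator (rep-ι (w k))) rep-denominator
          (*-nonzero (*-nonzero (*-nonzero (*-nonzero (*-nonzero nz₁ nz₂) (v≉0 k)) nz₄) nz₅) nz₆)
          (product-inverse₆ (inv₁ k V-k) (inv₂ k V-k) inv₆ (inv₃ k) (inv₄ k) (inv₅ k))))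
          (rep-^ k (rep-ι qP)))

      summand-den≉0 : ¬ den (summand k) ≋ 0P
      summand-den≉0 = *-nonzero (*-nonzero 1≉0 (*-nonzero
          (Represents.den≉0 (rep-numerator (rep-poch₂ k (rep-ι qP))))
          (*-nonzero (*-nonzero (*-nonzero (*-nonzero (*-nonzero nz₁ nz₂) (P₃≉0 k)) nz₄) nz₅) nz₆)))
        (Represents.den≉0 (rep-^ k (rep-ι qP)))

    -- The factor (q;q)ₖ of the raw denominator only has to be nonzero as a polynomial; its
    -- behaviour modulo f is bypassed by the detour through `summand′`.
    rep-summand : Rep (summand k) (t k)
    rep-summand = rep-replace summand-den≉0 (summand-replace k) rep-summand′

  module _ (nz : ∀ k → Nonzero k) where

    rep-lhs : ∀ M → (∀ j → j ℕ.< M → V j) → Rep (lhs M) (∑ (suc M) t)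
    rep-lhs M V-M = rep-sum (suc M) λ k k≤M → rep-summand k
      (λ j j<k → V-M j (ℕₚ.<-≤-trans j<k (ℕ.s≤s⁻¹ k≤M))) (nz k)

    right : ℕ → Fraction
    right m = ⟪ b L.* c L.* q ⟫² m L.* ⟪ q L.* q L.* b⁻¹ ⟫² m L.* ⟪ q L.* q L.* c⁻¹ ⟫² m
      L.* (∏ m i₅ L.* ∏ m i₃ L.* ∏ m i₄)

    rep-rhs : ∀ n m → Rep (rhs n m) (right m L.* ι (qint n))
    rep-rhs n m = rep-* (rep-/
      (rep-* (rep-* (rep-poch₂ m (rep-* rep-bc (rep-ι qP)))
        (rep-poch₂ m (rep-/ rep-q² (rep-ι bP) (var≉0 ib) b-inv)))
        (rep-poch₂ m (rep-/ rep-q² (rep-ι cP) (var≉0 ic) c-inv)))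
      (rep-* (rep-* (rep-poch₂ m rep-q³/bc) (rep-poch₂ m rep-bq²)) (rep-poch₂ m rep-cq²))
      (*-nonzero (*-nonzero (Nonzero.nz₆ (nz m)) (Nonzero.nz₄ (nz m))) (Nonzero.nz₅ (nz m)))
      (product-inverse₃ (inv₅ m) (inv₃ m) (inv₄ m))) (rep-ι (qint n))

    factor : ∀ n m M → (∀ j → j ℕ.< M → V j) → ∑ (suc M) t ∼ right m L.* ι (qint n) → HasFactor f (lhs M -F rhs n m)
    factor n m M V-M e = rep-zero (rep-cong
      (L.trans (L.+-congʳ {L.- (right m L.* ι (qint n))} e) (L.-‿inverseʳ (right m L.* ι (qint n))))
      (rep-minus (rep-lhs M V-M) (rep-rhs n m)))

    difference-den≉0 : ∀ n m M → (∀ j → j ℕ.< M → V j) → ¬ den (lhs M -F rhs n m) ≋ 0P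
    difference-den≉0 n m M V-M = Represents.den≉0 (rep-minus (rep-lhs M V-M) (rep-rhs n m))

-- Setting all variables to 1 sends `f₁` to 0, which does not divide 1.
f₁∤1 : ∀ n → ¬ f₁ (suc n) ∣ 1P
f₁∤1 n d = 1≉0 (R.trans (Divisibility._∣_.equality e) (R.trans (R.*-congʳ f↦0) (R.zeroˡ (Divisibility._∣_.quotient e))))
  where
  open Evaluation (polyRing 4) using (eval-1; eval-*)
  ρ : _ → P4
  ρ _ = 1P
  module ρ = EvaluationLemmas (polyRing 4) ρ
  e : eval ρ (f₁ (suc n)) ∣ 1P
  e = ∣-respʳ (eval-1 {4} ρ) (ρ.eval-∣ d)
  1^k : ∀ k → 1P R.^ k ≋ 1P
  1^k zero    = R.refl
  1^k (suc k) = R.trans (R.*-identityˡ (1P R.^ k)) (1^k k)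
  f↦0 : eval ρ (f₁ (suc n)) ≋ 0P
  f↦0 = R.trans (ρ.eval-minus 1P (aP *P X (suc n))) (R.trans (R.+-cong (eval-1 {4} ρ) (R.-‿cong
    (R.trans (eval-* ρ aP (X (suc n))) (R.trans (R.*-cong (eval-var ρ ia) (R.trans (ρ.eval-^ qP (suc n)) (R.trans (^-cong (eval-var ρ iq)) (1^k (suc n))))) (R.*-identityˡ 1P)))))
    (R.-‿inverseʳ 1P))
    where
    ^-cong : ∀ {x y} → x ≋ y → x R.^ suc n ≋ y R.^ suc n
    ^-cong {x} {y} e = go (suc n)
      where
      go : ∀ k → x R.^ k ≋ y R.^ k
      go zero    = R.refl
      go (suc k) = R.*-cong e (go k)

-- That these polynomials are nonzero has nothing to do with a modulus, but it follows from their
-- being units modulo a non-unit; `f₁ (suc k)` serves, since it admits exactly the indices j < k.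
nonzero : ∀ k → Nonzero k
nonzero k = Bridge.denominators-nonzero (f₁ (suc k)) (λ j → j ℕₚ.<? k) (f₁-regularities k) (f₁∤1 k) k λ j j<k → j<k

module LinearFactor (m : ℕ) (f : P4) (regs : Regularities f (ℕ._< m ℕ.+ m))
  (cop-q : ∀ j → Coprime f (1P -P X (suc j))) where
  open Bridge f (λ j → j ℕₚ.<? m ℕ.+ m) regs
  open Localisation P4R f
  open Units localRing
  open BigOperators localRing
  open ProductInverse localRing using (divide-product; product-inverse₃)
  open LocalSums localRing using (module Data)
  open Data data′ using (t)

  n : ℕ
  n = suc (m ℕ.+ m)

  q-units : ∀ j → Unit (L.1# L.- q L.* q L.^ j)
  q-units j = unit-cong (ι-1-X (suc j)) (coprime⇒unit (1P -P X (suc j)) (cop-q j))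

  qq-units : ∀ j → Unit (L.1# L.- q L.* (q L.^ j L.* q L.^ j))
  qq-units j = unit-cong (L.+-congˡ {L.1#} (L.-‿cong (L.*-congˡ {q} (L.^-homo-* q j j)))) (q-units (j ℕ.+ j))

  q-unit : Unit (L.1# L.- q)
  q-unit = unit-cong (L.+-congˡ {L.1#} (L.-‿cong (L.*-identityʳ q))) (q-units 0)

  q^n : q L.^ n ∼ q L.* (q L.^ m L.* q L.^ m)
  q^n = L.*-congˡ {q} (L.^-homo-* q m m)

  qint-n : (L.1# L.- q) L.* ι (qint n) ∼ L.1# L.- q L.* (q L.^ m L.* q L.^ m)
  qint-n = L.trans (qint-eq n) (L.+-congˡ {L.1#} (L.-‿cong q^n))

  -- Since the terms beyond index m are 0, both choices of M give the sum up to m; dividing by the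
  -- invertible products on its side gives the right-hand side.
  conclude : ∑ (suc m) t L.* (⟪ q L.* q L.* q L.* (b⁻¹ L.* c⁻¹) ⟫² m L.* ⟪ b L.* (q L.* q) ⟫² m L.* ⟪ c L.* (q L.* q) ⟫² m)
      ∼ ι (qint n) L.* (⟪ b L.* c L.* q ⟫² m L.* ⟪ q L.* q L.* b⁻¹ ⟫² m L.* ⟪ q L.* q L.* c⁻¹ ⟫² m) →
    (∀ k → m ℕ.< k → t k ∼ L.0#) → ∀ M → M ≡ m ℕ.+ m ⊎ M ≡ m → HasFactor f (lhs M -F rhs n m)
  conclude product tail M M-cases = factor nonzero n m M (V-M M M-cases) (L.trans (sum M M-cases)
      (divide-product product (product-inverse₃ (inv₅ m) (inv₃ m) (inv₄ m))))
    where
    V-M : ∀ M → M ≡ m ℕ.+ m ⊎ M ≡ m → ∀ j → j ℕ.< M → j ℕ.< m ℕ.+ m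
    V-M _ (inj₁ ≡.refl) j j<M = j<M
    V-M _ (inj₂ ≡.refl) j j<M = ℕₚ.≤-trans j<M (ℕₚ.m≤m+n m m)
    sum : ∀ M → M ≡ m ℕ.+ m ⊎ M ≡ m → ∑ (suc M) t ∼ ∑ (suc m) t
    sum _ (inj₂ ≡.refl) = L.refl
    sum _ (inj₁ ≡.refl) = L.trans (∑-++ (suc m) m t) (L.trans
      (L.+-congˡ {∑ (suc m) t} (∑-0 m λ j _ → tail (suc (m ℕ.+ j)) (s≤s (ℕₚ.m≤m+n m j))))
      (L.+-identityʳ (∑ (suc m) t)))

module _ (m : ℕ) where

  private
    n : ℕ
    n = suc (m ℕ.+ m)

  f₁-factor : ∀ M → M ≡ m ℕ.+ m ⊎ M ≡ m → HasFactor (f₁ n) (lhs M -F rhs n m)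
  f₁-factor = conclude
    (Direct.product-sum m (λ j j<2m → j<2m) (λ j _ → q-units j) q-unit (λ j _ → qq-units j) d≈1 (λ i _ → unit₇ i) qint-n)
    (Direct.terms-vanish m (λ j j<2m → j<2m) (λ j _ → q-units j)
      (L.trans (L.+-congˡ {L.1#} (L.-‿cong d≈1)) (L.-‿inverseʳ L.1#)))
    where
    regs = f₁-regularities (m ℕ.+ m)
    cop-q = coprime-1-X (f₁≉0 n) (f₁↦1 n)
    open LinearFactor m (f₁ n) regs cop-q using (conclude; q-units; q-unit; qq-units; q^n; qint-n)
    open Bridge (f₁ n) (λ j → j ℕₚ.<? m ℕ.+ m) regs
    open Localisation P4R (f₁ n)
    module Direct = LocalSums.Direct localRing data′
    -- With d = aq the condition dq²ᵐ = 1 reads aqⁿ = 1.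
    d≈1 : a L.* q L.* (q L.^ m L.* q L.^ m) ∼ L.1#
    d≈1 = L.trans (L.*-assoc a q (q L.^ m L.* q L.^ m)) (L.trans (L.*-congˡ {a} (L.sym q^n))
      (L.trans (L.*-congˡ {a} (L.sym (ι-X n))) (L.trans (L.sym (ι-* aP (X n))) (L.sym (ι-mod ∣-refl)))))

  f₂-factor : ∀ M → M ≡ m ℕ.+ m ⊎ M ≡ m → HasFactor (f₂ n) (lhs M -F rhs n m)
  f₂-factor = conclude
    (Inverted.product-sum m (λ j j<2m → j<2m) (λ j _ → q-units j) q-unit (λ j _ → qq-units j) d≈1 (λ i _ → unit₇ i) qint-n)
    (Inverted.terms-vanish m (λ j j<2m → j<2m) (λ j _ → q-units j)
      (L.trans (L.+-congˡ {L.1#} (L.-‿cong d≈1)) (L.-‿inverseʳ L.1#)))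
    where
    regs = f₂-regularities (m ℕ.+ m)
    cop-q = coprime-1-X (f₂≉0 n) (f₂↦1 n)
    open LinearFactor m (f₂ n) regs cop-q using (conclude; q-units; q-unit; qq-units; q^n; qint-n)
    open Bridge (f₂ n) (λ j → j ℕₚ.<? m ℕ.+ m) regs
    open Localisation P4R (f₂ n)
    module Inverted = LocalSums.Inverted localRing data′
    -- With d = q/a the condition dq²ᵐ = 1 reads a = qⁿ; hence the inverted orientation.
    d≈1 : q L.* a⁻¹ L.* (q L.^ m L.* q L.^ m) ∼ L.1#
    d≈1 = begin
      q L.* a⁻¹ L.* (q L.^ m L.* q L.^ m)    ≈⟨ L.*-congʳ (L.*-comm q a⁻¹) ⟩
      a⁻¹ L.* q L.* (q L.^ m L.* q L.^ m)    ≈⟨ L.*-assoc a⁻¹ q (q L.^ m L.* q L.^ m) ⟩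
      a⁻¹ L.* (q L.* (q L.^ m L.* q L.^ m))  ≈⟨ L.*-congˡ {a⁻¹} (L.trans (L.sym q^n) (L.sym (ι-X n))) ⟩
      a⁻¹ L.* ι (X n)                        ≈⟨ L.*-congˡ {a⁻¹} (ι-mod {aP} {X n} ∣-refl) ⟨
      a⁻¹ L.* a                              ≈⟨ L.*-comm a⁻¹ a ⟩
      a L.* a⁻¹                              ≈⟨ a-inv ⟩
      L.1#                                   ∎
      where open SetoidReasoning L.setoid

module _ (p e e′ : ℕ) (0<2p : 0 ℕ.< p ℕ.+ p) {h : P4} where

  private
    o : ℕ
    o = suc (p ℕ.+ p)

  -- For M = n - 1 the sum consists of e full periods, for M = m of e′ full periods and a half one;
  -- each of these adds up to 0. The right-hand side is 0 because of its factor [n].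
  cyclotomic-factor : h ∣ 1P -P X o → (∀ j → suc j ℕ.< o → Coprime h (1P -P X (suc j))) →
    ∀ n m → n ≡ e ℕ.* o → m ≡ e′ ℕ.* o ℕ.+ p → ∀ M → suc M ≡ n ⊎ M ≡ m → HasFactor h (lhs M -F rhs n m)
  cyclotomic-factor h∣ cop n m n≡ m≡ M M-cases = factor nonzero n m M (λ _ _ → tt) (L.trans (sum M M-cases) (L.sym rhs≈0))
    where
    regs = cyclotomic-regularities p h∣ {λ _ → ⊤}
    open Bridge h (λ _ → yes tt) regs
    open Localisation P4R h
    open LocalUnits P4R h using (ι-minus)
    open Units localRing
    open BigOperators localRing
    open ProductInverse localRing using (product-zero)
    open LocalSums localRing using (module Data)
    open Data data′ using (t)
    q-units : ∀ j → j ℕ.< p ℕ.+ p → Unit (L.1# L.- q L.* q L.^ j)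
    q-units j j<2p = unit-cong (ι-1-X (suc j)) (coprime⇒unit (1P -P X (suc j)) (cop j (s≤s j<2p)))
    q-unit : Unit (L.1# L.- q)
    q-unit = unit-cong (L.+-congˡ {L.1#} (L.-‿cong (L.*-identityʳ q))) (q-units 0 0<2p)
    q^o≈1 : q L.^ o ∼ L.1#
    q^o≈1 = L.sym (L.trans (ι-mod {1P} {X o} h∣) (ι-X o))
    d-units : ∀ i → Unit (a L.* q L.* (q L.^ i L.* q L.^ i) L.- b)
    d-units i = unit-cong
      (L.trans (ι-minus (aP *P X (suc (i ℕ.+ i))) bP) (L.+-congʳ {L.- b} (L.trans (ι-* aP (X (suc (i ℕ.+ i))))
        (L.trans (L.*-congˡ {a} (L.trans (ι-X (suc (i ℕ.+ i))) (L.*-congˡ {q} (L.^-homo-* q i i))))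
          (L.sym (L.*-assoc a q (q L.^ i L.* q L.^ i)))))))
      (coprime⇒unit ((aP *P X (suc (i ℕ.+ i))) -P bP) (coprime-ay-b′ p h∣ (X (suc (i ℕ.+ i)))))
    module Root = LocalSums.RootOfUnity localRing data′ p q^o≈1 (λ _ → tt) q-units q-unit unit₇ d-units
    sum : ∀ M → suc M ≡ n ⊎ M ≡ m → ∑ (suc M) t ∼ L.0#
    sum M (inj₁ 1+M≡n) = ≡.subst (λ k → ∑ k t ∼ L.0#) (≡.sym (≡.trans 1+M≡n n≡)) (Root.periods e)
    sum M (inj₂ M≡m)   = ≡.subst (λ k → ∑ k t ∼ L.0#)
      (≡.trans (ℕₚ.+-suc (e′ ℕ.* o) p) (≡.cong suc (≡.sym (≡.trans M≡m m≡)))) (Root.half-periods e′)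
    q^n≈1 : q L.^ n ∼ L.1#
    q^n≈1 = ≡.subst (λ k → q L.^ k ∼ L.1#) (≡.sym n≡) (Root.q^eo≈1 e)
    qint-n≈0 : ι (qint n) ∼ L.0#
    qint-n≈0 = unit-zero (ι (qint n)) q-unit (L.trans (qint-eq n)
      (L.trans (L.+-congˡ {L.1#} (L.-‿cong q^n≈1)) (L.-‿inverseʳ L.1#)))
    rhs≈0 : right nonzero m L.* ι (qint n) ∼ L.0#
    rhs≈0 = L.trans (L.*-congˡ {right nonzero m} qint-n≈0) (L.zeroʳ (right nonzero m))

-- The congruence

open Divisibility P4R using (_,_)
open FinalRearrangements P4R

module ∂ = Derivative 3

-- By the derivative with respect to q, t divides the integer n + 1; it also divides 1 - q^(n+1),
-- and such a common divisor is a unit.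
squarefree : ∀ n t → t *P t ∣ 1P -P X (suc n) → t ∣ 1P
squarefree n t d = integer-coprime {t} n n
  (Derivation.square-divisor P4R ∂.∂ derivation qP ∂q≈1 (suc n) t d)
  (∣-trans {t} {t *P t} {1P -P X (suc n)} (∣-*ʳ {t} {t} t (∣-refl {t})) d)
  where
  derivation : IsDerivation P4R ∂.∂
  derivation = record { ∂-cong = ∂.∂-cong ; ∂-+ = ∂.∂-+ ; ∂-* = ∂.∂-* ; ∂-1 = ∷-zero ≋-refl ≋-refl }
  ∂q≈1 : ∂.∂ qP ≋ 1P
  ∂q≈1 = ∷-cong (+P-identityʳ 1P) (∷-zero ≋-refl ≋-refl)

qint-∣ : ∀ n → qint n ∣ 1P -P X n
qint-∣ n = (1P -P qP) , R.trans (R.sym (qint-geometric n)) (R.*-comm (1P -P qP) (qint n))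

-- At q = 1 the value of [n] is n. Hence a common divisor of [n] and 1 - q divides the integer n, so
-- [n] has no part with d = 1.
qint-mod : ∀ n → 1P -P X 1 ∣ qint n -P fromℤ (+ n)
qint-mod zero    = ∣-respʳ {1P -P X 1} (R.sym (R.-‿inverseʳ 0P)) (∣-0 {1P -P X 1})
qint-mod (suc n) = ∣-respʳ {1P -P X 1} {(qint n -P fromℤ (+ n)) -P (1P -P X n)} {qint (suc n) -P fromℤ (+ suc n)}
  (R.trans (R.sym (difference-step (qint n) (X n) (fromℤ (+ n))))
    (R.+-congʳ { -P fromℤ (+ suc n)} (+P-congˡ (qint n) (R.reflexive (≡.sym (^P≡^ n))))))
  (∣-minus {1P -P X 1} {qint n -P fromℤ (+ n)} {1P -P X n} (qint-mod n)
    (∣-respˡ {1P -P qP} {1P -P X 1} {1P -P X n} (R.+-congˡ {1P} (R.-‿cong (R.sym (R.*-identityʳ qP))))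
      (PowerDivisibility.1-x∣1-x^k P4R qP n)))

qint-coprime-1-q : ∀ n → Coprime (qint (suc n)) (1P -P X 1)
qint-coprime-1-q n t t∣N t∣1-q = integer-coprime {t} n 0
  (∣-difference {t} (qint (suc n)) (fromℤ (+ suc n)) (∣-trans t∣1-q (qint-mod (suc n))) t∣N) t∣1-q

parity : ∀ k → (Σ ℕ λ p → k ≡ p ℕ.+ p) ⊎ (Σ ℕ λ p → k ≡ suc (p ℕ.+ p))
parity zero    = inj₁ (0 , ≡.refl)
parity (suc k) with parity k
... | inj₁ (p , ≡.refl) = inj₂ (p , ≡.refl)
... | inj₂ (p , ≡.refl) = inj₁ (suc p , ≡.cong suc (≡.sym (ℕₚ.+-suc p p)))

even≢odd : ∀ i j → ¬ i ℕ.+ i ≡ suc (j ℕ.+ j)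
even≢odd (suc i) zero    e with ≡.trans (≡.sym (ℕₚ.+-suc i i)) (ℕₚ.suc-injective e)
... | ()
even≢odd (suc i) (suc j) e = even≢odd i j (ℕₚ.suc-injective (≡.trans (≡.sym (ℕₚ.+-suc i i))
  (≡.trans (ℕₚ.suc-injective e) (≡.cong suc (ℕₚ.+-suc j j)))))

double-injective : ∀ i j → i ℕ.+ i ≡ j ℕ.+ j → i ≡ j
double-injective zero    zero    e = ≡.refl
double-injective (suc i) (suc j) e = ≡.cong suc (double-injective i j
  (ℕₚ.suc-injective (≡.trans (≡.sym (ℕₚ.+-suc i i)) (≡.trans (ℕₚ.suc-injective e) (ℕₚ.+-suc j j)))))

-- Both factors of an odd number are odd; with e = 2e′ + 1 and d = 2p + 1, half of ed - 1 is e′d +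
-- p, so summing up to (n-1)/2 stops at half a period.
odd-factors : ∀ e d m → suc (m ℕ.+ m) ≡ e ℕ.* d →
  Σ ℕ λ e′ → Σ ℕ λ p → d ≡ suc (p ℕ.+ p) × m ≡ e′ ℕ.* d ℕ.+ p
odd-factors e d m eq with parity e | parity d
... | inj₁ (i , ≡.refl) | _ = ⊥-elim (even≢odd (i ℕ.* d) m (≡.sym (≡.trans eq (ℕₚ.*-distribʳ-+ d i i))))
... | inj₂ _ | inj₁ (p , ≡.refl) = ⊥-elim (even≢odd (e ℕ.* p) m (≡.sym (≡.trans eq (ℕₚ.*-distribˡ-+ e p p))))
... | inj₂ (e′ , ≡.refl) | inj₂ (p , ≡.refl) = e′ , p , ≡.refl , double-injective _ _
  (ℕₚ.suc-injective (≡.trans eq (rearrange e′ p)))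
  where
  rearrange : ∀ e p → suc (e ℕ.+ e) ℕ.* suc (p ℕ.+ p) ≡ suc ((e ℕ.* suc (p ℕ.+ p) ℕ.+ p) ℕ.+ (e ℕ.* suc (p ℕ.+ p) ℕ.+ p))
  rearrange = solve-∀

module _ (m M : ℕ) (M-cases : M ≡ m ℕ.+ m ⊎ M ≡ m) where

  private
    n : ℕ
    n = suc (m ℕ.+ m)
    D : Frac
    D = lhs M -F rhs n m
    D-den≉0 : ¬ den D ≋ 0P
    -- The denominator is the same for every modulus; `f₁ (suc M)` is chosen because its range of
    -- regular factors reaches M.
    D-den≉0 = Bridge.difference-den≉0 (f₁ (suc M)) (λ j → j ℕₚ.<? M) (f₁-regularities M) nonzero n m M (λ j j<M → j<M)

  modulus′ : P4
  modulus′ = qint n *P f₁ n *P f₂ n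

  module Reduced (g x′ y′ : P4) (g≉0 : ¬ g ≋ 0P) (num≈ : num D ≋ g *P x′) (den≈ : den D ≋ g *P y′) where

    factor-∣ : ∀ f → HasFactor f D → f ∣ x′
    factor-∣ f (y , z , regular , e) = regular x′
      (reduced-∣ *-cancelˡ {f} {num D} {den D} {y} {z} {g} {x′} {y′} g≉0 e num≈ den≈)

    qint-∣-numerator : qint n ∣ x′
    qint-∣-numerator = Splitting.N-∣ (polyGCDDomain 4) qP squarefree (m ℕ.+ m) {qint n} {x′} (qint-∣ n)
      (qint-coprime-1-q (m ℕ.+ m)) parts
      where
      parts : ∀ d → suc (suc d) ℕ-Div.∣ n → ∀ h → h ∣ 1P -P X (suc (suc d)) →
        (∀ j → suc j ℕ.< suc (suc d) → Coprime h (1P -P X (suc j))) → h ∣ x′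
      parts d (ℕ-Div.divides e n≡) h h∣ cop = go (odd-factors e (suc (suc d)) m n≡)
        where
        go : (Σ ℕ λ e′ → Σ ℕ λ p → suc (suc d) ≡ suc (p ℕ.+ p) × m ≡ e′ ℕ.* suc (suc d) ℕ.+ p) → h ∣ x′
        go (e′ , p , o≡ , m≡) = factor-∣ h (cyclotomic-factor p e e′
          -- The order is d + 2 = 2p + 1, so p is positive; this is what makes 1 - q invertible
          -- modulo h.
          (≡.subst (0 ℕ.<_) (ℕₚ.suc-injective o≡) (s≤s z≤n)) {h}
          (≡.subst (λ o → h ∣ 1P -P X o) o≡ h∣)
          (λ j j<o → cop j (≡.subst (suc j ℕ.<_) (≡.sym o≡) j<o)) n m
          (≡.trans n≡ (≡.cong (e ℕ.*_) o≡)) (≡.trans m≡ (≡.cong (λ o → e′ ℕ.* o ℕ.+ p) o≡))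
          M (Sum.map₁ (≡.cong suc) M-cases))

    -- The three factors are pairwise coprime: [n] divides 1 - qⁿ, which is free of a, and
    -- eliminating a between the two linear factors leaves 1 - q²ⁿ.
    modulus-∣-numerator : modulus′ ∣ x′
    modulus-∣-numerator = coprime-product-∣ {qint n *P f₁ n} {f₂ n} {x′}
      (coprime-sym {f₂ n} {qint n *P f₁ n} (coprime-* {f₂ n} {qint n} {f₁ n}
        (λ t t∣f t∣N → coprime-1-X (f₂≉0 n) (f₂↦1 n) (m ℕ.+ m) t t∣f (∣-trans t∣N (qint-∣ n)))
        (coprime-sym {f₁ n} {f₂ n} (f₁-f₂-coprime (m ℕ.+ m)))))
      (coprime-product-∣ {qint n} {f₁ n} {x′}
        (λ t t∣N t∣f → coprime-1-X (f₁≉0 n) (f₁↦1 n) (m ℕ.+ m) t t∣f (∣-trans t∣N (qint-∣ n)))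
        qint-∣-numerator (factor-∣ (f₁ n) (f₁-factor m M M-cases)))
      (factor-∣ (f₂ n) (f₂-factor m M M-cases))

    congruence : ¬ y′ ≋ 0P → Coprime x′ y′ → modulus′ ∣ x′ → CongMod (lhs M) (rhs n m) modulus′
    congruence y′≉0 cop (r , x′≈) = r , y′ , (λ z → y′≉0 (coeffs z)) ,
      (λ h (k , e) (l , e′) → to-unit h (cop h (∣-respʳ {h} (R.sym x′≈) (k , coeffs e)) (l , coeffs e′))) ,
      coeffwise (reduced-cross {num D} {den D} {g} {x′} {y′} (modulus′ *P r) num≈ den≈ x′≈)
      where
      to-unit : ∀ h → h ∣ 1P → IsUnitP h
      to-unit h (u , e) = u , coeffwise (R.sym e)

  theorem′ : CongMod (lhs M) (rhs n m) modulus′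
  theorem′ = from (reduce (num D) {den D} D-den≉0)
    where
    from : (Σ P4 λ g → Σ P4 λ x′ → Σ P4 λ y′ →
           ¬ g ≋ 0P × num D ≋ g *P x′ × den D ≋ g *P y′ × Coprime x′ y′) → CongMod (lhs M) (rhs n m) modulus′
    from (g , x′ , y′ , g≉0 , num≈ , den≈ , cop) = congruence y′≉0 cop modulus-∣-numerator
      where
      open Reduced g x′ y′ g≉0 num≈ den≈
      y′≉0 : ¬ y′ ≋ 0P
      y′≉0 z = D-den≉0 (R.trans den≈ (R.trans (R.*-congˡ {g} z) (R.zeroʳ g)))

open import Data.Nat using (_+_; _*_; _∸_)

theorem6p1 : (n m M : ℕ) → n ≡ 2 * m + 1 → (M ≡ n ∸ 1 ⊎ M ≡ m) →
    CongMod (lhs M) (rhs n m) (modulus n)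
theorem6p1 n m M n≡ M≡ = transport n (≡.trans n≡ (odd m)) M≡
  where
  odd : ∀ m → 2 * m + 1 ≡ suc (m + m)
  odd = solve-∀
  modulus≡ : ∀ n → qint n *P f₁ n *P f₂ n ≡ modulus n
  modulus≡ n = ≡.cong (λ x → qint n *P (1P -P (aP *P x)) *P (aP -P x)) (≡.sym (^P≡^ n))
  transport : ∀ n → n ≡ suc (m + m) → (M ≡ n ∸ 1 ⊎ M ≡ m) → CongMod (lhs M) (rhs n m) (modulus n)
  transport _ ≡.refl M-cases = ≡.subst (CongMod (lhs M) (rhs (suc (m + m)) m)) (modulus≡ (suc (m + m)))
    (theorem′ m M M-cases)
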